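{- All of the following tuples are universal: $(12,4,3,1,2,0)$, $(12,4,6,4,6,2)$, $(12,8,3,1,3,1)$, $(12,6,8,2,3,1)$, $(12,6,8,6,3,1)$, $(12,8,3,1,2,0)$, $(12,8,5,3,5,1)$, $(12,8,4,2,4,2)$, $(12,8,8,4,2,0)$, $(12,8,8,4,3,1)$, $(12,8,12,4,2,0)$.
   Context: For $a_1,b_1,c_1$ positive integers and $a_2,b_2,c_2$ integers with $a_1-a_2$, $b_1-b_2$, $c_1-c_2$ all even, the tuple $(a_1,a_2,b_1,b_2,c_1,c_2)$ is called universal if every nonnegative integer $n$ can be written as $\frac{x(a_1x+a_2)}2+\frac{y(b_1y+b_2)}2+\frac{z(c_1z+c_2)}2$ with $x,y,z\in\mathbb{Z}$. -}

module Defs where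

open import Data.Nat using (ℕ)
open import Data.Integer using (ℤ; +_; _+_; _*_)
open import Data.Product using (∃; ∃-syntax; _×_; _,_)
open import Relation.Binary.PropositionalEquality using (_≡_)

-- Generalized polygonal-type value  x(a₁x+a₂)/2, recorded here via its
-- numerator  x(a₁x+a₂)  (the division by 2 is handled by doubling n below).
numer : ℤ → ℤ → ℤ → ℤ
numer a₁ a₂ x = x * (a₁ * x + a₂)

-- The tuple (a₁,a₂,b₁,b₂,c₁,c₂) is universal: every n ∈ ℕ equals
--   x(a₁x+a₂)/2 + y(b₁y+b₂)/2 + z(c₁z+c₂)/2  for some x y z ∈ ℤ,
-- written equivalently (multiplying by 2) as
--   2n = x(a₁x+a₂) + y(b₁y+b₂) + z(c₁z+c₂).
Universal : ℤ → ℤ → ℤ → ℤ → ℤ → ℤ → Set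
Universal a₁ a₂ b₁ b₂ c₁ c₂ =
  (n : ℕ) → ∃[ x ] ∃[ y ] ∃[ z ]
    (+ 2 * + n ≡ numer a₁ a₂ x + numer b₁ b₂ y + numer c₁ c₂ z)

{-# OPTIONS --safe #-}

-- Completing the squares turns each tuple into the statement that a diagonal ternary form represents an arithmetic
-- progression, and all of these follow from two facts: every m ≡ 2 (mod 4) is a sum of three squares, and
-- x² + y² + 3z² represents 12t + 10, 24t + 23 and 3(24t + 22).
--
-- Suppose -δ is a square modulo q, where δ = m or δ = 3m and s²q lies in a suitable residue class modulo 8δ. Then an
-- explicit positive ternary form of determinant 1 or 3 represents the number in question; Hermite reduction leaves one
-- class of determinant 1 and two of determinant 3, one of which is excluded by a 3-adic condition.
--
-- To find s²q, let χ be the Kronecker symbol (-δ / ·), periodic modulo Q = 8δ by quadratic reciprocity, and let f(n) be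
-- the sum of χ over the divisors of n. Then f ≥ 0, and f(n) > 0 only if n = s²q as required. By Dirichlet's hyperbola
-- method the sums of f over the n ≤ Z² with n ≡ a and with n ≡ 1 (mod Q) differ by at most 3Z when χ(a) = 1. The second
-- sum is larger than 3Z for a suitable Z because f ≥ 1 at the many values x² + δy² with x ≡ 1 (mod Q) and y a power of
-- Q. Hence the first sum is not zero. No theorem on primes in arithmetic progressions is needed.

module Submission where

open import Defs
open import Level using (0ℓ)
open import Data.Nat
open import Data.Nat.Properties
open import Data.Nat.Induction using (<-rec)
open import Data.Nat.DivMod
open import Data.Nat.Divisibility using (_∣_; divides; _∤_; _∣?_; ∣⇒≤; m%n≡0⇒n∣m; n∣m⇒m%n≡0; ∣m∣n⇒∣m+n; ∣m+n∣m⇒∣n; n∣m*n; m∣m*n; ∣-trans; ∣-refl; ∣1⇒≡1; ∣m⇒∣m*n; ∣n⇒∣m*n; *-monoˡ-∣; *-monoʳ-∣; *-cancelˡ-∣)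
open import Data.Nat.Coprimality using (Coprime; coprime-divisor; coprime?; coprime-Bézout; prime⇒coprime) renaming (sym to cop-sym)
open import Data.Nat.GCD using (module Bézout)
open import Data.Nat.Primality using (Prime; euclidsLemma; prime⇒nonZero; prime⇒nonTrivial; prime⇒irreducible)
open import Data.Nat.Primality.Factorisation using (factorise)
open import Data.Integer using (ℤ; +_; -[1+_]) renaming (_+_ to _⊕_; _*_ to _⊗_; _-_ to _⊖_; -_ to ⊝_)
import Data.Integer as ℤ
import Data.Integer.Properties as ℤ
import Data.Integer.DivMod as ℤ
open import Data.Integer.Divisibility.Signed using (∣ᵤ⇒∣) renaming (divides to ℤdivides)
open import Data.Nat.Tactic.RingSolver using () renaming (solve-∀ to ring-ℕ)
open import Data.Integer.Tactic.RingSolver using () renaming (solve-∀ to ring-ℤ)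
open import Data.Sign as Sign using (Sign)
import Data.Sign.Properties as Sign
open import Data.Fin as Fin using (Fin; toℕ; fromℕ<; punchIn; punchOut; opposite)
import Data.Fin.Properties as Fin
open import Data.List.Base using ([]; _∷_)
open import Data.List.Relation.Unary.All using (_∷_)
open import Data.Vec.Base using (Vec; []; _∷_; replicate)
open import Data.Product
open import Data.Sum using (_⊎_; inj₁; inj₂)
open import Data.Empty using (⊥; ⊥-elim)
open import Relation.Nullary using (¬_; Dec; yes; no)
open import Relation.Nullary.Decidable using (from-yes; from-no; ¬?; _×-dec_; _⊎-dec_; _→-dec_)
open import Relation.Binary.Definitions using (tri<; tri≈; tri>)
open import Relation.Binary.PropositionalEquality hiding (J)
open import Algebra.Bundles using (CommutativeMonoid)
import Algebra.Properties.CommutativeMonoid.Sum as CMSum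
open import Function using (_∘_; case_of_)

-- The error 3Z is linear in Z, while the special values win by a logarithm: up to Z there are about
-- Z / Q admissible x, and for each of them the number of usable powers y of Q grows like log Z. Any
-- fixed number of y per x can therefore be reached; slightly more than 6Q suffices when only the
-- upper half of the range of x is used. Powers of Q are taken for y because they are prime to every
-- divisor of a number prime to Q, which makes χ equal to 1 on all divisors of x² + δy².
--
-- Positivity of f only says that primes with χ = -1 have even exponent, whence n = s²q in place of
-- a prime. The ternary form has s as a parameter, so that only q needs a root; q is built from
-- distinct primes, so roots are glued by the Chinese remainder theorem and never lifted to prime
-- powers.
--
-- The squares must finally meet congruences such as y ≡ ±1 (mod 6). Conditions at 2 are forced by
-- residues modulo small powers of 2. At 3 and 5 they are not always forced, and a bad
-- representation is repaired by a similitude of factor 9 or 25.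

module _ (M : CommutativeMonoid 0ℓ 0ℓ) where
  open CommutativeMonoid M renaming (refl to ≈-refl; sym to ≈-sym; trans to ≈-trans)
  open CMSum M using (sum; sum-remove; sum-cong-≗)

  -- Induction: the term at `π 0` is split off and the other indices are punched out around it, so
  -- injectivity alone serves and no inverse of π is constructed.
  sum-injective : ∀ {n} (g : Fin n → Carrier) (π : Fin n → Fin n) →
    (∀ {i j} → π i ≡ π j → i ≡ j) → sum (g ∘ π) ≈ sum g
  sum-injective {zero} g π inj = ≈-refl
  sum-injective {suc n} g π inj =
    ≈-trans (∙-cong ≈-refl (≈-trans
      (reflexive (sum-cong-≗ {n} λ i → cong g (sym (Fin.punchIn-punchOut (π0≢ i)))))
      (sum-injective (g ∘ punchIn (π Fin.zero)) π′ π′-inj)))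
      (≈-sym (sum-remove {i = π Fin.zero} g))
    where
    π0≢ : ∀ i → π Fin.zero ≢ π (Fin.suc i)
    π0≢ i e = case inj e of λ ()
    π′ : Fin n → Fin n
    π′ i = punchOut (π0≢ i)
    π′-inj : ∀ {i j} → π′ i ≡ π′ j → i ≡ j
    π′-inj {i} {j} e = Fin.suc-injective (inj (Fin.punchOut-injective (π0≢ i) (π0≢ j) e))

-- Half-systems and Jacobi symbols

⟦_⟧ : Sign → ℤ
⟦ Sign.+ ⟧ = + 1
⟦ Sign.- ⟧ = -[1+ 0 ]

⟦⟧-* : ∀ s t → ⟦ s Sign.* t ⟧ ≡ ⟦ s ⟧ ⊗ ⟦ t ⟧
⟦⟧-* Sign.+ t = sym (ℤ.*-identityˡ _)
⟦⟧-* Sign.- Sign.+ = refl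
⟦⟧-* Sign.- Sign.- = refl

infix 4 _≈_[_]
-- Congruence that carries its quotient, so that each closure property is a single ring identity.
record _≈_[_] (a b n : ℤ) : Set where
  constructor via
  field
    quot : ℤ
    shift : a ≡ b ⊕ quot ⊗ n

module _ {n : ℤ} where
  ≈-refl : ∀ {a} → a ≈ a [ n ]
  ≈-refl {a} = via (+ 0) (lem a n)
    where lem : ∀ a n → a ≡ a ⊕ + 0 ⊗ n
          lem = ring-ℤ
  ≈-sym : ∀ {a b} → a ≈ b [ n ] → b ≈ a [ n ]
  ≈-sym {a} {b} (via q e) = via (⊝ q) (trans (lem b q n) (cong (λ x → x ⊕ (⊝ q) ⊗ n) (sym e)))
    where lem : ∀ b q n → b ≡ b ⊕ q ⊗ n ⊕ (⊝ q) ⊗ n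
          lem = ring-ℤ
  ≈-trans : ∀ {a b c} → a ≈ b [ n ] → b ≈ c [ n ] → a ≈ c [ n ]
  ≈-trans {a} {b} {c} (via q e) (via r f) = via (r ⊕ q) (trans e (trans (cong (λ x → x ⊕ q ⊗ n) f) (lem c r q n)))
    where lem : ∀ c r q n → c ⊕ r ⊗ n ⊕ q ⊗ n ≡ c ⊕ (r ⊕ q) ⊗ n
          lem = ring-ℤ
  ≈-* : ∀ {a b c d} → a ≈ b [ n ] → c ≈ d [ n ] → a ⊗ c ≈ b ⊗ d [ n ]
  ≈-* {a} {b} {c} {d} (via q e) (via r f) = via (b ⊗ r ⊕ q ⊗ d ⊕ q ⊗ r ⊗ n) (trans (cong₂ _⊗_ e f) (lem b q d r n))
    where lem : ∀ b q d r n → (b ⊕ q ⊗ n) ⊗ (d ⊕ r ⊗ n) ≡ b ⊗ d ⊕ (b ⊗ r ⊕ q ⊗ d ⊕ q ⊗ r ⊗ n) ⊗ n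
          lem = ring-ℤ
  ≈-*ˡ : ∀ a {c d} → c ≈ d [ n ] → a ⊗ c ≈ a ⊗ d [ n ]
  ≈-*ˡ a {c} {d} = ≈-* {a} {a} {c} {d} (≈-refl {a})
  ≈-reflexive : ∀ {a b} → a ≡ b → a ≈ b [ n ]
  ≈-reflexive {a} refl = ≈-refl {a}

small-multiple : ∀ z q n → z ≡ q ⊗ + n → ℤ.∣ z ∣ < n → z ≡ + 0
small-multiple z q n e lt = go ℤ.∣ q ∣ refl
  where
  open ≤-Reasoning
  go : ∀ k → ℤ.∣ q ∣ ≡ k → z ≡ + 0
  go zero eq = trans e (trans (cong (_⊗ + n) (ℤ.∣i∣≡0⇒i≡0 {q} eq)) (ℤ.*-zeroˡ (+ n)))
  go (suc k) eq = ⊥-elim (<⇒≱ lt (begin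
    n ≤⟨ m≤n*m n (suc k) ⟩
    suc k * n ≡⟨ cong (_* n) (sym eq) ⟩
    ℤ.∣ q ∣ * n ≡⟨ sym (ℤ.abs-* q (+ n)) ⟩
    ℤ.∣ q ⊗ + n ∣ ≡⟨ cong ℤ.∣_∣ (sym e) ⟩
    ℤ.∣ z ∣ ∎))

odd : ℕ → ℕ
odd h = suc (2 * h)

-- `sgn` and `res` are the sign and the modulus of the residue of c of least absolute value. A
-- multiple of `odd h` gets the sign +.
sgn : ℕ → ℕ → Sign
sgn h c with c % odd h ≤? h
... | yes _ = Sign.+
... | no _ = Sign.-

res : ℕ → ℕ → ℕ
res h c with c % odd h ≤? h
... | yes _ = c % odd h
... | no _ = odd h ∸ c % odd h

-- Membership of k in the half-system 1, ..., h with c ≡ ±k. By `half-unique`, any such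
-- representation, however found, determines the sign of c.
record HalfRep (h c : ℕ) (s : Sign) (k : ℕ) : Set where
  constructor half
  field
    low : 1 ≤ k
    high : k ≤ h
    cong-eq : + c ≈ ⟦ s ⟧ ⊗ + k [ + odd h ]

open HalfRep

+-cast : ∀ a b n q → a ≡ b + q * n → + a ≡ + b ⊕ + q ⊗ + n
+-cast a b n q e = trans (cong +_ e) (trans (ℤ.pos-+ b (q * n)) (cong (_⊕_ (+ b)) (ℤ.pos-* q n)))

halfRep : ∀ h c → odd h ∤ c → HalfRep h c (sgn h c) (res h c)
halfRep h c nd with c % odd h ≤? h
... | yes r≤h = half (n≢0⇒n>0 λ e → nd (m%n≡0⇒n∣m c (odd h) e)) r≤h
      (via (+ (c / odd h)) (trans (+-cast c (c % odd h) (odd h) (c / odd h) (m≡m%n+[m/n]*n c (odd h)))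
        (cong (_⊕ + (c / odd h) ⊗ + odd h) (sym (ℤ.*-identityˡ (+ (c % odd h)))))))
... | no r≰h = half (m<n⇒0<n∸m r<n) le
      (via (+ suc (c / odd h)) eq)
  where
  r = c % odd h
  r<n : r < odd h
  r<n = m%n<n c (odd h)
  le : odd h ∸ r ≤ h
  le = begin
    odd h ∸ r ≤⟨ ∸-monoʳ-≤ (odd h) (≰⇒> r≰h) ⟩
    odd h ∸ suc h ≡⟨ cong (λ x → h + x ∸ h) (+-identityʳ h) ⟩
    h + h ∸ h ≡⟨ m+n∸n≡m h h ⟩
    h ∎
    where open ≤-Reasoning
  eq0 : c + (odd h ∸ r) ≡ 0 + suc (c / odd h) * odd h
  eq0 = begin
    c + (odd h ∸ r) ≡⟨ cong (_+ (odd h ∸ r)) (m≡m%n+[m/n]*n c (odd h)) ⟩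
    r + (c / odd h) * odd h + (odd h ∸ r) ≡⟨ lem r ((c / odd h) * odd h) (odd h ∸ r) ⟩
    (r + (odd h ∸ r)) + (c / odd h) * odd h ≡⟨ cong (_+ (c / odd h) * odd h) (m+[n∸m]≡n (<⇒≤ r<n)) ⟩
    suc (c / odd h) * odd h ∎
    where open ≡-Reasoning
          lem : ∀ a b c → a + b + c ≡ a + c + b
          lem = ring-ℕ
  eq : + c ≡ -[1+ 0 ] ⊗ + (odd h ∸ r) ⊕ + suc (c / odd h) ⊗ + odd h
  eq = trans (lem (+ c) (+ (odd h ∸ r))) (cong (_⊕_ (-[1+ 0 ] ⊗ + (odd h ∸ r)))
         (trans (sym (ℤ.pos-+ c _)) (trans (+-cast _ 0 (odd h) (suc (c / odd h)) eq0) (ℤ.+-identityˡ _))))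
    where lem : ∀ a b → a ≡ -[1+ 0 ] ⊗ b ⊕ (a ⊕ b)
          lem = ring-ℤ

h+h<odd : ∀ {h k k′} → k ≤ h → k′ ≤ h → k + k′ < odd h
h+h<odd {h} {k} {k′} a b = s≤s (subst (λ x → k + k′ ≤ x) (cong (λ x → h + x) (sym (+-identityʳ h))) (+-mono-≤ a b))

half-unique : ∀ {h c s k s′ k′} → HalfRep h c s k → HalfRep h c s′ k′ → s ≡ s′ × k ≡ k′
half-unique {h} {c} {s} {k} {s′} {k′} (half l u (via q e)) (half l′ u′ (via q′ e′)) = go s s′ key small
  where
  z = ⟦ s ⟧ ⊗ + k ⊖ ⟦ s′ ⟧ ⊗ + k′
  zeq : z ≡ (q′ ⊖ q) ⊗ + odd h
  zeq = trans (lem (⟦ s ⟧ ⊗ + k) (⟦ s′ ⟧ ⊗ + k′) q q′ (+ odd h))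
          (trans (cong (λ x → x ⊕ _) (trans (cong₂ _⊖_ (sym e) (sym e′)) (ℤ.+-inverseʳ (+ c))))
                 (ℤ.+-identityˡ _))
    where lem : ∀ x y q q′ n → x ⊖ y ≡ ((x ⊕ q ⊗ n) ⊖ (y ⊕ q′ ⊗ n)) ⊕ (q′ ⊖ q) ⊗ n
          lem = ring-ℤ
  unit : ∀ s k → ℤ.∣ ⟦ s ⟧ ⊗ + k ∣ ≡ k
  unit Sign.+ k = trans (ℤ.abs-* (+ 1) (+ k)) (+-identityʳ k)
  unit Sign.- k = trans (ℤ.abs-* -[1+ 0 ] (+ k)) (+-identityʳ k)
  small : ℤ.∣ z ∣ < odd h
  small = ≤-<-trans (ℤ.∣i-j∣≤∣i∣+∣j∣ (⟦ s ⟧ ⊗ + k) (⟦ s′ ⟧ ⊗ + k′))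
    (subst₂ (λ a b → a + b < odd h) (sym (unit s k)) (sym (unit s′ k′)) (h+h<odd u u′))
  key : ⟦ s ⟧ ⊗ + k ≡ ⟦ s′ ⟧ ⊗ + k′
  key = ℤ.i-j≡0⇒i≡j _ _ (small-multiple z (q′ ⊖ q) (odd h) zeq small)
  1*_ : ∀ x → + 1 ⊗ + x ≡ + x
  1* x = ℤ.*-identityˡ (+ x)
  nonneg≢neg : ∀ {a b} → 1 ≤ b → + 1 ⊗ + a ≡ -[1+ 0 ] ⊗ + b → ⊥
  nonneg≢neg {a} {suc b} _ eq = case trans (sym (1* a)) (trans eq (cong ⊝_ (1* suc b))) of λ ()
  go : ∀ s s′ → ⟦ s ⟧ ⊗ + k ≡ ⟦ s′ ⟧ ⊗ + k′ → ℤ.∣ z ∣ < odd h → s ≡ s′ × k ≡ k′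
  go Sign.+ Sign.+ eq _ = refl , ℤ.+-injective (trans (sym (1* k)) (trans eq (1* k′)))
  go Sign.+ Sign.- eq _ = ⊥-elim (nonneg≢neg l′ eq)
  go Sign.- Sign.+ eq _ = ⊥-elim (nonneg≢neg l (sym eq))
  go Sign.- Sign.- eq _ = refl , ℤ.+-injective (ℤ.*-cancelˡ-≡ -[1+ 0 ] (+ k) (+ k′) eq)

open HalfRep
module SignSum = CMSum Sign.*-commutativeMonoid

∏ : ∀ n → (Fin n → Sign) → Sign
∏ n f = SignSum.sum {n} f

∏-cong : ∀ n {f g : Fin n → Sign} → (∀ i → f i ≡ g i) → ∏ n f ≡ ∏ n g
∏-cong n = SignSum.sum-cong-≗ {n}

∏-distrib : ∀ n (f g : Fin n → Sign) → ∏ n (λ i → f i Sign.* g i) ≡ ∏ n f Sign.* ∏ n g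
∏-distrib n = SignSum.∑-distrib-+ {n}

∏-comm : ∀ m n (f : Fin m → Fin n → Sign) → ∏ m (λ i → ∏ n (f i)) ≡ ∏ n (λ j → ∏ m (λ i → f i j))
∏-comm m n = SignSum.∑-comm {m} {n}

∏-one : ∀ n → ∏ n (λ _ → Sign.+) ≡ Sign.+
∏-one = SignSum.sum-replicate-zero

coprime-* : ∀ {a b n} → Coprime a n → Coprime b n → Coprime (a * b) n
coprime-* {a} {b} {n} ca cb {d} (d∣ab , d∣n) =
  cb (coprime-divisor {d} {a} {b} (λ { (e∣d , e∣a) → ca (e∣a , ∣-trans e∣d d∣n) }) d∣ab , d∣n)

coprime-*ˡ : ∀ {a b n} → Coprime (a * b) n → Coprime a n
coprime-*ˡ {a} {b} c (d∣a , d∣n) = c (∣-trans d∣a (m∣m*n b) , d∣n)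

coprime-*ʳ : ∀ {a b n} → Coprime (a * b) n → Coprime b n
coprime-*ʳ {a} {b} c (d∣b , d∣n) = c (∣-trans d∣b (n∣m*n a) , d∣n)

≈⇒∣ : ∀ {n x y} → x ≈ y [ + n ] → n ∣ ℤ.∣ x ⊖ y ∣
≈⇒∣ {n} {x} {y} (via q e) = divides ℤ.∣ q ∣ (trans (cong ℤ.∣_∣ (trans (cong (_⊖ y) e) (lem y (q ⊗ + n))))
    (ℤ.abs-* q (+ n)))
  where lem : ∀ y z → y ⊕ z ⊖ y ≡ z
        lem = ring-ℤ

∣⇒≈ : ∀ {n x y} → n ∣ ℤ.∣ x ⊖ y ∣ → x ≈ y [ + n ]
∣⇒≈ {n} {x} {y} d with ∣ᵤ⇒∣ {+ n} {x ⊖ y} d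
... | ℤdivides q e = via q (trans (lem x y) (cong (_⊕_ y) e))
  where lem : ∀ x y → x ≡ y ⊕ (x ⊖ y)
        lem = ring-ℤ

≈-cancelˡ : ∀ {n} a {x y} → Coprime a n → + a ⊗ x ≈ + a ⊗ y [ + n ] → x ≈ y [ + n ]
≈-cancelˡ {n} a {x} {y} c eq = ∣⇒≈ {n} {x} {y} (coprime-divisor {n} {a} (cop-sym c)
  (subst (n ∣_) (trans (cong ℤ.∣_∣ (lem (+ a) x y)) (ℤ.abs-* (+ a) (x ⊖ y))) (≈⇒∣ eq)))
  where lem : ∀ a x y → a ⊗ x ⊖ a ⊗ y ≡ a ⊗ (x ⊖ y)
        lem = ring-ℤ

halfRep-* : ∀ {h a b s k s′ k′} → HalfRep h b s k → HalfRep h (a * k) s′ k′ → HalfRep h (a * b) (s Sign.* s′) k′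
halfRep-* {h} {a} {b} {s} {k} {s′} {k′} (half _ _ e) (half l u e′) = half l u
  (≈-trans (≈-reflexive (ℤ.pos-* a b)) (≈-trans (≈-*ˡ (+ a) e) (≈-trans (≈-reflexive eq)
    (≈-trans (≈-*ˡ ⟦ s ⟧ e′) (≈-reflexive eq′)))))
  where
  eq : + a ⊗ (⟦ s ⟧ ⊗ + k) ≡ ⟦ s ⟧ ⊗ + (a * k)
  eq = trans (lem (+ a) ⟦ s ⟧ (+ k)) (cong (_⊗_ ⟦ s ⟧) (sym (ℤ.pos-* a k)))
    where lem : ∀ a s k → a ⊗ (s ⊗ k) ≡ s ⊗ (a ⊗ k)
          lem = ring-ℤ
  eq′ : ⟦ s ⟧ ⊗ (⟦ s′ ⟧ ⊗ + k′) ≡ ⟦ s Sign.* s′ ⟧ ⊗ + k′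
  eq′ = trans (sym (ℤ.*-assoc ⟦ s ⟧ ⟦ s′ ⟧ (+ k′))) (cong (_⊗ + k′) (sym (⟦⟧-* s s′)))

1+_ : ∀ {h} → Fin h → ℕ
1+ i = suc (toℕ i)

1+≤ : ∀ {h} (i : Fin h) → 1+ i ≤ h
1+≤ = Fin.toℕ<n

h<odd : ∀ h → h < odd h
h<odd h = s≤s (m≤m+n h (1 * h))

-- The Jacobi symbol (a / odd h) in the form of the Gauss-Schering lemma, which needs no factorisation of odd h.
J : ℕ → ℕ → Sign
J a h = ∏ h λ i → sgn h (a * 1+ i)

odd∤ : ∀ {h a k} → Coprime a (odd h) → 1 ≤ k → k ≤ h → odd h ∤ a * k
odd∤ {h} {a} {suc k} c l u d = <⇒≱ (h<odd h) (≤-trans (∣⇒≤ (coprime-divisor {odd h} {a} (cop-sym c) d)) u)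

repOf : ∀ {h a} → Coprime a (odd h) → (i : Fin h) → HalfRep h (a * 1+ i) (sgn h (a * 1+ i)) (res h (a * 1+ i))
repOf {h} {a} c i = halfRep h (a * 1+ i) (odd∤ {h} {a} c (s≤s z≤n) (1+≤ i))

module _ {h a : ℕ} (c : Coprime a (odd h)) where
  pred-bound : ∀ (k : ℕ) → 1 ≤ k → k ≤ h → pred k < h
  pred-bound (suc k) _ u = u

  shuffle : Fin h → Fin h
  shuffle i = fromℕ< (pred-bound (res h (a * 1+ i)) (low (repOf c i)) (high (repOf c i)))

  1+shuffle : ∀ i → 1+ shuffle i ≡ res h (a * 1+ i)
  1+shuffle i = trans (cong suc (Fin.toℕ-fromℕ< _)) (suc-pred (res h (a * 1+ i)) {{>-nonZero (low (repOf c i))}})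

  repShuffle : ∀ i → HalfRep h (a * 1+ i) (sgn h (a * 1+ i)) (1+ shuffle i)
  repShuffle i = subst (HalfRep h (a * 1+ i) _) (sym (1+shuffle i)) (repOf c i)

  ≈-*-halves : ∀ {s t i j k} → + (a * 1+ i) ≈ ⟦ s ⟧ ⊗ k [ + odd h ] → + (a * 1+ j) ≈ ⟦ t ⟧ ⊗ k [ + odd h ] →
    + (1+_ {h} i) ≈ ⟦ s Sign.* t ⟧ ⊗ + (1+_ {h} j) [ + odd h ]
  ≈-*-halves {s} {t} {i} {j} {k} ei ej = ≈-cancelˡ a {+ (1+ i)} c
    (≈-trans (≈-reflexive (sym (ℤ.pos-* a (1+ i)))) (≈-trans ei (≈-trans (≈-reflexive (eq s t))
      (≈-trans (≈-*ˡ ⟦ s Sign.* t ⟧ (≈-sym ej)) (≈-reflexive eq′)))))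
    where
    eq : ∀ s t → ⟦ s ⟧ ⊗ k ≡ ⟦ s Sign.* t ⟧ ⊗ (⟦ t ⟧ ⊗ k)
    eq s t = trans (cong (λ x → ⟦ x ⟧ ⊗ k) (trans (sym (Sign.*-identityʳ s))
        (trans (cong (s Sign.*_) (sym (Sign.s*s≡+ t))) (sym (Sign.*-assoc s t t)))))
               (trans (cong (_⊗ k) (⟦⟧-* (s Sign.* t) t)) (ℤ.*-assoc ⟦ s Sign.* t ⟧ ⟦ t ⟧ k))
    eq′ : ⟦ s Sign.* t ⟧ ⊗ + (a * 1+ j) ≡ + a ⊗ (⟦ s Sign.* t ⟧ ⊗ + (1+ j))
    eq′ = trans (cong (_⊗_ ⟦ s Sign.* t ⟧) (ℤ.pos-* a (1+ j))) (lem ⟦ s Sign.* t ⟧ (+ a) (+ (1+ j)))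
      where lem : ∀ x y z → x ⊗ (y ⊗ z) ≡ y ⊗ (x ⊗ z)
            lem = ring-ℤ

  -- If ai and aj agree up to sign, so do i and j after cancelling a, and two members of the
  -- half-system that agree up to sign are equal.
  shuffle-injective : ∀ {i j} → shuffle i ≡ shuffle j → i ≡ j
  shuffle-injective {i} {j} e = Fin.toℕ-injective (suc-injective
      (proj₂ (half-unique {h} {1+ i} {Sign.+} {1+ i} {sgn h (a * 1+ i) Sign.* sgn h (a * 1+ j)}
      (half (s≤s z≤n) (1+≤ i) (≈-reflexive (sym (ℤ.*-identityˡ (+ (1+ i))))))
      (half (s≤s z≤n) (1+≤ j) (≈-*-halves {sgn h (a * 1+ i)} {sgn h (a * 1+ j)} (cong-eq (repShuffle i))
        (subst (λ x → + (a * 1+ j) ≈ ⟦ sgn h (a * 1+ j) ⟧ ⊗ + (1+ x) [ + odd h ]) (sym e) (cong-eq (repShuffle j))))))))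

-- Replace b·i by ±k in the half-system and then a·k by its representative: the two signs multiply,
-- and k runs through the whole half-system because multiplication by b only permutes it.
J-* : ∀ a b h → Coprime a (odd h) → Coprime b (odd h) → J (a * b) h ≡ J a h Sign.* J b h
J-* a b h ca cb = begin
  ∏ h (λ i → sgn h (a * b * 1+ i))
    ≡⟨ ∏-cong h (λ i → sym (proj₁ (half-unique (subst (λ x → HalfRep h x
        (sgn h (b * 1+ i) Sign.* sgn h (a * 1+ shuffle {h} cb i)) (res h (a * 1+ shuffle {h} cb i)))
        (sym (*-assoc a b (1+ i)))
          (halfRep-* {h} {a} {b * 1+ i} {sgn h (b * 1+ i)} {s′ = sgn h (a * 1+ shuffle {h} cb i)} (repShuffle cb i)
              (repOf ca (shuffle {h} cb i)))) (repOf {h} {a * b} (coprime-* {a} {b} ca cb) i)))) ⟩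
  ∏ h (λ i → sgn h (b * 1+ i) Sign.* sgn h (a * 1+ shuffle {h} cb i))
    ≡⟨ ∏-distrib h (λ i → sgn h (b * 1+ i)) (λ i → sgn h (a * 1+ shuffle {h} cb i)) ⟩
  J b h Sign.* ∏ h (λ i → sgn h (a * 1+ shuffle {h} cb i))
    ≡⟨ cong (J b h Sign.*_) (sum-injective Sign.*-commutativeMonoid (λ i → sgn h (a * 1+ i)) (shuffle {h} cb)
        (shuffle-injective {h} {b} cb)) ⟩
  J b h Sign.* J a h ≡⟨ Sign.*-comm (J b h) (J a h) ⟩
  J a h Sign.* J b h ∎
  where open ≡-Reasoning

sgn-mod : ∀ h c d → c % odd h ≡ d % odd h → sgn h c ≡ sgn h d
sgn-mod h c d e with c % odd h ≤? h | d % odd h ≤? h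
... | yes _ | yes _ = refl
... | no _ | no _ = refl
... | yes p | no q = ⊥-elim (q (subst (_≤ h) e p))
... | no p | yes q = ⊥-elim (p (subst (_≤ h) (sym e) q))

J-mod : ∀ a b h → a % odd h ≡ b % odd h → J a h ≡ J b h
J-mod a b h e = ∏-cong h λ i → sgn-mod h (a * 1+ i) (b * 1+ i) (trans (%-distribˡ-* a (1+ i) (odd h))
  (trans (cong (λ x → (x * (1+ i % odd h)) % odd h) e) (sym (%-distribˡ-* b (1+ i) (odd h)))))

J-one : ∀ h → J 1 h ≡ Sign.+
J-one h = trans (∏-cong h λ i → small i) (∏-one h)
  where
  small : ∀ (i : Fin h) → sgn h (1 * 1+ i) ≡ Sign.+
  small i with (1 * 1+ i) % odd h ≤? h
  ... | yes _ = refl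
  ... | no q = ⊥-elim (q (subst (_≤ h) (sym (trans (cong (_% odd h) (*-identityˡ (1+ i)))
      (m<n⇒m%n≡m (≤-<-trans (1+≤ i) (h<odd h))))) (1+≤ i)))

J-square : ∀ a h → Coprime a (odd h) → J (a * a) h ≡ Sign.+
J-square a h c = trans (J-* a a h c c) (Sign.s*s≡+ (J a h))

-- The symbol of -1 and quadratic reciprocity by lattice points

alt : ℕ → Sign
alt h = ∏ h λ _ → Sign.-

coprime-2h : ∀ h → Coprime (2 * h) (odd h)
coprime-2h h {d} (d∣2h , d∣n) = ∣1⇒≡1 (∣m+n∣m⇒∣n (subst (d ∣_) (sym (+-comm (2 * h) 1)) d∣n) d∣2h)

coprime-2 : ∀ h → Coprime 2 (odd h)
coprime-2 h = coprime-*ˡ {2} {h} (coprime-2h h)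

-- The natural number 2h plays the part of -1 modulo `odd h`, so every member of the half-system
-- changes sign.
J-neg : ∀ h → J (2 * h) h ≡ alt h
J-neg h = ∏-cong h λ i → proj₁ (half-unique (repOf {h} {2 * h} (coprime-2h h) i)
  (half {h} {s = Sign.-} {k = 1+ i} (s≤s z≤n) (1+≤ i) (via (+ (1+ i)) (trans (lem (+ (2 * h * 1+ i)) (+ (1+ i)))
    (cong (_⊕_ (-[1+ 0 ] ⊗ + (1+ i))) (trans (sym (ℤ.pos-+ (2 * h * 1+ i) (1+ i)))
      (trans (cong +_ (lem′ h (1+ i))) (ℤ.pos-* (1+ i) (odd h)))))))))
  where
  lem : ∀ a b → a ≡ -[1+ 0 ] ⊗ b ⊕ (a ⊕ b)
  lem = ring-ℤ
  lem′ : ∀ h k → 2 * h * k + k ≡ k * suc (2 * h)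
  lem′ = ring-ℕ

-- A comparison as a sign: counting lattice points modulo 2 becomes multiplication.
lt : ℕ → ℕ → Sign
lt x y with x <? y
... | yes _ = Sign.-
... | no _ = Sign.+

lt-yes : ∀ {x y} → x < y → lt x y ≡ Sign.-
lt-yes {x} {y} p with x <? y
... | yes _ = refl
... | no q = ⊥-elim (q p)

lt-no : ∀ {x y} → y ≤ x → lt x y ≡ Sign.+
lt-no {x} {y} p with x <? y
... | yes q = ⊥-elim (<⇒≱ q p)
... | no _ = refl

lt-⇔ : ∀ {x y x′ y′} → (x < y → x′ < y′) → (x′ < y′ → x < y) → lt x y ≡ lt x′ y′
lt-⇔ {x} {y} {x′} {y′} f g with x <? y | x′ <? y′
... | yes _ | yes _ = refl
... | no _ | no _ = refl
... | yes p | no q = ⊥-elim (q (f p))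
... | no p | yes q = ⊥-elim (p (g q))

lt-swap : ∀ {x y} → x ≢ y → lt x y Sign.* lt y x ≡ Sign.-
lt-swap {x} {y} x≢y with x <? y | y <? x
... | yes p | yes q = ⊥-elim (<-asym p q)
... | yes _ | no _ = refl
... | no _ | yes _ = refl
... | no p | no q = ⊥-elim (x≢y (≤-antisym (≮⇒≥ q) (≮⇒≥ p)))

∏-single : ∀ {n} (f : Fin n → Sign) i → f i ≡ Sign.- → (∀ j → j ≢ i → f j ≡ Sign.+) → ∏ _ f ≡ Sign.-
∏-single {suc n} f i e o = trans (SignSum.sum-remove {i = i} f) (trans (cong₂ Sign._*_ e
  (trans (∏-cong n λ j → o (punchIn i j) (Fin.punchInᵢ≢i i j)) (∏-one n))) refl)

∏-trivial : ∀ {n} (f : Fin n → Sign) → (∀ j → f j ≡ Sign.+) → ∏ _ f ≡ Sign.+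
∏-trivial {n} f o = trans (∏-cong n o) (∏-one n)

alt-+ : ∀ a b → alt (a + b) ≡ alt a Sign.* alt b
alt-+ zero b = refl
alt-+ (suc a) b = trans (cong (Sign.- Sign.*_) (alt-+ a b)) (sym (Sign.*-assoc Sign.- (alt a) (alt b)))

alt-∏ : ∀ m n → ∏ m (λ _ → alt n) ≡ alt (m * n)
alt-∏ zero n = refl
alt-∏ (suc m) n = trans (cong (alt n Sign.*_) (alt-∏ m n)) (sym (alt-+ n (m * n)))

-- sgn h x is negative exactly when a multiple of odd h lies in (x, x + h]
module _ (h : ℕ) where
  private n = odd h

  sgn-count : ∀ l x → n ∤ x → x ≤ odd l * h →
    sgn h x ≡ ∏ l λ j → lt x (n * 1+ j) Sign.* lt (x + h) (n * 1+ j)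
  sgn-count l x nd bound with x % n ≤? h
  ... | yes r≤h = sym (∏-trivial _ λ j → outside j)
    where
    r = x % n
    t = x / n
    xeq : x ≡ r + n * t
    xeq = trans (m≡m%n+[m/n]*n x n) (cong (λ y → r + y) (*-comm t n))
    r+h<n : r + h < n
    r+h<n = h+h<odd r≤h ≤-refl
    outside : ∀ (j : Fin l) → lt x (n * 1+ j) Sign.* lt (x + h) (n * 1+ j) ≡ Sign.+
    outside j with 1+ j ≤? t
    ... | yes p = cong₂ Sign._*_ (lt-no {x} y≤x) (lt-no {x + h} (≤-trans y≤x (m≤m+n x h)))
      where
      y≤x : n * 1+ j ≤ x
      y≤x = ≤-trans (*-monoʳ-≤ n p) (≤-trans (m≤n+m (n * t) r) (≤-reflexive (sym xeq)))
    ... | no p = cong₂ Sign._*_ (lt-yes (≤-<-trans (m≤m+n x h) x+h<y)) (lt-yes x+h<y)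
      where
      x+h<y : x + h < n * 1+ j
      x+h<y = begin-strict
        x + h ≡⟨ cong (_+ h) xeq ⟩
        r + n * t + h ≡⟨ lem r (n * t) h ⟩
        r + h + n * t <⟨ +-monoˡ-< (n * t) r+h<n ⟩
        n + n * t ≡⟨ sym (*-suc n t) ⟩
        n * suc t ≤⟨ *-monoʳ-≤ n (≰⇒> p) ⟩
        n * 1+ j ∎
        where open ≤-Reasoning
              lem : ∀ a b c → a + b + c ≡ a + c + b
              lem = ring-ℕ
  ... | no r≰h = sym (∏-single _ i inside outside)
    where
    r = x % n
    t = x / n
    xeq : x ≡ r + n * t
    xeq = trans (m≡m%n+[m/n]*n x n) (cong (λ y → r + y) (*-comm t n))
    h<r : h < r
    h<r = ≰⇒> r≰h
    r<n : r < n
    r<n = m%n<n x n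
    x<nst : x < n * suc t
    x<nst = begin-strict
      x ≡⟨ xeq ⟩
      r + n * t <⟨ +-monoˡ-< (n * t) r<n ⟩
      n + n * t ≡⟨ sym (*-suc n t) ⟩
      n * suc t ∎
      where open ≤-Reasoning
    nst≤x+h : n * suc t ≤ x + h
    nst≤x+h = begin
      n * suc t ≡⟨ *-suc n t ⟩
      n + n * t ≡⟨ cong (λ z → suc (h + z) + n * t) (+-identityʳ h) ⟩
      suc h + h + n * t ≤⟨ +-monoˡ-≤ (n * t) (+-monoˡ-≤ h h<r) ⟩
      r + h + n * t ≡⟨ lem r h (n * t) ⟩
      r + n * t + h ≡⟨ cong (_+ h) (sym xeq) ⟩
      x + h ∎
      where open ≤-Reasoning
            lem : ∀ a b c → a + b + c ≡ a + c + b
            lem = ring-ℕ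
    -- The bound on x is used here: it keeps `n * suc t`, the first multiple of n above x, among the
    -- l multiples of the product.
    t<l : t < l
    t<l = *-cancelˡ-< n t l (+-cancelˡ-< h (n * t) (n * l) (begin-strict
      h + n * t <⟨ +-monoˡ-< (n * t) h<r ⟩
      r + n * t ≡⟨ sym xeq ⟩
      x ≤⟨ bound ⟩
      odd l * h ≤⟨ m≤m+n (odd l * h) l ⟩
      odd l * h + l ≡⟨ lem l h ⟩
      h + n * l ∎))
      where open ≤-Reasoning
            lem : ∀ l h → suc (2 * l) * h + l ≡ h + suc (2 * h) * l
            lem = ring-ℕ
    i : Fin l
    i = fromℕ< t<l
    1+i : 1+ i ≡ suc t
    1+i = cong suc (Fin.toℕ-fromℕ< t<l)
    inside : lt x (n * 1+ i) Sign.* lt (x + h) (n * 1+ i) ≡ Sign.-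
    inside = cong₂ Sign._*_ (lt-yes (subst (λ z → x < n * z) (sym 1+i) x<nst))
        (lt-no {x + h} (subst (λ z → n * z ≤ x + h) (sym 1+i) nst≤x+h))
    outside : ∀ j → j ≢ i → lt x (n * 1+ j) Sign.* lt (x + h) (n * 1+ j) ≡ Sign.+
    outside j j≢i with <-cmp (1+ j) (suc t)
    ... | tri≈ _ e _ = ⊥-elim (j≢i (Fin.toℕ-injective (suc-injective (trans e (sym 1+i)))))
    ... | tri< p _ _ = cong₂ Sign._*_ (lt-no {x} y≤x) (lt-no {x + h} (≤-trans y≤x (m≤m+n x h)))
      where
      y≤x : n * 1+ j ≤ x
      y≤x = ≤-trans (*-monoʳ-≤ n (≤-pred p)) (≤-trans (m≤n+m (n * t) r) (≤-reflexive (sym xeq)))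
    ... | tri> _ _ p = cong₂ Sign._*_ (lt-yes (≤-<-trans (m≤m+n x h) x+h<y)) (lt-yes x+h<y)
      where
      x+h<y : x + h < n * 1+ j
      x+h<y = begin-strict
        x + h <⟨ +-mono-< x<nst (h<odd h) ⟩
        n * suc t + n ≡⟨ trans (+-comm (n * suc t) n) (sym (*-suc n (suc t))) ⟩
        n * suc (suc t) ≤⟨ *-monoʳ-≤ n p ⟩
        n * 1+ j ∎
        where open ≤-Reasoning

∏∏ : ∀ m n → (Fin m → Fin n → Sign) → Sign
∏∏ m n f = ∏ m λ i → ∏ n (f i)

∏∏-cong : ∀ m n {f g : Fin m → Fin n → Sign} → (∀ i j → f i j ≡ g i j) → ∏∏ m n f ≡ ∏∏ m n g
∏∏-cong m n e = ∏-cong m λ i → ∏-cong n (e i)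

∏∏-distrib : ∀ m n (f g : Fin m → Fin n → Sign) → ∏∏ m n (λ i j → f i j Sign.* g i j) ≡ ∏∏ m n f Sign.* ∏∏ m n g
∏∏-distrib m n f g = trans (∏-cong m λ i → ∏-distrib n (f i) (g i)) (∏-distrib m (λ i → ∏ n (f i)) (λ i → ∏ n (g i)))

∏-reverse : ∀ n (f : Fin n → Sign) → ∏ n (f ∘ opposite) ≡ ∏ n f
∏-reverse n f = sum-injective Sign.*-commutativeMonoid f opposite
  λ {i} {j} e → trans (sym (Fin.opposite-involutive i)) (trans (cong opposite e) (Fin.opposite-involutive j))

1+opposite : ∀ {n} (i : Fin n) → 1+ opposite i + 1+ i ≡ suc n
1+opposite {n} i = trans (cong (λ x → suc x + 1+ i) (Fin.opposite-prop i)) (cong suc (m∸n+n≡m (1+≤ i)))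

J-table : ∀ h l → Coprime (odd l) (odd h) →
  J (odd l) h ≡ ∏∏ h l λ i j → lt (odd l * 1+ i) (odd h * 1+ j) Sign.* lt (odd l * 1+ i + h) (odd h * 1+ j)
J-table h l c = ∏-cong h λ i → sgn-count h l (odd l * 1+ i) (odd∤ {h} {odd l} c (s≤s z≤n) (1+≤ i))
    (*-monoʳ-≤ (odd l) (1+≤ i))

-- Frobenius: A and B mark the lattice points of the rectangle that lie outside the two bands counted by the symbols, and
-- the point reflection of the rectangle exchanges them.
reciprocity : ∀ h l → Coprime (odd l) (odd h) → J (odd l) h Sign.* J (odd h) l ≡ alt (h * l)
reciprocity h l c = begin
  J m h Sign.* J n l
    ≡⟨ cong₂ Sign._*_ (J-table h l c) (trans (J-table l h (cop-sym c)) (∏-comm l h λ j i → below i j Sign.* B i j)) ⟩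
  ∏∏ h l (λ i j → above i j Sign.* A i j) Sign.* ∏∏ h l (λ i j → below i j Sign.* B i j)
    ≡⟨ cong₂ Sign._*_ (∏∏-distrib h l above A) (∏∏-distrib h l below B) ⟩
  (∏∏ h l above Sign.* ∏∏ h l A) Sign.* (∏∏ h l below Sign.* ∏∏ h l B)
    ≡⟨ cong (λ x → (∏∏ h l above Sign.* x) Sign.* (∏∏ h l below Sign.* ∏∏ h l B)) (sym B≡A) ⟩
  (∏∏ h l above Sign.* ∏∏ h l B) Sign.* (∏∏ h l below Sign.* ∏∏ h l B)
    ≡⟨ cancel (∏∏ h l above) (∏∏ h l below) (∏∏ h l B) ⟩
  ∏∏ h l above Sign.* ∏∏ h l below
    ≡⟨ sym (∏∏-distrib h l above below) ⟩
  ∏∏ h l (λ i j → above i j Sign.* below i j)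
    ≡⟨ ∏∏-cong h l (λ i j → lt-swap (distinct i j)) ⟩
  ∏ h (λ _ → alt l)
    ≡⟨ alt-∏ h l ⟩
  alt (h * l) ∎
  where
  open ≡-Reasoning
  m = odd l
  n = odd h
  above below A B : Fin h → Fin l → Sign
  above i j = lt (m * 1+ i) (n * 1+ j)
  below i j = lt (n * 1+ j) (m * 1+ i)
  A i j = lt (m * 1+ i + h) (n * 1+ j)
  B i j = lt (n * 1+ j + l) (m * 1+ i)
  cancel : ∀ a b c → (a Sign.* c) Sign.* (b Sign.* c) ≡ a Sign.* b
  cancel a b Sign.+ = cong₂ Sign._*_ (Sign.*-identityʳ a) (Sign.*-identityʳ b)
  cancel Sign.+ Sign.+ Sign.- = refl
  cancel Sign.+ Sign.- Sign.- = refl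
  cancel Sign.- Sign.+ Sign.- = refl
  cancel Sign.- Sign.- Sign.- = refl
  distinct : ∀ i j → m * 1+ i ≢ n * 1+ j
  distinct i j e = odd∤ {h} {m} c (s≤s z≤n) (1+≤ i) (divides (1+ j) (trans e (*-comm n (1+ j))))
  reflect : ∀ i j → B (opposite i) (opposite j) ≡ A i j
  reflect i j = lt-⇔ to from
    where
    i′ = 1+ opposite i
    j′ = 1+ opposite j
    k = 1+ i
    q = 1+ j
    -- The reflection sends (k, q) to (h + 1 - k, l + 1 - q). It exchanges the two inequalities
    -- because m(h + 1) + h and n(l + 1) + l are both 2hl + 2h + 2l + 1.
    key : (m * k + h) + (m * i′) ≡ (n * q) + (n * j′ + l)
    key = begin
      (m * k + h) + (m * i′) ≡⟨ lem₁ m k h i′ ⟩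
      m * (i′ + k) + h ≡⟨ cong (λ x → m * x + h) (1+opposite i) ⟩
      m * suc h + h ≡⟨ lem₂ l h ⟩
      n * suc l + l ≡⟨ cong (λ x → n * x + l) (sym (1+opposite j)) ⟩
      n * (j′ + q) + l ≡⟨ lem₃ n j′ q l ⟩
      (n * q) + (n * j′ + l) ∎
      where
      lem₁ : ∀ m k h i → (m * k + h) + (m * i) ≡ m * (i + k) + h
      lem₁ = ring-ℕ
      lem₂ : ∀ l h → suc (2 * l) * suc h + h ≡ suc (2 * h) * suc l + l
      lem₂ = ring-ℕ
      lem₃ : ∀ n j q l → n * (j + q) + l ≡ n * q + (n * j + l)
      lem₃ = ring-ℕ
    to : n * j′ + l < m * i′ → m * k + h < n * q
    to p = ≰⇒> λ g → <-irrefl (sym key) (+-mono-≤-< g p)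
    from : m * k + h < n * q → n * j′ + l < m * i′
    from p = ≰⇒> λ g → <-irrefl key (+-mono-<-≤ p g)
  B≡A : ∏∏ h l B ≡ ∏∏ h l A
  B≡A = trans (sym (∏-reverse h λ i → ∏ l (B i))) (∏-cong h λ i → trans (sym (∏-reverse l (B (opposite i))))
      (∏-cong l (reflect i)))

-- The Kronecker symbol as a character

alt-2* : ∀ a → alt (2 * a) ≡ Sign.+
alt-2* a = trans (cong alt (cong (λ x → a + x) (+-identityʳ a))) (trans (alt-+ a a) (Sign.s*s≡+ (alt a)))

alt-consecutive : ∀ h → alt (suc h * h) ≡ Sign.+
alt-consecutive zero = refl
alt-consecutive (suc h) = trans (cong alt (lem h)) (trans (alt-+ (2 * suc h) (suc h * h))
    (cong₂ Sign._*_ (alt-2* (suc h)) (alt-consecutive h)))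
  where lem : ∀ h → suc (suc h) * suc h ≡ 2 * suc h + suc h * h
        lem = ring-ℕ

coprime-odd-suc : ∀ h → Coprime (odd h) (odd (suc h))
coprime-odd-suc h {d} (p , q) = coprime-2 h (∣m+n∣m⇒∣n (subst (d ∣_) (lem h) q) p , p)
  where lem : ∀ h → suc (2 * suc h) ≡ suc (2 * h) + 2
        lem = ring-ℕ

-- 4(h + 1) ≡ 2h + 1 modulo 2h + 3, so reciprocity links the symbols of 2 for consecutive odd moduli.
J-2-suc : ∀ h → J 2 (suc h) ≡ alt (suc h) Sign.* J 2 h
J-2-suc h = solve (J 2 (suc h)) (alt (suc h)) (J 2 h) (begin
  J 2 (suc h) Sign.* alt (suc h) Sign.* J 2 h
    ≡⟨ cong (λ s → J 2 (suc h) Sign.* s Sign.* J 2 h) (sym (J-neg (suc h))) ⟩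
  J 2 (suc h) Sign.* J (2 * suc h) (suc h) Sign.* J 2 h
    ≡⟨ cong (Sign._* J 2 h) (sym (J-* 2 (2 * suc h) (suc h) (coprime-2 (suc h)) (coprime-2h (suc h)))) ⟩
  J (2 * (2 * suc h)) (suc h) Sign.* J 2 h
    ≡⟨ cong₂ Sign._*_ (J-mod (2 * (2 * suc h)) (odd h) (suc h)
          (trans (cong (_% odd (suc h)) (lem₁ h)) ([m+n]%n≡m%n (odd h) (odd (suc h)))))
        (J-mod 2 (odd (suc h)) h (sym (trans (cong (_% odd h) (lem₂ h)) ([m+n]%n≡m%n 2 (odd h))))) ⟩
  J (odd h) (suc h) Sign.* J (odd (suc h)) h
    ≡⟨ reciprocity (suc h) h (coprime-odd-suc h) ⟩
  alt (suc h * h) ≡⟨ alt-consecutive h ⟩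
  Sign.+ ∎)
  where
  open ≡-Reasoning
  lem₁ : ∀ h → 2 * (2 * suc h) ≡ suc (2 * h) + suc (2 * suc h)
  lem₁ = ring-ℕ
  lem₂ : ∀ h → suc (2 * suc h) ≡ 2 + suc (2 * h)
  lem₂ = ring-ℕ
  solve : ∀ a b c → a Sign.* b Sign.* c ≡ Sign.+ → a ≡ b Sign.* c
  solve a b c e = trans (sym (Sign.*-identityʳ a)) (trans (cong (a Sign.*_) (sym (Sign.s*s≡+ (b Sign.* c))))
    (trans (sym (Sign.*-assoc a _ _)) (cong (Sign._* (b Sign.* c)) (trans (sym (Sign.*-assoc a b c)) e))))

-- The symbol (2 / odd h). Its period 8 in the modulus is a period 4 in h.
second : ℕ → Sign
second 0 = Sign.+
second 1 = Sign.-
second 2 = Sign.-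
second 3 = Sign.+
second (suc (suc (suc (suc h)))) = second h

J-2 : ∀ h → J 2 h ≡ second h
J-2 zero = refl
J-2 (suc h) = trans (J-2-suc h) (trans (cong (alt (suc h) Sign.*_) (J-2 h)) (sym (step h)))
  where
  alt-4 : ∀ h → alt (4 + h) ≡ alt h
  alt-4 h = trans (alt-+ 4 h) (Sign.*-identityˡ (alt h))
  step : ∀ h → second (suc h) ≡ alt (suc h) Sign.* second h
  step 0 = refl
  step 1 = refl
  step 2 = refl
  step 3 = refl
  step (suc (suc (suc (suc h)))) = trans (step h) (cong (Sign._* second h) (sym (alt-4 (suc h))))

infixl 7 _⊛_
_⊛_ : ℕ → ℕ → ℕ
h ⊛ l = h + l + 2 * (h * l)

odd-⊛ : ∀ h l → odd (h ⊛ l) ≡ odd h * odd l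
odd-⊛ = lem
  where lem : ∀ h l → suc (2 * (h + l + 2 * (h * l))) ≡ suc (2 * h) * suc (2 * l)
        lem = ring-ℕ

second-+4 : ∀ k h → second (h + 4 * k) ≡ second h
second-+4 zero h = cong second (+-identityʳ h)
second-+4 (suc k) h = trans (cong second (lem h k)) (second-+4 k h)
  where lem : ∀ h k → h + 4 * suc k ≡ 4 + (h + 4 * k)
        lem = ring-ℕ

second-⊛ : ∀ h l → second (h ⊛ l) ≡ second h Sign.* second l
second-⊛ (suc (suc (suc (suc h)))) l = trans (cong second (lem h l))
    (trans (second-+4 (1 + 2 * l) (h ⊛ l)) (second-⊛ h l))
  where lem : ∀ h l → 4 + h + l + 2 * ((4 + h) * l) ≡ h + l + 2 * (h * l) + 4 * (1 + 2 * l)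
        lem = ring-ℕ
second-⊛ 0 l = cong second (+-identityʳ l)
second-⊛ 1 l = go l
  where
  go : ∀ l → second (1 ⊛ l) ≡ Sign.- Sign.* second l
  go 0 = refl
  go 1 = refl
  go 2 = refl
  go 3 = refl
  go (suc (suc (suc (suc l)))) = trans (cong second (lem l)) (trans (second-+4 3 (1 ⊛ l)) (go l))
    where lem : ∀ l → 1 + (4 + l) + 2 * (1 * (4 + l)) ≡ 1 + l + 2 * (1 * l) + 12
          lem = ring-ℕ
second-⊛ 2 l = go l
  where
  go : ∀ l → second (2 ⊛ l) ≡ Sign.- Sign.* second l
  go 0 = refl
  go 1 = refl
  go 2 = refl
  go 3 = refl
  go (suc (suc (suc (suc l)))) = trans (cong second (lem l)) (trans (second-+4 5 (2 ⊛ l)) (go l))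
    where lem : ∀ l → 2 + (4 + l) + 2 * (2 * (4 + l)) ≡ 2 + l + 2 * (2 * l) + 20
          lem = ring-ℕ
second-⊛ 3 l = go l
  where
  go : ∀ l → second (3 ⊛ l) ≡ second l
  go 0 = refl
  go 1 = refl
  go 2 = refl
  go 3 = refl
  go (suc (suc (suc (suc l)))) = trans (cong second (lem l)) (trans (second-+4 7 (3 ⊛ l)) (go l))
    where lem : ∀ l → 3 + (4 + l) + 2 * (3 * (4 + l)) ≡ 3 + l + 2 * (3 * l) + 28
          lem = ring-ℕ

alt-⊛ : ∀ h l k → alt ((h ⊛ l) * k) ≡ alt (h * k) Sign.* alt (l * k)
alt-⊛ h l k = trans (cong alt (lem h l k)) (trans (alt-+ (h * k + l * k) _)
  (trans (cong₂ Sign._*_ (alt-+ (h * k) (l * k)) (alt-2* (h * l * k))) (Sign.*-identityʳ _)))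
  where lem : ∀ h l k → (h + l + 2 * (h * l)) * k ≡ h * k + l * k + 2 * (h * l * k)
        lem = ring-ℕ

infixr 8 _^ˢ_
_^ˢ_ : Sign → ℕ → Sign
s ^ˢ zero = Sign.+
s ^ˢ suc β = s Sign.* s ^ˢ β

interchange : ∀ a b c d → (a Sign.* b) Sign.* (c Sign.* d) ≡ (a Sign.* c) Sign.* (b Sign.* d)
interchange a b c d = trans (Sign.*-assoc a b _) (trans (cong (a Sign.*_) (trans (sym (Sign.*-assoc b c d))
  (trans (cong (Sign._* d) (Sign.*-comm b c)) (Sign.*-assoc c b d)))) (sym (Sign.*-assoc a c _)))

^ˢ-* : ∀ s t β → (s Sign.* t) ^ˢ β ≡ s ^ˢ β Sign.* t ^ˢ β
^ˢ-* s t zero = refl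
^ˢ-* s t (suc β) = trans (cong (s Sign.* t Sign.*_) (^ˢ-* s t β)) (interchange s t (s ^ˢ β) (t ^ˢ β))

-- the Kronecker symbol (-m / odd h) for m = 2^β * odd l
module Kronecker (β l : ℕ) where
  m : ℕ
  m = 2 ^ β * odd l

  -- The factors are (-1 / odd h), (2 / odd h)^β and, flipped by reciprocity, (odd l / odd h). With
  -- `odd h` on top of the last symbol, periodicity in h can be read off.
  κ : ℕ → Sign
  κ h = (alt h Sign.* second h ^ˢ β) Sign.* (alt (h * l) Sign.* J (odd h) l)

  J-2^ : ∀ h β → J (2 ^ β) h ≡ second h ^ˢ β × Coprime (2 ^ β) (odd h)
  J-2^ h zero = J-one h , λ (p , _) → ∣1⇒≡1 p
  J-2^ h (suc β) = let e , c = J-2^ h β in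
    trans (J-* 2 (2 ^ β) h (coprime-2 h) c) (cong₂ Sign._*_ (J-2 h) e) , coprime-* {2} {2 ^ β} (coprime-2 h) c

  κ≡J : ∀ h → Coprime (odd l) (odd h) → κ h ≡ alt h Sign.* J m h
  κ≡J h c = trans (Sign.*-assoc (alt h) _ _) (cong (alt h Sign.*_) (sym (trans
    (J-* (2 ^ β) (odd l) h (proj₂ (J-2^ h β)) c) (cong₂ Sign._*_ (proj₁ (J-2^ h β))
    (solve (J (odd l) h) (J (odd h) l) (alt (h * l)) (reciprocity h l c))))))
    where
    solve : ∀ a b c → a Sign.* b ≡ c → a ≡ c Sign.* b
    solve a b c e = trans (sym (Sign.*-identityʳ a)) (trans (cong (a Sign.*_) (sym (Sign.s*s≡+ b)))
      (trans (sym (Sign.*-assoc a b b)) (cong (Sign._* b) e)))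

  κ-⊛ : ∀ h k → Coprime (odd h) (odd l) → Coprime (odd k) (odd l) → κ (h ⊛ k) ≡ κ h Sign.* κ k
  κ-⊛ h k ch ck = trans (cong₂ Sign._*_
      (trans (cong₂ Sign._*_ (trans (cong alt (sym (*-identityʳ (h ⊛ k))))
          (trans (alt-⊛ h k 1) (cong₂ (λ a b → alt a Sign.* alt b) (*-identityʳ h) (*-identityʳ k))))
                              (trans (cong (_^ˢ β) (second-⊛ h k)) (^ˢ-* (second h) (second k) β)))
             (interchange (alt h) (alt k) (second h ^ˢ β) (second k ^ˢ β)))
      (trans (cong₂ Sign._*_ (alt-⊛ h k l) (trans (cong (λ x → J x l) (odd-⊛ h k)) (J-* (odd h) (odd k) l ch ck)))
             (interchange (alt (h * l)) (alt (k * l)) (J (odd h) l) (J (odd k) l))))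
    (interchange (alt h Sign.* second h ^ˢ β) (alt k Sign.* second k ^ˢ β) _ _)

  -- A shift of h by 4tm is a shift of `odd h` by 8tm. Hence the modulus 8m of the character.
  κ-+ : ∀ h t → κ (h + 4 * (t * m)) ≡ κ h
  κ-+ h t = cong₂ Sign._*_
    (cong₂ Sign._*_ (trans (alt-+ h (4 * (t * m))) (trans (cong (alt h Sign.*_)
        (trans (cong alt (lem₀ (t * m))) (alt-2* (2 * (t * m))))) (Sign.*-identityʳ (alt h))))
                    (cong (_^ˢ β) (second-+4 (t * m) h)))
    (cong₂ Sign._*_ (trans (cong alt (lem₁ h (t * m) l)) (trans (alt-+ (h * l) (2 * (2 * (t * m) * l)))
        (trans (cong (alt (h * l) Sign.*_) (alt-2* (2 * (t * m) * l))) (Sign.*-identityʳ (alt (h * l))))))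
                    (J-mod (odd (h + 4 * (t * m))) (odd h) l (trans (cong (_% odd l) (lem₂ h t (2 ^ β) (odd l)))
                        ([m+kn]%n≡m%n (odd h) (8 * t * 2 ^ β) (odd l)))))
    where
    lem₀ : ∀ x → 4 * x ≡ 2 * (2 * x)
    lem₀ = ring-ℕ
    lem₁ : ∀ h x l → (h + 4 * x) * l ≡ h * l + 2 * (2 * x * l)
    lem₁ = ring-ℕ
    lem₂ : ∀ h t b o → suc (2 * (h + 4 * (t * (b * o)))) ≡ suc (2 * h) + 8 * t * b * o
    lem₂ = ring-ℕ

-- Square roots modulo primes

module IntProd = CMSum ℤ.*-1-commutativeMonoid

∏ℤ : ∀ n → (Fin n → ℤ) → ℤ
∏ℤ n f = IntProd.sum {n} f

∏ℤ-≈ : ∀ {m} n {f g : Fin n → ℤ} → (∀ i → f i ≈ g i [ m ]) → ∏ℤ n f ≈ ∏ℤ n g [ m ]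
∏ℤ-≈ zero e = ≈-refl
∏ℤ-≈ (suc n) e = ≈-* (e Fin.zero) (∏ℤ-≈ n (λ i → e (Fin.suc i)))

∏ℤ-const : ∀ n a → ∏ℤ n (λ _ → a) ≡ a ℤ.^ n
∏ℤ-const zero a = refl
∏ℤ-const (suc n) a = cong (_⊗_ a) (∏ℤ-const n a)

∏ℤ-sign : ∀ n (f : Fin n → Sign) → ∏ℤ n (λ i → ⟦ f i ⟧) ≡ ⟦ ∏ n f ⟧
∏ℤ-sign zero f = refl
∏ℤ-sign (suc n) f = trans (cong (_⊗_ ⟦ f Fin.zero ⟧) (∏ℤ-sign n _)) (sym (⟦⟧-* (f Fin.zero) (∏ n (f ∘ Fin.suc))))

∏ℤ-coprime : ∀ {p} n (f : Fin n → ℕ) → (∀ i → Coprime (f i) p) → ∃ λ c → ∏ℤ n (λ i → + f i) ≡ + c × Coprime c p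
∏ℤ-coprime zero f e = 1 , refl , λ (d , _) → ∣1⇒≡1 d
∏ℤ-coprime (suc n) f e = let c , eq , cop = ∏ℤ-coprime n (f ∘ Fin.suc) (e ∘ Fin.suc) in
  f Fin.zero * c , trans (cong (_⊗_ (+ f Fin.zero)) eq) (sym (ℤ.pos-* (f Fin.zero) c)) , coprime-* {f Fin.zero} {c}
      (e Fin.zero) cop

module _ {h : ℕ} (pr : Prime (odd h)) where

  coprime-small : ∀ (i : Fin h) → Coprime (1+ i) (odd h)
  coprime-small i = cop-sym (prime⇒coprime pr (≤-<-trans (1+≤ i) (h<odd h)))

  -- Multiply the h congruences a·i ≡ ±k. Both sides contain h!, because the k are a permutation of
  -- 1, ..., h, and h! is prime to p.
  gauss-lemma : ∀ a → Coprime a (odd h) → (+ a) ℤ.^ h ≈ ⟦ J a h ⟧ [ + odd h ]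
  gauss-lemma a c = ≈-cancelˡ P P-coprime (subst₂ (λ x y → x ≈ y [ + odd h ]) lhs rhs
      (∏ℤ-≈ h λ i → cong-eq (repShuffle {h} {a} c i)))
    where
    fact = ∏ℤ-coprime {odd h} h 1+_ coprime-small
    P = proj₁ fact
    P-eq = proj₁ (proj₂ fact)
    P-coprime = proj₂ (proj₂ fact)
    lhs : ∏ℤ h (λ i → + (a * 1+ i)) ≡ + P ⊗ (+ a) ℤ.^ h
    lhs = trans (IntProd.sum-cong-≗ {h} λ i → ℤ.pos-* a (1+ i))
        (trans (IntProd.∑-distrib-+ {h} (λ _ → + a) (λ i → + (1+ i)))
      (trans (cong₂ _⊗_ (∏ℤ-const h (+ a)) P-eq) (ℤ.*-comm ((+ a) ℤ.^ h) (+ P))))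
    rhs : ∏ℤ h (λ i → ⟦ sgn h (a * 1+ i) ⟧ ⊗ + (1+ shuffle {h} {a} c i)) ≡ + P ⊗ ⟦ J a h ⟧
    rhs = trans (IntProd.∑-distrib-+ {h} (λ i → ⟦ sgn h (a * 1+ i) ⟧) (λ i → + (1+ shuffle {h} {a} c i)))
      (trans (cong₂ _⊗_ (∏ℤ-sign h (λ i → sgn h (a * 1+ i)))
        (trans (sum-injective ℤ.*-1-commutativeMonoid (λ i → + (1+ i)) (shuffle {h} {a} c)
            (shuffle-injective {h} {a} c)) P-eq))
        (ℤ.*-comm ⟦ J a h ⟧ (+ P)))

-- a monic polynomial of degree n is the vector of its n lower coefficients
eval : ∀ {n} → Vec ℤ n → ℤ → ℤ
eval [] x = + 1
eval (c ∷ cs) x = c ⊕ x ⊗ eval cs x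

addmul : ∀ {n} → ℤ → Vec ℤ (suc n) → Vec ℤ n → Vec ℤ (suc n)
addmul a (c ∷ cs) (d ∷ ds) = (c ⊕ a ⊗ d) ∷ addmul a cs ds
addmul a (c ∷ []) [] = (c ⊕ a) ∷ []

eval-addmul : ∀ {n} a (u : Vec ℤ (suc n)) (v : Vec ℤ n) x → eval (addmul a u v) x ≡ eval u x ⊕ a ⊗ eval v x
eval-addmul a (c ∷ []) [] x = lem a c x
  where lem : ∀ a c x → c ⊕ a ⊕ x ⊗ + 1 ≡ c ⊕ x ⊗ + 1 ⊕ a ⊗ + 1
        lem = ring-ℤ
eval-addmul a (c ∷ cs) (d ∷ ds) x = trans (cong (λ y → c ⊕ a ⊗ d ⊕ x ⊗ y) (eval-addmul a cs ds x))
    (lem a c d x (eval cs x) (eval ds x))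
  where lem : ∀ a c d x u v → c ⊕ a ⊗ d ⊕ x ⊗ (u ⊕ a ⊗ v) ≡ c ⊕ x ⊗ u ⊕ a ⊗ (d ⊕ x ⊗ v)
        lem = ring-ℤ

divide : ∀ {n} → ℤ → Vec ℤ (suc n) → Vec ℤ n
divide a (c ∷ []) = []
divide a (c ∷ d ∷ ds) = addmul a (d ∷ ds) (divide a (d ∷ ds))

eval-divide : ∀ {n} a (u : Vec ℤ (suc n)) x → eval u x ⊖ eval u a ≡ (x ⊖ a) ⊗ eval (divide a u) x
eval-divide a (c ∷ []) x = lem a c x
  where lem : ∀ a c x → c ⊕ x ⊗ + 1 ⊖ (c ⊕ a ⊗ + 1) ≡ (x ⊖ a) ⊗ + 1
        lem = ring-ℤ
eval-divide a (c ∷ u@(_ ∷ _)) x = trans (lem a c x (eval u x) (eval u a)) (trans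
    (cong (λ y → (x ⊖ a) ⊗ eval u x ⊕ a ⊗ y) (eval-divide a u x))
    (trans (lem′ a x (eval u x) (eval (divide a u) x)) (cong (_⊗_ (x ⊖ a)) (sym (eval-addmul a u (divide a u) x)))))
  where lem : ∀ a c x p q → c ⊕ x ⊗ p ⊖ (c ⊕ a ⊗ q) ≡ (x ⊖ a) ⊗ p ⊕ a ⊗ (p ⊖ q)
        lem = ring-ℤ
        lem′ : ∀ a x p q → (x ⊖ a) ⊗ p ⊕ a ⊗ ((x ⊖ a) ⊗ q) ≡ (x ⊖ a) ⊗ (p ⊕ a ⊗ q)
        lem′ = ring-ℤ

eval-power : ∀ n x → eval (replicate n (+ 0)) x ≡ x ℤ.^ n
eval-power zero x = refl
eval-power (suc n) x = trans (ℤ.+-identityˡ _) (cong (_⊗_ x) (eval-power n x))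

euclidsLemmaℤ : ∀ {p} → Prime p → ∀ x y → x ⊗ y ≈ + 0 [ + p ] → x ≈ + 0 [ + p ] ⊎ y ≈ + 0 [ + p ]
euclidsLemmaℤ {p} pr x y e with euclidsLemma ℤ.∣ x ∣ ℤ.∣ y ∣ pr
    (subst (p ∣_) (trans (cong ℤ.∣_∣ (ℤ.+-identityʳ (x ⊗ y))) (ℤ.abs-* x y)) (≈⇒∣ e))
... | inj₁ d = inj₁ (∣⇒≈ (subst (λ z → p ∣ ℤ.∣ z ∣) (sym (ℤ.+-identityʳ x)) d))
... | inj₂ d = inj₂ (∣⇒≈ (subst (λ z → p ∣ ℤ.∣ z ∣) (sym (ℤ.+-identityʳ y)) d))

≈-minus : ∀ {n x y} → x ≈ y [ n ] → x ⊖ y ≈ + 0 [ n ]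
≈-minus {n} {x} {y} (via q e) = via q (trans (cong (_⊖ y) e) (lem y (q ⊗ n)))
  where lem : ∀ y z → y ⊕ z ⊖ y ≡ + 0 ⊕ z
        lem = ring-ℤ

minus-≈ : ∀ {n x y} → x ⊖ y ≈ + 0 [ n ] → x ≈ y [ n ]
minus-≈ {n} {x} {y} (via q e) = via q (trans (lem x y) (cong (_⊕_ y) (trans e (ℤ.+-identityˡ (q ⊗ n)))))
  where lem : ∀ x y → x ≡ y ⊕ (x ⊖ y)
        lem = ring-ℤ

-- Induction on the degree: after division by the linear factor of one root, Euclid's lemma makes
-- the quotient vanish at all the others.
lagrange : ∀ {p} → Prime p → ∀ n (u : Vec ℤ n) (r : Fin (suc n) → ℤ) →
  (∀ {i j} → r i ≈ r j [ + p ] → i ≡ j) → (∀ i → eval u (r i) ≈ + 0 [ + p ]) → ⊥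
lagrange {p} pr zero [] r inj root = nonTrivial⇒≢1 {{prime⇒nonTrivial pr}} (∣1⇒≡1 (≈⇒∣ (root Fin.zero)))
lagrange {p} pr (suc n) u r inj root = lagrange pr n (divide a u) (r ∘ Fin.suc) (Fin.suc-injective ∘ inj) root′
  where
  a = r Fin.zero
  root′ : ∀ i → eval (divide a u) (r (Fin.suc i)) ≈ + 0 [ + p ]
  root′ i with euclidsLemmaℤ pr (x ⊖ a) (eval (divide a u) x)
      (≈-trans (≈-reflexive (sym (eval-divide a u x))) (≈-minus (≈-trans (root (Fin.suc i)) (≈-sym (root Fin.zero)))))
    where x = r (Fin.suc i)
  ... | inj₂ z = z
  ... | inj₁ z = case inj (minus-≈ z) of λ ()

-- The squares 1², ..., h² are h incongruent roots of x^h - 1. By `gauss-lemma` a is a root as well,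
-- and one too many unless it is congruent to one of them.
J-root : ∀ {h} → Prime (odd h) → ∀ a → Coprime a (odd h) → J a h ≡ Sign.+ → ∃ λ b → + a ≈ + (b * b) [ + odd h ]
J-root {zero} pr a c e = ⊥-elim (nonTrivial⇒≢1 {{prime⇒nonTrivial pr}} refl)
J-root {suc h′} pr a c e with Fin.any? {suc h′} (λ i → odd (suc h′) ∣? ℤ.∣ + a ⊖ + (1+ i * 1+ i) ∣)
... | yes (i , d) = 1+ i , ∣⇒≈ d
... | no none = ⊥-elim (lagrange pr h poly r inj root)
  where
  h = suc h′
  p = odd h
  poly : Vec ℤ h
  poly = -[1+ 0 ] ∷ replicate h′ (+ 0)
  eval-poly : ∀ x → eval poly x ≡ x ℤ.^ h ⊖ + 1
  eval-poly x = trans (cong (λ y → -[1+ 0 ] ⊕ x ⊗ y) (eval-power h′ x)) (ℤ.+-comm -[1+ 0 ] (x ⊗ x ℤ.^ h′))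
  sq : Fin h → ℤ
  sq i = + (1+ i * 1+ i)
  r : Fin (suc h) → ℤ
  r Fin.zero = + a
  r (Fin.suc i) = sq i
  sq-inj : ∀ i j → sq i ≈ sq j [ + p ] → i ≡ j
  sq-inj i j (via q e) with euclidsLemmaℤ pr (+ (1+ i) ⊖ + (1+ j)) (+ (1+ i) ⊕ + (1+ j))
      (via q (trans (lem (+ (1+ i)) (+ (1+ j))) (trans (cong₂ _⊖_ (trans (sym (ℤ.pos-* (1+ i) (1+ i))) e)
          (sym (ℤ.pos-* (1+ j) (1+ j))))
         (lem′ (sq j) (q ⊗ + p)))))
    where
    lem : ∀ x y → (x ⊖ y) ⊗ (x ⊕ y) ≡ x ⊗ x ⊖ y ⊗ y
    lem = ring-ℤ
    lem′ : ∀ x y → x ⊕ y ⊖ x ≡ + 0 ⊕ y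
    lem′ = ring-ℤ
  ... | inj₁ (via q e) = Fin.toℕ-injective (suc-injective (ℤ.+-injective
      (ℤ.i-j≡0⇒i≡j _ _ (small-multiple _ q p (trans e (ℤ.+-identityˡ _))
        (≤-<-trans (ℤ.∣i-j∣≤∣i∣+∣j∣ (+ (1+ i)) (+ (1+ j))) (h+h<odd (1+≤ i) (1+≤ j)))))))
  ... | inj₂ (via q e) = case small-multiple (+ (1+ i) ⊕ + (1+ j)) q p (trans e (ℤ.+-identityˡ _))
      (h+h<odd (1+≤ i) (1+≤ j)) of λ ()
  inj : ∀ {i j} → r i ≈ r j [ + p ] → i ≡ j
  inj {Fin.zero} {Fin.zero} _ = refl
  inj {Fin.zero} {Fin.suc j} e = ⊥-elim (none (j , ≈⇒∣ e))
  inj {Fin.suc i} {Fin.zero} e = ⊥-elim (none (i , ≈⇒∣ (≈-sym e)))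
  inj {Fin.suc i} {Fin.suc j} e = cong Fin.suc (sq-inj i j e)
  root₁ : ∀ b → Coprime b p → J b h ≡ Sign.+ → eval poly (+ b) ≈ + 0 [ + p ]
  root₁ b cb eb = ≈-trans (≈-reflexive (eval-poly (+ b))) (≈-minus
      (subst (λ s → (+ b) ℤ.^ h ≈ ⟦ s ⟧ [ + p ]) eb (gauss-lemma {h} pr b cb)))
  root : ∀ i → eval poly (r i) ≈ + 0 [ + p ]
  root Fin.zero = root₁ a c e
  root (Fin.suc i) = root₁ (1+ i * 1+ i) (coprime-* {1+ i} {1+ i} (coprime-small {h} pr i) (coprime-small {h} pr i))
    (J-square (1+ i) h (coprime-small {h} pr i))

-- Divisor sums of a quadratic character

-- The range is 1, ..., n, so that 0 never occurs as a divisor.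
S : ℕ → (ℕ → ℤ) → ℤ
S zero g = + 0
S (suc n) g = S n g ⊕ g (suc n)

S-cong : ∀ n {f g} → (∀ i → 1 ≤ i → i ≤ n → f i ≡ g i) → S n f ≡ S n g
S-cong zero e = refl
S-cong (suc n) e = cong₂ _⊕_ (S-cong n λ i l u → e i l (m≤n⇒m≤1+n u)) (e (suc n) (s≤s z≤n) ≤-refl)

S-zero : ∀ n {f} → (∀ i → 1 ≤ i → i ≤ n → f i ≡ + 0) → S n f ≡ + 0
S-zero zero e = refl
S-zero (suc n) e = cong₂ _⊕_ (S-zero n λ i l u → e i l (m≤n⇒m≤1+n u)) (e (suc n) (s≤s z≤n) ≤-refl)

S-+ : ∀ n f g → S n (λ i → f i ⊕ g i) ≡ S n f ⊕ S n g
S-+ zero f g = refl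
S-+ (suc n) f g = trans (cong (_⊕ (f (suc n) ⊕ g (suc n))) (S-+ n f g)) (lem (S n f) (S n g) (f (suc n)) (g (suc n)))
  where lem : ∀ a b c d → a ⊕ b ⊕ (c ⊕ d) ≡ a ⊕ c ⊕ (b ⊕ d)
        lem = ring-ℤ

S-* : ∀ n a f → S n (λ i → a ⊗ f i) ≡ a ⊗ S n f
S-* zero a f = sym (ℤ.*-zeroʳ a)
S-* (suc n) a f = trans (cong (_⊕ (a ⊗ f (suc n))) (S-* n a f)) (sym (ℤ.*-distribˡ-+ a (S n f) (f (suc n))))

S-split : ∀ m k f → S (m + k) f ≡ S m f ⊕ S k (λ i → f (m + i))
S-split m zero f = trans (cong (λ x → S x f) (+-identityʳ m)) (sym (ℤ.+-identityʳ (S m f)))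
S-split m (suc k) f = trans (cong (λ x → S x f) (+-suc m k)) (trans
    (cong₂ _⊕_ (S-split m k f) (cong f (sym (+-suc m k))))
  (ℤ.+-assoc (S m f) _ _))

S-extend : ∀ {n m} f → n ≤ m → (∀ i → n < i → f i ≡ + 0) → S m f ≡ S n f
S-extend {n} {m} f n≤m e = trans (cong (λ x → S x f) (sym (m+[n∸m]≡n n≤m))) (trans (S-split n (m ∸ n) f)
  (trans (cong (_⊕_ (S n f)) (S-zero (m ∸ n) λ i l _ → e (n + i) (subst (_≤ n + i) (+-comm n 1) (+-monoʳ-≤ n l))))
      (ℤ.+-identityʳ (S n f))))

S-comm : ∀ m n (f : ℕ → ℕ → ℤ) → S m (λ i → S n (f i)) ≡ S n (λ j → S m (λ i → f i j))
S-comm zero n f = sym (S-zero n λ _ _ _ → refl)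
S-comm (suc m) n f = trans (cong (_⊕ S n (f (suc m))) (S-comm m n f))
    (sym (S-+ n (λ j → S m (λ i → f i j)) (f (suc m))))

S-mono : ∀ n {f g} → (∀ i → 1 ≤ i → i ≤ n → f i ℤ.≤ g i) → S n f ℤ.≤ S n g
S-mono zero e = ℤ.≤-refl
S-mono (suc n) e = ℤ.+-mono-≤ (S-mono n λ i l u → e i l (m≤n⇒m≤1+n u)) (e (suc n) (s≤s z≤n) ≤-refl)

S-nonneg : ∀ n {f} → (∀ i → 1 ≤ i → i ≤ n → + 0 ℤ.≤ f i) → + 0 ℤ.≤ S n f
S-nonneg zero e = ℤ.≤-refl
S-nonneg (suc n) e = ℤ.+-mono-≤ (S-nonneg n λ i l u → e i l (m≤n⇒m≤1+n u)) (e (suc n) (s≤s z≤n) ≤-refl)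

S-multiples : ∀ P .{{_ : NonZero P}} N g → (∀ u → P ∤ u → g u ≡ + 0) → S (P * N) g ≡ S N (λ w → g (P * w))
S-multiples P zero g e = cong (λ x → S x g) (*-zeroʳ P)
S-multiples P@(suc P′) (suc N) g e = trans (cong (λ x → S x g) (trans (*-suc P N) (+-comm P (P * N))))
    (trans (S-split (P * N) P g)
  (cong₂ _⊕_ (S-multiples P N g e) (trans (cong₂ _⊕_ (S-zero P′ λ i l u → e (P * N + i) λ d →
      <⇒≱ (s≤s u) (∣⇒≤ {{>-nonZero l}} (∣m+n∣m⇒∣n d (m∣m*n N)))) refl)
          (trans (ℤ.+-identityˡ _) (cong g (trans (+-comm (P * N) P) (sym (*-suc P N)))))))  )

δ : ∀ {P : Set} → Dec P → ℤ
δ (yes _) = + 1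
δ (no _) = + 0

δ-yes : ∀ {P : Set} (d : Dec P) → P → δ d ≡ + 1
δ-yes (yes _) _ = refl
δ-yes (no n) p = ⊥-elim (n p)

δ-no : ∀ {P : Set} (d : Dec P) → ¬ P → δ d ≡ + 0
δ-no (yes p) n = ⊥-elim (n p)
δ-no (no _) _ = refl

δ-⇔ : ∀ {P Q : Set} (d : Dec P) (d′ : Dec Q) → (P → Q) → (Q → P) → δ d ≡ δ d′
δ-⇔ (yes p) d′ f g = sym (δ-yes d′ (f p))
δ-⇔ (no n) d′ f g = sym (δ-no d′ (n ∘ g))

-- Square roots of -m modulo composite numbers

bezoutℤ : ∀ {p q} → Coprime p q → ∃₂ λ α β → α ⊗ + p ⊕ β ⊗ + q ≡ + 1
bezoutℤ {p} {q} c with coprime-Bézout c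
... | Bézout.+- x y e = + x , ⊝ + y , trans (cong₂ _⊕_ (trans (sym (ℤ.pos-* x p))
    (trans (cong +_ (sym e)) (ℤ.pos-+ 1 (y * q)))) (sym (ℤ.neg-distribˡ-* (+ y) (+ q))))
   (trans (cong (λ z → + 1 ⊕ z ⊖ (+ y ⊗ + q)) (ℤ.pos-* y q)) (lem (+ 1) (+ y ⊗ + q)))
  where lem : ∀ a b → a ⊕ b ⊖ b ≡ a
        lem = ring-ℤ
... | Bézout.-+ x y e = ⊝ + x , + y , trans (cong₂ _⊕_ (sym (ℤ.neg-distribˡ-* (+ x) (+ p)))
    (trans (sym (ℤ.pos-* y q)) (trans (cong +_ (sym e)) (ℤ.pos-+ 1 (x * p)))))
   (trans (cong (λ z → ⊝ (+ x ⊗ + p) ⊕ (+ 1 ⊕ z)) (ℤ.pos-* x p)) (lem (+ 1) (+ x ⊗ + p)))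
  where lem : ∀ a b → ⊝ b ⊕ (a ⊕ b) ≡ a
        lem = ring-ℤ

Root : ℕ → ℕ → Set
Root m q = ∃ λ b → b ⊗ b ⊕ + m ≈ + 0 [ + q ]

≈-+ʳ : ∀ {n x y} z → x ≈ y [ n ] → x ⊕ z ≈ y ⊕ z [ n ]
≈-+ʳ {n} {x} {y} z (via q e) = via q (trans (cong (_⊕ z) e) (lem y (q ⊗ n) z))
  where lem : ∀ y w z → y ⊕ w ⊕ z ≡ y ⊕ z ⊕ w
        lem = ring-ℤ

≈0-* : ∀ {p q z} → Coprime p q → z ≈ + 0 [ + p ] → z ≈ + 0 [ + q ] → z ≈ + 0 [ + (p * q) ]
≈0-* {p} {q} {z} c (via x e) (via y e′) with bezoutℤ c
... | α , β , one = via (α ⊗ y ⊕ β ⊗ x) (trans (sym (ℤ.*-identityˡ z)) (trans (cong (_⊗ z) (sym one))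
      (trans (lem₀ (α ⊗ + p) (β ⊗ + q) z) (trans (cong₂ (λ u v → α ⊗ + p ⊗ u ⊕ β ⊗ + q ⊗ v) e′ e)
      (trans (lem₁ α β x y (+ p) (+ q)) (cong (λ w → + 0 ⊕ (α ⊗ y ⊕ β ⊗ x) ⊗ w) (sym (ℤ.pos-* p q))))))))
  where
  lem₀ : ∀ a b z → (a ⊕ b) ⊗ z ≡ a ⊗ z ⊕ b ⊗ z
  lem₀ = ring-ℤ
  lem₁ : ∀ α β X Y p q → α ⊗ p ⊗ (+ 0 ⊕ Y ⊗ q) ⊕ β ⊗ q ⊗ (+ 0 ⊕ X ⊗ p) ≡ + 0 ⊕ (α ⊗ Y ⊕ β ⊗ X) ⊗ (p ⊗ q)
  lem₁ = ring-ℤ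

root-≈ : ∀ {m n b b′} → b ≈ b′ [ + n ] → b′ ⊗ b′ ⊕ + m ≈ + 0 [ + n ] → b ⊗ b ⊕ + m ≈ + 0 [ + n ]
root-≈ {m} e r = ≈-trans (≈-+ʳ (+ m) (≈-* e e)) r

root-* : ∀ {m p q} → Coprime p q → Root m p → Root m q → Root m (p * q)
root-* {m} {p} {q} c (b , r) (b′ , r′) with bezoutℤ c
... | α , β , one = B , ≈0-* c (root-≈ {m} B≈b r) (root-≈ {m} B≈b′ r′)
  where
  B = b ⊗ (β ⊗ + q) ⊕ b′ ⊗ (α ⊗ + p)
  B≈b : B ≈ b [ + p ]
  B≈b = via ((b′ ⊖ b) ⊗ α) (trans (lem b b′ α β (+ p) (+ q)) (trans (cong (λ o → b ⊗ o ⊕ (b′ ⊖ b) ⊗ α ⊗ + p) one)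
      (cong (_⊕ (b′ ⊖ b) ⊗ α ⊗ + p) (ℤ.*-identityʳ b))))
    where lem : ∀ b b′ α β p q → b ⊗ (β ⊗ q) ⊕ b′ ⊗ (α ⊗ p) ≡ b ⊗ (α ⊗ p ⊕ β ⊗ q) ⊕ (b′ ⊖ b) ⊗ α ⊗ p
          lem = ring-ℤ
  B≈b′ : B ≈ b′ [ + q ]
  B≈b′ = via ((b ⊖ b′) ⊗ β) (trans (lem b b′ α β (+ p) (+ q)) (trans (cong (λ o → b′ ⊗ o ⊕ (b ⊖ b′) ⊗ β ⊗ + q) one)
      (cong (_⊕ (b ⊖ b′) ⊗ β ⊗ + q) (ℤ.*-identityʳ b′))))
    where lem : ∀ b b′ α β p q → b ⊗ (β ⊗ q) ⊕ b′ ⊗ (α ⊗ p) ≡ b′ ⊗ (α ⊗ p ⊕ β ⊗ q) ⊕ (b ⊖ b′) ⊗ β ⊗ q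
          lem = ring-ℤ

-- The substitute for "n is a prime modulo which -m is a square". Pairs of equal prime factors go
-- into s, so that inert primes can occur there.
record Good (m n : ℕ) : Set where
  constructor good
  field
    s q : ℕ
    n≡ : n ≡ s * s * q
    root : Root m q

prime-divisor : ∀ n → 1 < n → ∃ λ p → Prime p × p ∣ n
prime-divisor n@(suc _) 1<n with factorise n
... | record { factors = [] ; isFactorisation = e } = ⊥-elim (<-irrefl (sym e) 1<n)
... | record { factors = p ∷ ps ; isFactorisation = e ; factorsPrime = pr ∷ _ } = p , pr , subst (p ∣_) (sym e)
    (m∣m*n _)

extract : ∀ p → 1 < p → ∀ n → 1 ≤ n → ∃₂ λ e k → n ≡ p ^ e * k × p ∤ k × 1 ≤ k
extract p 1<p = <-rec _ step
  where
  step : ∀ n → (∀ {n′} → n′ < n → 1 ≤ n′ → ∃₂ λ e k → n′ ≡ p ^ e * k × p ∤ k × 1 ≤ k) → 1 ≤ n → ∃₂ λ e k → n ≡ p ^ e * k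
      × p ∤ k × 1 ≤ k
  step n rec 1≤n with p ∣? n
  ... | no p∤n = 0 , n , sym (+-identityʳ n) , p∤n , 1≤n
  ... | yes (divides zero eq) = ⊥-elim (<-irrefl (sym eq) 1≤n)
  ... | yes (divides q@(suc _) eq) with rec {q} (subst (q <_) (sym eq) (m<m*n q p 1<p)) (s≤s z≤n)
  ... | e , k , eq′ , p∤k , 1≤k = suc e , k , trans eq (trans (cong (_* p) eq′)
      (trans (*-comm (p ^ e * k) p) (sym (*-assoc p (p ^ e) k)))) , p∤k , 1≤k

evenOrOdd : ∀ n → ∃ λ j → n ≡ j + j ⊎ n ≡ suc (j + j)
evenOrOdd zero = 0 , inj₁ refl
evenOrOdd (suc n) with evenOrOdd n
... | j , inj₁ e = j , inj₂ (cong suc e)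
... | j , inj₂ e = suc j , inj₁ (cong suc (trans e (sym (+-suc j j))))

coprime-^ : ∀ {p k} → Prime p → p ∤ k → ∀ e → Coprime (p ^ e) k
coprime-^ pr p∤k zero (d , _) = ∣1⇒≡1 d
coprime-^ {p} {k} pr p∤k (suc e) = coprime-* {p} {p ^ e} base (coprime-^ pr p∤k e)
  where
  base : Coprime p k
  base {d} (d∣p , d∣k) with prime⇒irreducible pr d∣p
  ... | inj₁ d≡1 = d≡1
  ... | inj₂ d≡p = ⊥-elim (p∤k (subst (_∣ k) d≡p d∣k))

module DivisorSum (χ : ℕ → ℤ) (χ-1 : χ 1 ≡ + 1) (χ-* : ∀ u v → χ (u * v) ≡ χ u ⊗ χ v) (m : ℕ) where

  f : ℕ → ℤ
  f n = S n λ u → δ (u ∣? n) ⊗ χ u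

  f-extend : ∀ {n B} → 1 ≤ n → n ≤ B → S B (λ u → δ (u ∣? n) ⊗ χ u) ≡ f n
  f-extend {n} {B} 1≤n n≤B = S-extend _ n≤B λ i n<i → cong (_⊗ χ i)
      (δ-no (i ∣? n) λ d → <⇒≱ n<i (∣⇒≤ {{>-nonZero 1≤n}} d))

  Split : ℕ → Set
  Split p = χ p ≡ + 1 × Root m p

  Admissible : ℕ → Set
  Admissible n = ∀ p → Prime p → p ∣ n → Split p ⊎ χ p ≡ -[1+ 0 ]

  module _ {p} (pr : Prime p) where
    private instance
      nz : NonZero p
      nz = prime⇒nonZero pr

    -- A divisor of p^(e+1)·k either divides p^e·k already or is p^(e+1)·w with w a divisor of k.
    f-step : ∀ e k → p ∤ k → 1 ≤ k → f (p ^ suc e * k) ≡ f (p ^ e * k) ⊕ χ (p ^ suc e) ⊗ f k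
    f-step e k p∤k 1≤k = begin
      S (P * k) (λ u → δ (u ∣? P * k) ⊗ χ u)
        ≡⟨ S-cong (P * k) (λ u _ _ → trans (cong (_⊗ χ u) (split u))
            (ℤ.*-distribʳ-+ (χ u) (δ (u ∣? P′ * k)) (δ (both u)))) ⟩
      S (P * k) (λ u → δ (u ∣? P′ * k) ⊗ χ u ⊕ δ (both u) ⊗ χ u)
        ≡⟨ S-+ (P * k) (λ u → δ (u ∣? P′ * k) ⊗ χ u) (λ u → δ (both u) ⊗ χ u) ⟩
      S (P * k) (λ u → δ (u ∣? P′ * k) ⊗ χ u) ⊕ S (P * k) (λ u → δ (both u) ⊗ χ u)
        ≡⟨ cong₂ _⊕_ (f-extend (*-mono-≤ (>-nonZero⁻¹ P′ {{nzP′}}) 1≤k) (*-monoˡ-≤ k (m≤n*m P′ p)))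
            (S-multiples P {{nzP}} k (λ u → δ (both u) ⊗ χ u) λ u P∤u → cong (_⊗ χ u) (δ-no (both u) (P∤u ∘ proj₁))) ⟩
      f (P′ * k) ⊕ S k (λ w → δ (both (P * w)) ⊗ χ (P * w))
        ≡⟨ cong (_⊕_ (f (P′ * k))) (trans (S-cong k λ w _ _ → trans
             (cong₂ _⊗_ (δ-⇔ (both (P * w)) (w ∣? k) (λ (_ , d) → *-cancelˡ-∣ P {{nzP}} d)
                 (λ d → m∣m*n w , *-monoʳ-∣ P d)) (χ-* P w))
             (lem (δ (w ∣? k)) (χ P) (χ w))) (S-* k (χ P) (λ w → δ (w ∣? k) ⊗ χ w))) ⟩
      f (P′ * k) ⊕ χ P ⊗ f k ∎
      where
      open ≡-Reasoning
      P′ = p ^ e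
      P = p ^ suc e
      nzP′ : NonZero P′
      nzP′ = m^n≢0 p e
      nzP : NonZero P
      nzP = m^n≢0 p (suc e)
      both : ∀ u → Dec (P ∣ u × u ∣ P * k)
      both u = (P ∣? u) ×-dec (u ∣? P * k)
      lem : ∀ a b c → a ⊗ (b ⊗ c) ≡ b ⊗ (a ⊗ c)
      lem = ring-ℤ
      P-not : ∀ u → u ∣ P′ * k → P ∣ u → ⊥
      P-not u d d′ = p∤k (*-cancelˡ-∣ P′ {{nzP′}} (subst (_∣ P′ * k) (*-comm p P′) (∣-trans d′ d)))
      P-or : ∀ u → u ∣ P * k → u ∣ P′ * k ⊎ P ∣ u
      P-or u (divides t eq) with p ∣? t
      ... | yes (divides t′ eq′) = inj₁ (divides t′ (*-cancelˡ-≡ _ _ p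
          (trans (sym (*-assoc p P′ k)) (trans eq (trans (cong (_* u) eq′) (lem₂ t′ p u))))))
        where lem₂ : ∀ t p u → t * p * u ≡ p * (t * u)
              lem₂ = ring-ℕ
      ... | no p∤t = inj₂ (coprime-divisor {P} {t} (coprime-^ pr p∤t (suc e)) (divides k (trans (sym eq) (*-comm P k))))
      split : ∀ u → δ (u ∣? P * k) ≡ δ (u ∣? P′ * k) ⊕ δ (both u)
      split u with u ∣? P′ * k
      ... | yes d = trans (δ-yes (u ∣? P * k) (∣-trans d (*-monoˡ-∣ k (n∣m*n p))))
                     (sym (cong (_⊕_ (+ 1)) (δ-no (both u) λ (d′ , _) → P-not u d d′)))
      ... | no nd = trans (δ-⇔ (u ∣? P * k) (both u) (λ d → (case P-or u d of λ
          { (inj₁ x) → ⊥-elim (nd x) ; (inj₂ y) → y }) , d) proj₂) (sym (ℤ.+-identityˡ _))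

    χ-^ : ∀ e → χ (p ^ e) ≡ χ p ℤ.^ e
    χ-^ zero = χ-1
    χ-^ (suc e) = trans (χ-* p (p ^ e)) (cong (_⊗_ (χ p)) (χ-^ e))

    f-split : χ p ≡ + 1 → ∀ e k → p ∤ k → 1 ≤ k → f (p ^ e * k) ≡ + suc e ⊗ f k
    f-split χp zero k _ _ = trans (cong f (+-identityʳ k)) (sym (ℤ.*-identityˡ (f k)))
    f-split χp (suc e) k p∤k 1≤k = trans (f-step e k p∤k 1≤k) (trans
        (cong₂ (λ x y → x ⊕ y ⊗ f k) (f-split χp e k p∤k 1≤k)
        (trans (χ-^ (suc e)) (trans (cong (ℤ._^ suc e) χp) (ℤ.^-zeroˡ (suc e)))))
      (trans (sym (ℤ.*-distribʳ-+ (f k) (+ suc e) (+ 1))) (cong (λ x → + x ⊗ f k) (+-comm (suc e) 1))))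

    f-inert : χ p ≡ -[1+ 0 ] → ∀ j k → p ∤ k → 1 ≤ k → f (p ^ (j + j) * k) ≡ f k × f (p ^ suc (j + j) * k) ≡ + 0
    f-inert χp j k p∤k 1≤k = even j , odd′ j
      where
      minus : ∀ j → -[1+ 0 ] ℤ.^ (j + j) ≡ + 1
      minus zero = refl
      minus (suc j) = trans (cong (-[1+ 0 ] ℤ.^_) (+-suc (suc j) j)) (trans (lem (-[1+ 0 ] ℤ.^ (j + j))) (minus j))
        where lem : ∀ x → -[1+ 0 ] ⊗ (-[1+ 0 ] ⊗ x) ≡ x
              lem = ring-ℤ
      even : ∀ j → f (p ^ (j + j) * k) ≡ f k
      odd′ : ∀ j → f (p ^ suc (j + j) * k) ≡ + 0
      even zero = cong f (+-identityʳ k)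
      even (suc j) = trans (cong (λ e → f (p ^ e * k)) (+-suc (suc j) j)) (trans (f-step (suc (j + j)) k p∤k 1≤k)
        (trans (cong₂ (λ x y → x ⊕ y ⊗ f k) (odd′ j) (trans (χ-^ (suc (suc (j + j))))
            (trans (cong (ℤ._^ suc (suc (j + j))) χp) (trans (cong (-[1+ 0 ] ℤ.^_) (sym (+-suc (suc j) j)))
            (minus (suc j))))))
        (trans (ℤ.+-identityˡ _) (ℤ.*-identityˡ (f k)))))
      odd′ j = trans (f-step (j + j) k p∤k 1≤k)
        (trans (cong₂ (λ x y → x ⊕ y ⊗ f k) (even j) (trans (χ-^ (suc (j + j)))
            (trans (cong (ℤ._^ suc (j + j)) χp) (trans (cong (_⊗_ -[1+ 0 ]) (minus j)) refl))))
        (lem (f k)))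
        where lem : ∀ x → x ⊕ -[1+ 0 ] ⊗ x ≡ + 0
              lem = ring-ℤ

  Positive : ℕ → Set
  Positive n = + 1 ℤ.≤ f n × Good m n

  -- Strong induction that strips one prime p with its full power. A split p multiplies f by its
  -- exponent plus one; an inert p leaves f unchanged or kills it, according to the parity of its
  -- exponent. `Admissible` excludes χ p = 0.
  dichotomy : ∀ n → 1 ≤ n → Admissible n → f n ≡ + 0 ⊎ Positive n
  dichotomy = <-rec _ step
    where
    step : ∀ n → (∀ {k} → k < n → 1 ≤ k → Admissible k → f k ≡ + 0 ⊎ Positive k) → 1 ≤ n → Admissible n → f n ≡ + 0 ⊎
        Positive n
    step 1 _ _ _ = inj₂ (ℤ.≤-reflexive (sym (trans (ℤ.+-identityˡ _)
        (trans (cong₂ _⊗_ (δ-yes (1 ∣? 1) ∣-refl) χ-1) refl))) ,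
      good 1 1 refl (+ 0 , via (+ m) (trans (ℤ.+-identityˡ (+ m))
          (trans (sym (ℤ.*-identityʳ (+ m))) (sym (ℤ.+-identityˡ _))))))
    step n@(suc (suc _)) rec 1≤n adm with prime-divisor n (s≤s (s≤s z≤n))
    ... | p , pr , p∣n with extract p (nonTrivial⇒n>1 p {{prime⇒nonTrivial pr}}) n 1≤n
    ... | zero , k , eq , p∤k , 1≤k = ⊥-elim (p∤k (subst (p ∣_) (trans eq (+-identityʳ k)) p∣n))
    ... | suc e , k , eq , p∤k , 1≤k = go (rec k<n 1≤k (λ q pq d → adm q pq (∣-trans d k∣n))) (adm p pr p∣n)
      where
      instance
        nzp : NonZero p
        nzp = prime⇒nonZero pr
      1<P : 1 < p ^ suc e
      1<P = ≤-trans (nonTrivial⇒n>1 p {{prime⇒nonTrivial pr}}) (m≤m*n p (p ^ e) {{m^n≢0 p e}})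
      k<n : k < n
      k<n = subst (k <_) (trans (*-comm k (p ^ suc e)) (sym eq)) (m<m*n k (p ^ suc e) {{>-nonZero 1≤k}} 1<P)
      k∣n : k ∣ n
      k∣n = divides (p ^ suc e) eq
      even-good : ∀ j → suc e ≡ j + j → Good m k → Good m n
      even-good j e≡ (good s q k≡ r) = good (p ^ j * s) q (trans eq
          (trans (cong₂ _*_ (trans (cong (p ^_) e≡) (^-distribˡ-+-* p j j)) k≡) (lem (p ^ j) s q))) r
        where lem : ∀ x s q → x * x * (s * s * q) ≡ x * s * (x * s) * q
              lem = ring-ℕ
      go : f k ≡ + 0 ⊎ Positive k → Split p ⊎ χ p ≡ -[1+ 0 ] → f n ≡ + 0 ⊎ Positive n
      go (inj₁ fk) (inj₁ (χp , _)) = inj₁ (trans (cong f eq) (trans (f-split pr χp (suc e) k p∤k 1≤k)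
          (trans (cong (_⊗_ (+ suc (suc e))) fk) (ℤ.*-zeroʳ (+ suc (suc e))))))
      go (inj₂ (pos , g)) (inj₁ (χp , r)) = inj₂ (subst (λ x → + 1 ℤ.≤ x)
          (sym (trans (cong f eq) (f-split pr χp (suc e) k p∤k 1≤k))) bound , good-n)
        where
        bound : + 1 ℤ.≤ + suc (suc e) ⊗ f k
        bound = ℤ.≤-trans (ℤ.+≤+ (s≤s z≤n)) (ℤ.≤-trans (ℤ.≤-reflexive (sym (ℤ.*-identityʳ (+ suc (suc e)))))
            (ℤ.*-monoˡ-≤-nonNeg (+ suc (suc e)) pos))
        good-n : Good m n
        good-n with evenOrOdd (suc e)
        ... | j , inj₁ e≡ = even-good j e≡ g
        ... | j , inj₂ e≡ = let good s q k≡ rq = g in good (p ^ j * s) (p * q)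
              (trans eq (trans (cong₂ _*_ (trans (cong (p ^_) e≡) (cong (p *_) (^-distribˡ-+-* p j j))) k≡)
                  (lem p (p ^ j) s q)))
              (root-* {m} {p} {q} (coprime-q s q k≡) r rq)
          where
          lem : ∀ p x s q → p * (x * x) * (s * s * q) ≡ x * s * (x * s) * (p * q)
          lem = ring-ℕ
          coprime-q : ∀ s q → k ≡ s * s * q → Coprime p q
          coprime-q s q k≡ {d} (a , b) = coprime-^ pr p∤k 1 (subst (d ∣_) (sym (*-identityʳ p)) a , subst (d ∣_)
              (sym k≡) (∣n⇒∣m*n (s * s) b))
      go d (inj₂ χp) with evenOrOdd (suc e)
      ... | j , inj₂ e≡ = inj₁ (trans (cong f eq) (trans (cong (λ e → f (p ^ e * k)) e≡)
          (proj₂ (f-inert pr χp j k p∤k 1≤k))))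
      ... | j , inj₁ e≡ = lift d
        where
        fn : f n ≡ f k
        fn = trans (cong f eq) (trans (cong (λ e → f (p ^ e * k)) e≡) (proj₁ (f-inert pr χp j k p∤k 1≤k)))
        lift : f k ≡ + 0 ⊎ Positive k → f n ≡ + 0 ⊎ Positive n
        lift (inj₁ z) = inj₁ (trans fn z)
        lift (inj₂ (pos , g)) = inj₂ (subst (λ x → + 1 ℤ.≤ x) (sym fn) pos , even-good j e≡ g)

  f-all : ∀ n → 1 ≤ n → (∀ u → u ∣ n → χ u ≡ + 1) → + 1 ℤ.≤ f n
  f-all n@(suc n′) _ all = ℤ.+-mono-≤ {+ 0} (S-nonneg n′ λ u _ _ → term u)
      (ℤ.≤-reflexive (sym (trans (cong₂ _⊗_ (δ-yes (n ∣? n) ∣-refl) (all n ∣-refl)) refl)))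
    where
    term : ∀ u → + 0 ℤ.≤ δ (u ∣? n) ⊗ χ u
    term u with u ∣? n
    ... | yes d = subst (λ x → + 0 ℤ.≤ x) (sym (trans (ℤ.*-identityˡ (χ u)) (all u d))) (ℤ.+≤+ z≤n)
    ... | no _ = ℤ.≤-reflexive (sym (ℤ.*-zeroˡ (χ u)))

-- The hyperbola method

≈⇒% : ∀ Q .{{_ : NonZero Q}} a b → + a ≈ + b [ + Q ] → a % Q ≡ b % Q
≈⇒% Q a b e = case ≤-total a b of λ
  { (inj₁ a≤b) → sym (ordered a b a≤b (subst (Q ∣_) (ℤ.∣i-j∣≡∣j-i∣ (+ a) (+ b)) (≈⇒∣ e)))
  ; (inj₂ b≤a) → ordered b a b≤a (≈⇒∣ e) }
  where
  ordered : ∀ a b → a ≤ b → Q ∣ ℤ.∣ + b ⊖ + a ∣ → b % Q ≡ a % Q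
  ordered a b a≤b (divides k eq) = trans (cong (_% Q) (trans (sym (m+[n∸m]≡n a≤b)) (cong (λ x → a + x)
    (trans (cong ℤ.∣_∣ (sym (trans (ℤ.m-n≡m⊖n b a) (ℤ.⊖-≥ a≤b)))) eq)))) ([m+kn]%n≡m%n a k Q)

≈-% : ∀ Q .{{_ : NonZero Q}} a → + a ≈ + (a % Q) [ + Q ]
≈-% Q a = via (+ (a / Q)) (+-cast a (a % Q) Q (a / Q) (m≡m%n+[m/n]*n a Q))

%⇒≈ : ∀ Q .{{_ : NonZero Q}} a b → a % Q ≡ b % Q → + a ≈ + b [ + Q ]
%⇒≈ Q a b e = ≈-trans (≈-% Q a) (≈-trans (≈-reflexive (cong +_ e)) (≈-sym (≈-% Q b)))

coprime-% : ∀ Q .{{_ : NonZero Q}} {a b} → a % Q ≡ b % Q → Coprime a Q → Coprime b Q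
coprime-% Q {a} {b} e c {d} (d∣b , d∣Q) = c (subst (d ∣_) (sym (m≡m%n+[m/n]*n a Q))
    (∣m∣n⇒∣m+n (subst (d ∣_) (sym e) d∣b%) (∣n⇒∣m*n (a / Q) d∣Q)) , d∣Q)
  where
  d∣b% : d ∣ b % Q
  d∣b% = ∣m+n∣m⇒∣n (subst (d ∣_) (trans (m≡m%n+[m/n]*n b Q) (+-comm (b % Q) _)) d∣b) (∣n⇒∣m*n (b / Q) d∣Q)

inverse : ∀ {u Q} .{{_ : NonZero Q}} → Coprime u Q → ∃ λ w → + u ⊗ + w ≈ + 1 [ + Q ]
inverse {u} {Q@(suc Q′)} c with bezoutℤ c
... | α , β , one = w α , ≈-trans (≈-*ˡ (+ u) (w≈ α)) (via (⊝ β)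
    (trans (lem₁ (+ u) α β (+ Q)) (cong (λ x → x ⊕ ⊝ β ⊗ + Q) one)))
  where
  lem₁ : ∀ u α β Q → u ⊗ α ≡ α ⊗ u ⊕ β ⊗ Q ⊕ ⊝ β ⊗ Q
  lem₁ = ring-ℤ
  w : ℤ → ℕ
  w (+ n) = n
  w -[1+ n ] = suc n * (Q ∸ 1)
  w≈ : ∀ α → + w α ≈ α [ + Q ]
  w≈ (+ n) = ≈-refl
  w≈ -[1+ n ] = via (+ suc n) (trans (ℤ.pos-* (suc n) Q′) (lem (+ suc n) (+ Q′)))
    where lem : ∀ a b → a ⊗ b ≡ ⊝ a ⊕ a ⊗ (+ 1 ⊕ b)
          lem = ring-ℤ

S-single : ∀ n k f → 1 ≤ k → k ≤ n → (∀ i → 1 ≤ i → i ≤ n → i ≢ k → f i ≡ + 0) → S n f ≡ f k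
S-single zero k f 1≤k k≤n z = ⊥-elim (<⇒≱ 1≤k k≤n)
S-single (suc n) k f 1≤k k≤n z with k ≟ suc n
... | yes refl = trans (cong (_⊕ f (suc n)) (S-zero n λ i l u → z i l (m≤n⇒m≤1+n u) λ e → <-irrefl e (s≤s u)))
    (ℤ.+-identityˡ _)
... | no k≢ = trans (cong₂ _⊕_ (S-single n k f 1≤k (≤-pred (≤∧≢⇒< k≤n k≢)) λ i l u → z i l (m≤n⇒m≤1+n u))
    (z (suc n) (s≤s z≤n) ≤-refl (k≢ ∘ sym))) (ℤ.+-identityʳ _)

S-bound : ∀ n c f → (∀ i → 1 ≤ i → i ≤ n → ℤ.∣ f i ∣ ≤ c) → ℤ.∣ S n f ∣ ≤ n * c
S-bound zero c f b = z≤n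
S-bound (suc n) c f b = ≤-trans (ℤ.∣i+j∣≤∣i∣+∣j∣ (S n f) (f (suc n)))
    (subst (ℤ.∣ S n f ∣ + ℤ.∣ f (suc n) ∣ ≤_) (+-comm (n * c) c)
  (+-mono-≤ (S-bound n c f λ i l u → b i l (m≤n⇒m≤1+n u)) (b (suc n) (s≤s z≤n) ≤-refl)))

S-truncate : ∀ {T X} {P : ℕ → Set} (P? : ∀ v → Dec (P v)) f → T ≤ X → (∀ v → v ≤ T → P v) → (∀ v → P v → v ≤ T) →
  S X (λ v → δ (P? v) ⊗ f v) ≡ S T f
S-truncate {T} {X} P? f T≤X yes′ no′ = trans (S-extend _ T≤X λ i T<i → trans
    (cong (_⊗ f i) (δ-no (P? i) λ p → <⇒≱ T<i (no′ i p))) (ℤ.*-zeroˡ (f i)))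
  (S-cong T λ i _ u → trans (cong (_⊗ f i) (δ-yes (P? i) (yes′ i u))) (ℤ.*-identityˡ (f i)))

δ-nonneg : ∀ {P : Set} (d : Dec P) → + 0 ℤ.≤ δ d
δ-nonneg (yes _) = ℤ.+≤+ z≤n
δ-nonneg (no _) = ℤ.+≤+ z≤n

δ≤1 : ∀ {P : Set} (d : Dec P) → δ d ℤ.≤ + 1
δ≤1 (yes _) = ℤ.+≤+ (s≤s z≤n)
δ≤1 (no _) = ℤ.+≤+ z≤n

*-δ : ∀ {P : Set} (d : Dec P) {x y} → (P → x ≡ y) → δ d ⊗ x ≡ δ d ⊗ y
*-δ (yes p) e = cong (_⊗_ (+ 1)) (e p)
*-δ (no _) {x} {y} e = trans (ℤ.*-zeroˡ x) (sym (ℤ.*-zeroˡ y))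

residue-unique : ∀ {Q a b} → 1 ≤ a → a ≤ Q → 1 ≤ b → b ≤ Q → + a ≈ + b [ + Q ] → a ≡ b
residue-unique {Q} {a} {b} 1≤a a≤Q 1≤b b≤Q (via q e) = ℤ.+-injective (ℤ.i-j≡0⇒i≡j (+ a) (+ b)
    (small-multiple (+ a ⊖ + b) q Q (trans (cong (_⊖ + b) e) (lem (+ b) (q ⊗ + Q))) (small a b 1≤a a≤Q 1≤b b≤Q)))
  where
  lem : ∀ x y → x ⊕ y ⊖ x ≡ y
  lem = ring-ℤ
  small′ : ∀ a b → b ≤ a → a ≤ Q → 1 ≤ b → ℤ.∣ + a ⊖ + b ∣ < Q
  small′ a b b≤a a≤Q 1≤b = ≤-trans (s≤s (≤-reflexive (cong ℤ.∣_∣ (trans (ℤ.m-n≡m⊖n a b) (ℤ.⊖-≥ b≤a)))))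
    (<-≤-trans (∸-monoʳ-< {a} 1≤b b≤a) a≤Q)
  small : ∀ a b → 1 ≤ a → a ≤ Q → 1 ≤ b → b ≤ Q → ℤ.∣ + a ⊖ + b ∣ < Q
  small a b 1≤a a≤Q 1≤b b≤Q with ≤-total b a
  ... | inj₁ b≤a = small′ a b b≤a a≤Q 1≤b
  ... | inj₂ a≤b = subst (_< Q) (ℤ.∣i-j∣≡∣j-i∣ (+ b) (+ a)) (small′ b a a≤b b≤Q 1≤a)

residue : ∀ {Q} .{{_ : NonZero Q}} y → ∃ λ v → 1 ≤ v × v ≤ Q × + v ≈ + y [ + Q ]
residue {Q} y with y % Q in eq
-- Representatives lie in 1, ..., Q to match the range of `S`, so remainder 0 becomes Q.
... | zero = Q , >-nonZero⁻¹ Q , ≤-refl , ≈-trans (via (+ 1) (sym (trans (ℤ.+-identityˡ _) (ℤ.*-identityˡ (+ Q)))))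
    (≈-sym (subst (λ r → + y ≈ + r [ + Q ]) eq (≈-% Q y)))
... | suc r = suc r , s≤s z≤n , subst (_≤ Q) eq (<⇒≤ (m%n<n y Q)) , ≈-sym (subst (λ r → + y ≈ + r [ + Q ]) eq (≈-% Q y))

module Progressions (Q : ℕ) .{{nzQ : NonZero Q}} where

  hit : ℕ → ℕ → ℤ
  hit r n = δ (n % Q ≟ r % Q)

  module _ {u : ℕ} (cu : Coprime u Q) where

    count : ℕ → ℕ → ℤ
    count r n = S n λ v → hit r (u * v)

    count-one : ∀ r v₀ → 1 ≤ v₀ → v₀ ≤ Q → + u ⊗ + v₀ ≈ + r [ + Q ] → count r Q ≡ + 1
    count-one r v₀ 1≤v₀ v₀≤Q solves =
      trans (S-single Q v₀ (λ v → hit r (u * v)) 1≤v₀ v₀≤Q λ i l h i≢v₀ → δ-no (u * i % Q ≟ r % Q) λ e → i≢v₀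
          (residue-unique l h 1≤v₀ v₀≤Q
          (≈-cancelˡ u {+ i} {+ v₀} cu (≈-trans (≈-reflexive (sym (ℤ.pos-* u i)))
              (≈-trans (%⇒≈ Q (u * i) r e) (≈-sym solves))))))
        (δ-yes (u * v₀ % Q ≟ r % Q) (≈⇒% Q (u * v₀) r (≈-trans (≈-reflexive (ℤ.pos-* u v₀)) solves)))

    count-Q : ∀ r → count r Q ≡ + 1
    count-Q r with inverse cu
    ... | w , uw≈1 with residue (r * w)
    ... | v₀ , l , h , v₀≈ = count-one r v₀ l h (≈-trans (≈-*ˡ (+ u) v₀≈)
        (≈-trans (≈-reflexive (trans (cong (_⊗_ (+ u)) (ℤ.pos-* r w)) (lem′ (+ u) (+ r) (+ w))))
        (≈-trans (≈-*ˡ (+ r) uw≈1) (≈-reflexive (ℤ.*-identityʳ (+ r))))))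
      where
      lem′ : ∀ a b c → a ⊗ (b ⊗ c) ≡ b ⊗ (a ⊗ c)
      lem′ = ring-ℤ

    count-+Q : ∀ r t s → count r (t * Q + s) ≡ + t ⊕ count r s
    count-+Q r zero s = sym (ℤ.+-identityˡ _)
    count-+Q r (suc t) s = trans (cong (count r) (+-assoc Q (t * Q) s)) (trans (S-split Q (t * Q + s) _)
      (trans (cong₂ _⊕_ (count-Q r) (trans (S-cong (t * Q + s) λ i _ _ → cong (λ x → δ (x ≟ r % Q)) (period i))
          (count-+Q r t s)))
        (sym (ℤ.+-assoc (+ 1) (+ t) (count r s)))))
      where
      period : ∀ i → u * (Q + i) % Q ≡ u * i % Q
      period i = trans (cong (_% Q) (trans (*-distribˡ-+ u Q i) (+-comm (u * Q) (u * i)))) ([m+kn]%n≡m%n (u * i) u Q)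

    count-bounds : ∀ r n → + (n / Q) ℤ.≤ count r n × count r n ℤ.≤ + (n / Q) ⊕ + 1
    count-bounds r n = subst (λ x → + (n / Q) ℤ.≤ x × x ℤ.≤ + (n / Q) ⊕ + 1) (sym eq)
        (ℤ.i≤i+j (+ (n / Q)) _ {{ℤ.nonNegative (S-nonneg s λ i _ _ → δ-nonneg (u * i % Q ≟ r % Q))}} ,
         ℤ.+-monoʳ-≤ (+ (n / Q)) (subst (count r s ℤ.≤_) (count-Q r) s≤Q))
      where
      s = n % Q
      eq : count r n ≡ + (n / Q) ⊕ count r s
      eq = trans (cong (count r) (trans (m≡m%n+[m/n]*n n Q) (+-comm s (n / Q * Q)))) (count-+Q r (n / Q) s)
      s≤Q : count r s ℤ.≤ count r Q
      s≤Q = subst (λ x → count r s ℤ.≤ count r x) (m+[n∸m]≡n (<⇒≤ (m%n<n n Q)))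
          (subst (count r s ℤ.≤_) (sym (S-split s (Q ∸ s) _))
        (ℤ.i≤i+j (count r s) _ {{ℤ.nonNegative (S-nonneg (Q ∸ s) λ i _ _ → δ-nonneg (u * (s + i) % Q ≟ r % Q))}}))

    -- Among any Q consecutive v exactly one solves uv ≡ r, whatever r is; both counts therefore lie
    -- between n / Q and n / Q + 1.
    balance : ∀ a b n → ℤ.∣ S n (λ v → hit a (u * v) ⊖ hit b (u * v)) ∣ ≤ 1
    balance a b n = subst (λ x → ℤ.∣ x ∣ ≤ 1) (sym (S-minus n)) (close (count-bounds a n) (count-bounds b n))
      where
      S-minus : ∀ n → S n (λ v → hit a (u * v) ⊖ hit b (u * v)) ≡ count a n ⊖ count b n
      S-minus zero = refl
      S-minus (suc n) = trans (cong (_⊕ (hit a (u * suc n) ⊖ hit b (u * suc n))) (S-minus n))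
          (lem (count a n) (count b n) (hit a (u * suc n)) (hit b (u * suc n)))
        where lem : ∀ x y a b → x ⊖ y ⊕ (a ⊖ b) ≡ x ⊕ a ⊖ (y ⊕ b)
              lem = ring-ℤ
      close : ∀ {t x y} → t ℤ.≤ x × x ℤ.≤ t ⊕ + 1 → t ℤ.≤ y × y ℤ.≤ t ⊕ + 1 → ℤ.∣ x ⊖ y ∣ ≤ 1
      close {t} {x} {y} (a , b) (c , d) = small (x ⊖ y)
         (subst₂ ℤ._≤_ (lem₁ t) refl (ℤ.+-mono-≤ a (ℤ.neg-mono-≤ d)))
             (subst₂ ℤ._≤_ refl (lem₂ t) (ℤ.+-mono-≤ b (ℤ.neg-mono-≤ c)))
        where
        lem₁ : ∀ t → t ⊖ (t ⊕ + 1) ≡ -[1+ 0 ]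
        lem₁ = ring-ℤ
        lem₂ : ∀ t → t ⊕ + 1 ⊖ t ≡ + 1
        lem₂ = ring-ℤ
        small : ∀ z → -[1+ 0 ] ℤ.≤ z → z ℤ.≤ + 1 → ℤ.∣ z ∣ ≤ 1
        small (+ n) _ (ℤ.+≤+ p) = p
        small -[1+ n ] (ℤ.-≤- p) _ = s≤s p

S-increasing : ∀ (g : ℕ → ℤ) (e : ℕ → ℕ) → (∀ i → + 0 ℤ.≤ g i) → (∀ j → e j < e (suc j)) → 1 ≤ e 0 →
    (∀ j → + 1 ℤ.≤ g (e j)) →
  ∀ j → + suc j ℤ.≤ S (e j) g
S-increasing g e g≥0 inc e0 g≥1 = go
  where
  mono : ∀ {a b} → a ≤ b → S a g ℤ.≤ S b g
  mono {a} {b} a≤b = subst (λ x → S a g ℤ.≤ S x g) (m+[n∸m]≡n a≤b) (subst (S a g ℤ.≤_) (sym (S-split a (b ∸ a) g))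
    (ℤ.i≤i+j (S a g) _ {{ℤ.nonNegative (S-nonneg (b ∸ a) λ i _ _ → g≥0 (a + i))}}))
  last : ∀ {n} k → n < k → + 1 ℤ.≤ g k → S n g ⊕ + 1 ℤ.≤ S k g
  last (suc k) (s≤s n≤k) one = ℤ.+-mono-≤ (mono n≤k) one
  go : ∀ j → + suc j ℤ.≤ S (e j) g
  go zero = ℤ.≤-trans (ℤ.≤-reflexive refl) (last {0} (e 0) e0 (g≥1 0))
  go (suc j) = ℤ.≤-trans (ℤ.≤-reflexive (cong +_ (+-comm 1 (suc j))))
      (ℤ.≤-trans (ℤ.+-monoˡ-≤ (+ 1) (go j)) (last (e (suc j)) (inc j) (g≥1 (suc j))))

module Hyperbola (Q m : ℕ) (1<Q : 1 < Q) (1≤m : 1 ≤ m)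
  (χ : ℕ → ℤ) (χ-1 : χ 1 ≡ + 1) (χ-* : ∀ u v → χ (u * v) ≡ χ u ⊗ χ v)
  (χ-% : .{{_ : NonZero Q}} → ∀ u v → u % Q ≡ v % Q → χ u ≡ χ v)
  (χ-unit : ∀ u → Coprime u Q → χ u ≡ + 1 ⊎ χ u ≡ -[1+ 0 ])
  (χ-root : ∀ p → Prime p → Coprime p Q → χ p ≡ + 1 → Root m p)
  (χ-norm : ∀ u x y → u ∣ x * x + m * (y * y) → Coprime u Q → Coprime u y → χ u ≡ + 1)
  (a : ℕ) (a-coprime : Coprime a Q) (χ-a : χ a ≡ + 1) where

  open DivisorSum χ χ-1 χ-* m

  instance
    nzQ : NonZero Q
    nzQ = >-nonZero (≤-trans (s≤s z≤n) 1<Q)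

  open Progressions Q

  W : ℕ → ℤ
  W n = hit a n ⊖ hit 1 n

  1-coprime : Coprime 1 Q
  1-coprime (d , _) = ∣1⇒≡1 d

  unit-abs : ∀ u → Coprime u Q → ℤ.∣ χ u ∣ ≡ 1
  unit-abs u c with χ-unit u c
  ... | inj₁ e = cong ℤ.∣_∣ e
  ... | inj₂ e = cong ℤ.∣_∣ e

  same-sign : ∀ u v r → χ r ≡ + 1 → Coprime r Q → u * v % Q ≡ r % Q → χ u ≡ χ v × Coprime u Q × Coprime v Q
  same-sign u v r χr cr e = agree (χ-unit u cu) (χ-unit v cv) , cu , cv
    where
    c = coprime-% Q (sym e) cr
    cu = coprime-*ˡ {u} {v} c
    cv = coprime-*ʳ {u} {v} c
    χuv : χ u ⊗ χ v ≡ + 1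
    χuv = trans (sym (χ-* u v)) (trans (χ-% (u * v) r e) χr)
    agree : χ u ≡ + 1 ⊎ χ u ≡ -[1+ 0 ] → χ v ≡ + 1 ⊎ χ v ≡ -[1+ 0 ] → χ u ≡ χ v
    agree (inj₁ x) (inj₁ y) = trans x (sym y)
    agree (inj₂ x) (inj₂ y) = trans x (sym y)
    agree (inj₁ x) (inj₂ y) = case trans (sym (cong₂ _⊗_ x y)) χuv of λ ()
    agree (inj₂ x) (inj₁ y) = case trans (sym (cong₂ _⊗_ x y)) χuv of λ ()

  -- Where W(uv) is not zero, χ(u)χ(v) = 1. The resulting equality χ u = χ v is the symmetry between
  -- the two factors on which the hyperbola method rests; it is the reason for requiring χ(a) = 1.
  W-support : ∀ u v → W (u * v) ≡ + 0 ⊎ (χ u ≡ χ v × Coprime u Q × Coprime v Q)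
  W-support u v with u * v % Q ≟ a % Q | u * v % Q ≟ 1 % Q
  ... | no _ | no _ = inj₁ refl
  ... | yes e | _ = inj₂ (same-sign u v a χ-a a-coprime e)
  ... | no _ | yes e = inj₂ (same-sign u v 1 χ-1 1-coprime e)

  twisted-balance : ∀ u n → ℤ.∣ χ u ⊗ S n (λ v → W (u * v)) ∣ ≤ 1
  twisted-balance u n with coprime? u Q
  ... | yes c = subst (_≤ 1) (sym (trans (ℤ.abs-* (χ u) _) (trans (cong (_* ℤ.∣ S n (λ v → W (u * v)) ∣) (unit-abs u c))
      (+-identityʳ _)))) (balance {u} c a 1 n)
  ... | no nc = subst (λ x → ℤ.∣ x ∣ ≤ 1) (sym (trans (cong (_⊗_ (χ u)) (S-zero n λ v _ _ → off v)) (ℤ.*-zeroʳ (χ u))))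
      z≤n
    where
    off : ∀ v → W (u * v) ≡ + 0
    off v with W-support u v
    ... | inj₁ z = z
    ... | inj₂ (_ , c , _) = ⊥-elim (nc c)

  module _ (Z : ℕ) (1≤Z : 1 ≤ Z) where
    X : ℕ
    X = Z * Z

    Z≤X : Z ≤ X
    Z≤X = m≤m*n Z Z {{>-nonZero 1≤Z}}

    term : ℕ → ℕ → ℤ
    term u v = δ (u * v ≤? X) ⊗ (χ u ⊗ W (u * v))

    D : ℤ
    D = S X λ n → W n ⊗ f n

    D-double : D ≡ S X λ u → S X λ v → term u v
    D-double = begin
      S X (λ n → W n ⊗ f n)
        ≡⟨ S-cong X (λ n 1≤n n≤X → trans (cong (_⊗_ (W n)) (sym (f-extend 1≤n n≤X)))
            (sym (S-* X (W n) (λ u → δ (u ∣? n) ⊗ χ u)))) ⟩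
      S X (λ n → S X (λ u → W n ⊗ (δ (u ∣? n) ⊗ χ u)))
        ≡⟨ S-comm X X (λ n u → W n ⊗ (δ (u ∣? n) ⊗ χ u)) ⟩
      S X (λ u → S X (λ n → W n ⊗ (δ (u ∣? n) ⊗ χ u)))
        ≡⟨ S-cong X (λ u 1≤u _ → inner u 1≤u) ⟩
      S X (λ u → S X λ v → term u v) ∎
      where
      open ≡-Reasoning
      inner : ∀ u → 1 ≤ u → S X (λ n → W n ⊗ (δ (u ∣? n) ⊗ χ u)) ≡ S X (λ v → term u v)
      inner u 1≤u = trans (sym (S-truncate {X} {u * X} (_≤? X) g (m≤n*m X u {{>-nonZero 1≤u}}) (λ _ p → p) (λ _ p → p)))
        (trans (S-multiples u {{>-nonZero 1≤u}} X (λ n → δ (n ≤? X) ⊗ g n)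
            (λ n u∤n → trans (cong (_⊗_ (δ (n ≤? X))) (trans (cong (λ x → W n ⊗ (x ⊗ χ u)) (δ-no (u ∣? n) u∤n))
            (zero′ (W n) (χ u)))) (ℤ.*-zeroʳ (δ (n ≤? X)))))
          (S-cong X λ v _ _ → cong (_⊗_ (δ (u * v ≤? X))) (trans (cong (λ x → W (u * v) ⊗ (x ⊗ χ u))
              (δ-yes (u ∣? u * v) (m∣m*n v))) (one′ (W (u * v)) (χ u)))))
        where
        g : ℕ → ℤ
        g n = W n ⊗ (δ (u ∣? n) ⊗ χ u)
        zero′ : ∀ w x → w ⊗ (+ 0 ⊗ x) ≡ + 0
        zero′ = ring-ℤ
        one′ : ∀ w x → w ⊗ (+ 1 ⊗ x) ≡ x ⊗ w
        one′ = ring-ℤ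

    threshold : ∀ u → .{{_ : NonZero u}} → ∀ v → (v ≤ X / u → u * v ≤ X) × (u * v ≤ X → v ≤ X / u)
    threshold u v = (λ p → ≤-trans (*-monoʳ-≤ u p) (subst (_≤ X) (*-comm (X / u) u) (m/n*n≤m X u))) ,
      λ p → subst (_≤ X / u) (m*n/n≡m v u) (/-monoˡ-≤ u (subst (_≤ X) (*-comm u v) p))

    row : ∀ u → 1 ≤ u → ℤ.∣ S X (λ v → term u v) ∣ ≤ 1
    row u 1≤u = subst (λ x → ℤ.∣ x ∣ ≤ 1) (sym (trans (S-truncate {X / u} {X} (λ v → u * v ≤? X) (λ v → χ u ⊗ W (u * v))
        (m/n≤m X u) (λ v → proj₁ (threshold u v)) (λ v → proj₂ (threshold u v)))
        (S-* (X / u) (χ u) (λ v → W (u * v))))) (twisted-balance u (X / u))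
      where instance _ = >-nonZero 1≤u

    swap-term : ∀ u v → term u v ≡ δ (v * u ≤? X) ⊗ (χ v ⊗ W (v * u))
    swap-term u v = trans (cong (_⊗_ (δ (u * v ≤? X))) eq) (cong (_⊗ (χ v ⊗ W (v * u)))
        (δ-⇔ (u * v ≤? X) (v * u ≤? X) (subst (_≤ X) (*-comm u v)) (subst (_≤ X) (*-comm v u))))
      where
      eq : χ u ⊗ W (u * v) ≡ χ v ⊗ W (v * u)
      eq with W-support u v
      ... | inj₁ z = trans (cong (_⊗_ (χ u)) z) (trans (ℤ.*-zeroʳ (χ u))
          (sym (trans (cong (_⊗_ (χ v)) (trans (cong W (*-comm v u)) z)) (ℤ.*-zeroʳ (χ v)))))
      ... | inj₂ (e , _) = cong₂ _⊗_ e (cong W (*-comm u v))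

    -- After χ u is exchanged for χ v, the column is the row of v without its first Z terms. Those
    -- terms all satisfy the cut-off uv ≤ Z², so row and head are both balanced and each contributes
    -- at most 1.
    column : ∀ v → 1 ≤ v → v ≤ Z → ℤ.∣ S (X ∸ Z) (λ i → term (Z + i) v) ∣ ≤ 2
    column v 1≤v v≤Z = subst (λ x → ℤ.∣ x ∣ ≤ 2) (sym eq) (≤-trans (ℤ.∣i-j∣≤∣i∣+∣j∣ (S X t) (S Z t))
        (+-mono-≤ (row v 1≤v) head))
      where
      t : ℕ → ℤ
      t u = term v u
      vu≤X : ∀ u → u ≤ Z → v * u ≤ X
      vu≤X u = *-mono-≤ v≤Z
      head : ℤ.∣ S Z t ∣ ≤ 1
      head = subst (λ x → ℤ.∣ x ∣ ≤ 1) (sym (trans (S-cong Z λ u _ u≤Z → trans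
          (cong (_⊗ (χ v ⊗ W (v * u))) (δ-yes (v * u ≤? X) (vu≤X u u≤Z))) (ℤ.*-identityˡ (χ v ⊗ W (v * u))))
         (S-* Z (χ v) (λ u → W (v * u))))) (twisted-balance v Z)
      lem : ∀ x y → y ≡ x ⊕ y ⊖ x
      lem = ring-ℤ
      eq : S (X ∸ Z) (λ i → term (Z + i) v) ≡ S X t ⊖ S Z t
      eq = trans (S-cong (X ∸ Z) λ i _ _ → swap-term (Z + i) v) (trans (lem (S Z t) _)
          (cong (_⊖ S Z t) (trans (sym (S-split Z (X ∸ Z) t)) (cong (λ x → S x t) (m+[n∸m]≡n Z≤X)))))

    -- The Z rows with u ≤ Z contribute at most 1 each. If u > Z then v ≤ Z, and the Z columns
    -- contribute at most 2 each.
    D-bound : ℤ.∣ D ∣ ≤ 3 * Z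
    D-bound = begin
      ℤ.∣ D ∣ ≡⟨ cong ℤ.∣_∣ (trans D-double (trans (cong (λ x → S x r) (sym (m+[n∸m]≡n Z≤X))) (S-split Z (X ∸ Z) r))) ⟩
      ℤ.∣ S Z r ⊕ S (X ∸ Z) (λ i → r (Z + i)) ∣ ≤⟨ ℤ.∣i+j∣≤∣i∣+∣j∣ (S Z r) _ ⟩
      ℤ.∣ S Z r ∣ + ℤ.∣ S (X ∸ Z) (λ i → r (Z + i)) ∣ ≤⟨ +-mono-≤ (S-bound Z 1 r λ u l _ → row u l) tail ⟩
      Z * 1 + Z * 2 ≡⟨ lem Z ⟩
      3 * Z ∎
      where
      open ≤-Reasoning
      lem : ∀ z → z * 1 + z * 2 ≡ 3 * z
      lem = ring-ℕ
      r : ℕ → ℤ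
      r u = S X λ v → term u v
      c : ℕ → ℤ
      c v = S (X ∸ Z) λ i → term (Z + i) v
      vanish : ∀ v → Z < v → c v ≡ + 0
      vanish v Z<v = S-zero (X ∸ Z) λ i 1≤i _ → trans (cong (_⊗ (χ (Z + i) ⊗ W ((Z + i) * v))) (δ-no ((Z + i) * v ≤? X)
          λ p → <⇒≱ (<-≤-trans (*-monoʳ-< Z {{>-nonZero 1≤Z}} Z<v) (*-monoˡ-≤ v (m≤m+n Z i))) p))
              (ℤ.*-zeroˡ (χ (Z + i) ⊗ W ((Z + i) * v)))
      tail : ℤ.∣ S (X ∸ Z) (λ i → r (Z + i)) ∣ ≤ Z * 2
      tail = subst (λ x → ℤ.∣ x ∣ ≤ Z * 2) (sym (trans (S-comm (X ∸ Z) X (λ i v → term (Z + i) v))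
          (S-extend c Z≤X vanish)))
        (S-bound Z 2 c λ v l u → column v l u)

  admissible : ∀ n → Coprime n Q → Admissible n
  admissible n c p pr p∣n with χ-unit p cp
    where
    cp : Coprime p Q
    cp (d∣p , d∣Q) = c (∣-trans d∣p p∣n , d∣Q)
  ... | inj₁ e = inj₁ (e , χ-root p pr (λ (d∣p , d∣Q) → c (∣-trans d∣p p∣n , d∣Q)) e)
  ... | inj₂ e = inj₂ e

  f≥0 : ∀ n → 1 ≤ n → Coprime n Q → + 0 ℤ.≤ f n
  f≥0 n 1≤n c with dichotomy n 1≤n (admissible n c)
  ... | inj₁ e = ℤ.≤-reflexive (sym e)
  ... | inj₂ (p , _) = ℤ.≤-trans (ℤ.+≤+ z≤n) p

  -- A lower bound from the values x² + my²

  g : ℕ → ℤ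
  g n = hit 1 n ⊗ f n

  g≥0 : ∀ n → 1 ≤ n → + 0 ℤ.≤ g n
  g≥0 n 1≤n with n % Q ≟ 1 % Q
  ... | yes e = subst (λ x → + 0 ℤ.≤ x) (sym (ℤ.*-identityˡ (f n))) (f≥0 n 1≤n (coprime-% Q (sym e) 1-coprime))
  ... | no _ = ℤ.≤-reflexive (sym (ℤ.*-zeroˡ (f n)))

  coprime-^ʳ : ∀ {u} k → Coprime u Q → Coprime u (Q ^ k)
  coprime-^ʳ zero c (_ , d) = ∣1⇒≡1 d
  coprime-^ʳ {u} (suc k) c = cop-sym (coprime-* {Q} {Q ^ k} (cop-sym c) (cop-sym (coprime-^ʳ k c)))

  x : ℕ → ℕ
  x i = 1 + Q * i

  -- my² for y = Q^(j+1). The exponent is positive so that x² + my² stays in the class 1 (mod Q);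
  -- its divisors are then prime to Q, hence to y, and `χ-norm` applies to each of them.
  e : ℕ → ℕ
  e j = m * (Q ^ suc j * Q ^ suc j)

  g-special : ∀ i j → + 1 ℤ.≤ g (x i * x i + e j)
  g-special i j = subst (λ y → + 1 ℤ.≤ y) (sym (trans (cong (_⊗ f n) (δ-yes (n % Q ≟ 1 % Q) n≡1))
      (ℤ.*-identityˡ (f n))))
      (f-all n (s≤s z≤n) λ u u∣n → χ-norm u (x i) (Q ^ suc j) u∣n (cu u u∣n) (coprime-^ʳ (suc j) (cu u u∣n)))
    where
    n = x i * x i + e j
    lem : ∀ q i m r → (1 + q * i) * (1 + q * i) + m * (q * r * (q * r)) ≡ 1 + (2 * i + i * (q * i) + m * (r * (q * r)))
        * q
    lem = ring-ℕ
    n≡1 : n % Q ≡ 1 % Q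
    n≡1 = trans (cong (_% Q) (lem Q i m (Q ^ j))) ([m+kn]%n≡m%n 1 (2 * i + i * (Q * i) + m * (Q ^ j * (Q * Q ^ j))) Q)
    cu : ∀ u → u ∣ n → Coprime u Q
    cu u u∣n (d∣u , d∣Q) = coprime-% Q (sym n≡1) 1-coprime (∣-trans d∣u u∣n , d∣Q)

  -- Enough values e j for each i that they outnumber 3Z, and K so large that the numbers x i * x i + e j with j < Y and
  -- i ≥ K are pairwise distinct.
  Y-1 = 6 * Q + 3
  Y = suc Y-1
  K = e Y-1

  1≤Q^ : ∀ j → 1 ≤ Q ^ j
  1≤Q^ j = >-nonZero⁻¹ (Q ^ j) {{m^n≢0 Q j}}

  1≤e : ∀ j → 1 ≤ e j
  1≤e j = *-mono-≤ 1≤m (*-mono-≤ (1≤Q^ (suc j)) (1≤Q^ (suc j)))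

  e-increasing : ∀ j → e j < e (suc j)
  e-increasing j = *-monoʳ-< m {{>-nonZero 1≤m}} (*-mono-< lt′ lt′)
    where
    lt′ : Q ^ suc j < Q ^ suc (suc j)
    lt′ = subst (Q ^ suc j <_) (*-comm (Q ^ suc j) Q) (m<m*n (Q ^ suc j) Q {{m^n≢0 Q (suc j)}} 1<Q)

  -- For i ≥ K the gap between consecutive squares of the x i exceeds K, the largest offset in use;
  -- all Y special values belonging to i fall into that gap.
  block : ∀ i → K ≤ i → S (x i * x i) g ⊕ + Y ℤ.≤ S (x (suc i) * x (suc i)) g
  block i K≤i = ℤ.≤-trans (ℤ.+-monoʳ-≤ (S (x i * x i) g) (ℤ.≤-trans
      (S-increasing g′ e (λ t → g≥0 (x i * x i + t) (s≤s z≤n)) e-increasing (1≤e 0) (λ j → g-special i j) Y-1)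
      (subst (λ y → S K g′ ℤ.≤ S y g′) (m+[n∸m]≡n K≤L) (subst (S K g′ ℤ.≤_) (sym (S-split K (L ∸ K) g′))
        (ℤ.i≤i+j (S K g′) _ {{ℤ.nonNegative (S-nonneg (L ∸ K) λ t _ _ → g≥0 (x i * x i + (K + t)) (s≤s z≤n))}})))))
      (ℤ.≤-reflexive (trans (sym (S-split (x i * x i) L g)) (cong (λ y → S y g) (lem Q i))))
    where
    g′ : ℕ → ℤ
    g′ t = g (x i * x i + t)
    L = 2 * Q * (1 + Q * i) + Q * Q
    lem : ∀ q i → (1 + q * i) * (1 + q * i) + (2 * q * (1 + q * i) + q * q) ≡ (1 + q * suc i) * (1 + q * suc i)
    lem = ring-ℕ
    K≤L : K ≤ L
    K≤L = begin
      K ≤⟨ K≤i ⟩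
      i ≤⟨ m≤n*m i Q ⟩
      Q * i ≤⟨ n≤1+n (Q * i) ⟩
      1 + Q * i ≤⟨ m≤n*m (1 + Q * i) (2 * Q) {{m*n≢0 2 Q}} ⟩
      2 * Q * (1 + Q * i) ≤⟨ m≤m+n _ (Q * Q) ⟩
      L ∎
      where open ≤-Reasoning

  blocks : ∀ t → + (t * Y) ℤ.≤ S (x (K + t) * x (K + t)) g
  blocks zero = S-nonneg (x (K + 0) * x (K + 0)) λ i 1≤i _ → g≥0 i 1≤i
  blocks (suc t) = ℤ.≤-trans (ℤ.≤-reflexive (trans (cong +_ (+-comm Y (t * Y))) (ℤ.pos-+ (t * Y) Y)))
      (ℤ.≤-trans (ℤ.+-monoˡ-≤ (+ Y) (blocks t))
    (subst (λ j → S (x (K + t) * x (K + t)) g ⊕ + Y ℤ.≤ S (x j * x j) g) (sym (+-suc K t)) (block (K + t) (m≤m+n K t))))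

  -- A bounded search keeps this constructive. If it failed, f would vanish on the class of a up to
  -- Z², D would be minus the sum of g, and `D-bound` would contradict the lower bound.
  exists : ∃ λ n → n % Q ≡ a % Q × Good m n
  exists = case anyUpTo? (λ n → (n % Q ≟ a % Q) ×-dec (1 ≤? n) ×-dec ¬? (f n ℤ.≟ + 0)) (suc X′) of λ
    { (yes (n , _ , e , 1≤n , f≢0)) → n , e , (case dichotomy n 1≤n (admissible n (coprime-% Q (sym e) a-coprime)) of λ
        { (inj₁ f≡0) → ⊥-elim (f≢0 f≡0) ; (inj₂ (_ , gd)) → gd })
    ; (no none) → ⊥-elim (<⇒≱ too-big (subst (_≤ 3 * Z) (abs none) (D-bound Z (s≤s z≤n)))) }
    where
    -- The K blocks from K to 2K contribute K(6Q + 4) in all, and 3Z = 6QK + 3.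
    Z = x (K + K)
    X′ = Z * Z
    abs : ¬ (∃ λ n → n < suc X′ × n % Q ≡ a % Q × 1 ≤ n × ¬ (f n ≡ + 0)) → ℤ.∣ D Z (s≤s z≤n) ∣ ≡ ℤ.∣ S X′ g ∣
    abs none = trans (cong ℤ.∣_∣ (trans (S-cong X′ λ n l u → term′ n l u)
        (trans (S-* X′ -[1+ 0 ] g) (ℤ.-1*i≡-i (S X′ g))))) (ℤ.∣-i∣≡∣i∣ (S X′ g))
      where
      lem₁ : ∀ h y → (+ 0 ⊖ h) ⊗ y ≡ -[1+ 0 ] ⊗ (h ⊗ y)
      lem₁ = ring-ℤ
      term′ : ∀ n → 1 ≤ n → n ≤ X′ → W n ⊗ f n ≡ -[1+ 0 ] ⊗ g n
      term′ n l u with n % Q ≟ a % Q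
      ... | no _ = lem₁ (hit 1 n) (f n)
      ... | yes eq with f n ℤ.≟ + 0
      ... | no f≢0 = ⊥-elim (none (n , s≤s u , eq , l , f≢0))
      ... | yes f≡0 = trans (cong (_⊗_ (+ 1 ⊖ hit 1 n)) f≡0) (trans (ℤ.*-zeroʳ (+ 1 ⊖ hit 1 n))
          (sym (trans (cong (λ y → -[1+ 0 ] ⊗ (hit 1 n ⊗ y)) f≡0) (trans (cong (_⊗_ -[1+ 0 ]) (ℤ.*-zeroʳ (hit 1 n)))
          refl))))
    too-big : 3 * Z < ℤ.∣ S X′ g ∣
    too-big = begin-strict
      3 * Z ≡⟨ lem₂ Q K ⟩
      K * (6 * Q) + 3 <⟨ +-monoʳ-< (K * (6 * Q)) (*-mono-≤ (1≤e Y-1) (≤-refl {4})) ⟩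
      K * (6 * Q) + K * 4 ≡⟨ lem₃ Q K ⟩
      K * Y ≤⟨ abs-≤ (blocks K) ⟩
      ℤ.∣ S X′ g ∣ ∎
      where
      open ≤-Reasoning
      lem₂ : ∀ q k → 3 * (1 + q * (k + k)) ≡ k * (6 * q) + 3
      lem₂ = ring-ℕ
      lem₃ : ∀ q k → k * (6 * q) + k * 4 ≡ k * suc (6 * q + 3)
      lem₃ = ring-ℕ
      abs-≤ : ∀ {n z} → + n ℤ.≤ z → n ≤ ℤ.∣ z ∣
      abs-≤ (ℤ.+≤+ p) = p

-- The Kronecker symbol as a Dirichlet character modulo 8m

∣⇒≈0 : ∀ {n x} → n ∣ x → + x ≈ + 0 [ + n ]
∣⇒≈0 {n} {x} (divides q e) = via (+ q) (trans (cong +_ e) (trans (ℤ.pos-* q n) (sym (ℤ.+-identityˡ _))))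

odd-injective : ∀ {a b} → odd a ≡ odd b → a ≡ b
odd-injective {a} {b} e = *-cancelˡ-≡ a b 2 (suc-injective e)

module Character (β l : ℕ) where
  open Kronecker β l public

  Q : ℕ
  Q = 8 * m

  1≤m : 1 ≤ m
  1≤m = *-mono-≤ {1} {2 ^ β} {1} {odd l} (>-nonZero⁻¹ (2 ^ β) {{m^n≢0 2 β}}) (s≤s z≤n)

  1<Q : 1 < Q
  1<Q = ≤-trans (s≤s (s≤s z≤n)) (*-monoʳ-≤ 8 1≤m)

  m∣Q : m ∣ Q
  m∣Q = n∣m*n 8

  2∣Q : 2 ∣ Q
  2∣Q = ∣-trans (divides 4 refl) (m∣m*n m)

  hf : ℕ → ℕ
  hf u = proj₁ (evenOrOdd u)

  odd-hf : ∀ u → Coprime u Q → u ≡ odd (hf u)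
  odd-hf u c with evenOrOdd u
  ... | j , inj₂ e = trans e (cong (λ x → suc (j + x)) (sym (+-identityʳ j)))
  ... | j , inj₁ e = case c (divides j (trans e (trans (cong (λ x → j + x) (sym (+-identityʳ j))) (*-comm 2 j))) , 2∣Q)
      of λ ()

  hf-odd : ∀ u h → Coprime u Q → u ≡ odd h → hf u ≡ h
  hf-odd u h c e = odd-injective (trans (sym (odd-hf u c)) e)

  coprime-m : ∀ {u} → Coprime u Q → Coprime u m
  coprime-m c (d∣u , d∣m) = c (d∣u , ∣-trans d∣m m∣Q)

  coprime-l : ∀ {u} → Coprime u Q → Coprime u (odd l)
  coprime-l c (d∣u , d∣l) = coprime-m c (d∣u , ∣n⇒∣m*n (2 ^ β) d∣l)

  χ : ℕ → ℤ
  χ u with coprime? u Q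
  ... | yes _ = ⟦ κ (hf u) ⟧
  ... | no _ = + 0

  χ-coprime : ∀ u → Coprime u Q → χ u ≡ ⟦ κ (hf u) ⟧
  χ-coprime u c with coprime? u Q
  ... | yes _ = refl
  ... | no n = ⊥-elim (n c)

  χ-off : ∀ u → ¬ Coprime u Q → χ u ≡ + 0
  χ-off u n with coprime? u Q
  ... | yes c = ⊥-elim (n c)
  ... | no _ = refl

  1-coprime : Coprime 1 Q
  1-coprime (d , _) = ∣1⇒≡1 d

  κ-0 : κ 0 ≡ Sign.+
  κ-0 = trans (sym (Sign.*-identityʳ (κ 0))) (trans (cong (κ 0 Sign.*_) (sym (Sign.s*s≡+ (κ 0))))
    (trans (sym (Sign.*-assoc (κ 0) (κ 0) (κ 0))) (trans (cong (Sign._* κ 0)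
        (sym (κ-⊛ 0 0 (coprime-l 1-coprime) (coprime-l 1-coprime)))) (Sign.s*s≡+ (κ 0)))))

  χ-1 : χ 1 ≡ + 1
  χ-1 = trans (χ-coprime 1 1-coprime) (cong ⟦_⟧ κ-0)

  χ-* : ∀ u v → χ (u * v) ≡ χ u ⊗ χ v
  χ-* u v with coprime? u Q | coprime? v Q
  ... | no nu | yes _ = trans (χ-off (u * v) λ c → nu (coprime-*ˡ {u} {v} c)) (sym (ℤ.*-zeroˡ ⟦ κ (hf v) ⟧))
  ... | no nu | no _ = χ-off (u * v) λ c → nu (coprime-*ˡ {u} {v} c)
  ... | yes cu | no nv = trans (χ-off (u * v) λ c → nv (coprime-*ʳ {u} {v} c)) (sym (ℤ.*-zeroʳ ⟦ κ (hf u) ⟧))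
  ... | yes cu | yes cv = trans (χ-coprime (u * v) cuv) (trans
      (cong ⟦_⟧ (trans (cong κ (hf-odd (u * v) (hf u ⊛ hf v) cuv
        (trans (cong₂ _*_ (odd-hf u cu) (odd-hf v cv)) (sym (odd-⊛ (hf u) (hf v))))))
      (κ-⊛ (hf u) (hf v) (subst (λ x → Coprime x (odd l)) (odd-hf u cu) (coprime-l cu))
          (subst (λ x → Coprime x (odd l)) (odd-hf v cv) (coprime-l cv)))))
      (⟦⟧-* (κ (hf u)) (κ (hf v))))
    where
    cuv : Coprime (u * v) Q
    cuv = coprime-* {u} {v} cu cv

  module _ .{{_ : NonZero Q}} where
    shift-χ : ∀ u t → Coprime u Q → κ (hf (u + t * Q)) ≡ κ (hf u)
    shift-χ u t c = trans (cong κ (hf-odd (u + t * Q) (hf u + 4 * (t * m)) c′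
        (trans (cong (_+ t * Q) (odd-hf u c)) (lem (hf u) t m)))) (κ-+ (hf u) t)
      where
      lem : ∀ h t m → suc (2 * h) + t * (8 * m) ≡ suc (2 * (h + 4 * (t * m)))
      lem = ring-ℕ
      c′ : Coprime (u + t * Q) Q
      c′ = coprime-% Q (sym ([m+kn]%n≡m%n u t Q)) c

    κ-% : ∀ u → Coprime u Q → κ (hf u) ≡ κ (hf (u % Q))
    κ-% u c = trans (cong (λ x → κ (hf x)) (m≡m%n+[m/n]*n u Q))
        (shift-χ (u % Q) (u / Q) (coprime-% Q (sym (m%n%n≡m%n u Q)) c))

    χ-% : ∀ u v → u % Q ≡ v % Q → χ u ≡ χ v
    χ-% u v e with coprime? u Q | coprime? v Q
    ... | yes cu | yes cv = cong ⟦_⟧ (trans (κ-% u cu) (trans (cong (λ x → κ (hf x)) e) (sym (κ-% v cv))))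
    ... | no _ | no _ = refl
    ... | yes cu | no nv = ⊥-elim (nv (coprime-% Q e cu))
    ... | no nu | yes cv = ⊥-elim (nu (coprime-% Q (sym e) cv))

  χ-unit : ∀ u → Coprime u Q → χ u ≡ + 1 ⊎ χ u ≡ -[1+ 0 ]
  χ-unit u c = subst (λ x → x ≡ + 1 ⊎ x ≡ -[1+ 0 ]) (sym (χ-coprime u c)) (sgn± (κ (hf u)))
    where
    sgn± : ∀ s → ⟦ s ⟧ ≡ + 1 ⊎ ⟦ s ⟧ ≡ -[1+ 0 ]
    sgn± Sign.+ = inj₁ refl
    sgn± Sign.- = inj₂ refl

  χ-J : ∀ h → Coprime (odd h) Q → χ (odd h) ≡ ⟦ alt h Sign.* J m h ⟧
  χ-J h c = trans (χ-coprime (odd h) c) (cong ⟦_⟧ (trans (cong κ (hf-odd (odd h) h c refl))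
      (κ≡J h (cop-sym (coprime-l c)))))

  χ-J+ : ∀ h → Coprime (odd h) Q → alt h Sign.* J m h ≡ Sign.+ → χ (odd h) ≡ + 1
  χ-J+ h c e = trans (χ-J h c) (cong ⟦_⟧ e)

  -- Modulo u one has -x² ≡ my². Squares of units drop out of the Jacobi symbol, which leaves (m /
  -- u) = (-1 / u).
  χ-norm : ∀ u x y → u ∣ x * x + m * (y * y) → Coprime u Q → Coprime u y → χ u ≡ + 1
  χ-norm u x y d cu cy = subst (λ v → χ v ≡ + 1) (sym (odd-hf u cu))
      (χ-J+ h c (trans (cong (alt h Sign.*_) eq) (Sign.s*s≡+ (alt h))))
    where
    h = hf u
    n = odd h
    c : Coprime n Q
    c = subst (λ v → Coprime v Q) (odd-hf u cu) cu
    cm : Coprime m n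
    cm = cop-sym (coprime-m c)
    y-n : Coprime y n
    y-n = cop-sym (subst (λ v → Coprime v y) (odd-hf u cu) cy)
    d′ : n ∣ x * x + m * (y * y)
    d′ = subst (_∣ x * x + m * (y * y)) (odd-hf u cu) d
    x-n : Coprime x n
    x-n {k} (k∣x , k∣n) = coprime-* {m} {y * y} cm (coprime-* {y} {y} y-n y-n)
        (∣m+n∣m⇒∣n (∣-trans k∣n d′) (∣m⇒∣m*n x k∣x) , k∣n)
    lem : ∀ h x t → 2 * h * (x * x) + (x * x + t) ≡ t + x * x * suc (2 * h)
    lem = ring-ℕ
    cong-n : (2 * h * (x * x)) % n ≡ (m * (y * y)) % n
    cong-n = trans (sym (trans (cong (λ z → (2 * h * (x * x) + z) % n) (_∣_.equality d′))
        ([m+kn]%n≡m%n (2 * h * (x * x)) (_∣_.quotient d′) n)))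
      (trans (cong (_% n) (lem h x (m * (y * y)))) ([m+kn]%n≡m%n (m * (y * y)) (x * x) n))
    eq : J m h ≡ alt h
    eq = begin
      J m h ≡⟨ sym (Sign.*-identityʳ (J m h)) ⟩
      J m h Sign.* Sign.+ ≡⟨ cong (J m h Sign.*_) (sym (J-square y h y-n)) ⟩
      J m h Sign.* J (y * y) h ≡⟨ sym (J-* m (y * y) h cm (coprime-* {y} {y} y-n y-n)) ⟩
      J (m * (y * y)) h ≡⟨ sym (J-mod (2 * h * (x * x)) (m * (y * y)) h cong-n) ⟩
      J (2 * h * (x * x)) h ≡⟨ J-* (2 * h) (x * x) h (coprime-2h h) (coprime-* {x} {x} x-n x-n) ⟩
      J (2 * h) h Sign.* J (x * x) h ≡⟨ cong₂ Sign._*_ (J-neg h) (J-square x h x-n) ⟩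
      alt h Sign.* Sign.+ ≡⟨ Sign.*-identityʳ (alt h) ⟩
      alt h ∎
      where open ≡-Reasoning

  χ-root : ∀ p → Prime p → Coprime p Q → χ p ≡ + 1 → Root m p
  -- The residue -m is represented by the natural number 2hm, since 2h ≡ -1 modulo `odd h`.
  χ-root p pr c e = subst (Root m) (sym p≡) (go (J-root {h} (subst Prime p≡ pr) (2 * h * m)
      (coprime-* {2 * h} {m} (coprime-2h h) cm) J+))
    where
    h = hf p
    p≡ : p ≡ odd h
    p≡ = odd-hf p c
    c′ : Coprime (odd h) Q
    c′ = subst (λ v → Coprime v Q) p≡ c
    cm : Coprime m (odd h)
    cm = cop-sym (coprime-m c′)
    ⟦⟧-inj : ∀ s → ⟦ s ⟧ ≡ + 1 → s ≡ Sign.+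
    ⟦⟧-inj Sign.+ _ = refl
    J+ : J (2 * h * m) h ≡ Sign.+
    J+ = trans (J-* (2 * h) m h (coprime-2h h) cm) (trans (cong (Sign._* J m h) (J-neg h))
        (⟦⟧-inj _ (trans (sym (χ-J h c′)) (subst (λ v → χ v ≡ + 1) p≡ e))))
    go : (∃ λ b → + (2 * h * m) ≈ + (b * b) [ + odd h ]) → Root m (odd h)
    go (b , eq) = + b , ≈-trans (≈-+ʳ (+ m) (≈-trans (≈-reflexive (sym (ℤ.pos-* b b))) (≈-sym eq)))
      (∣⇒≈0 (divides m (lem h m)))
      where lem : ∀ h m → 2 * h * m + m ≡ m * suc (2 * h)
            lem = ring-ℕ

  -- This takes the place of Dirichlet's theorem on primes in arithmetic progressions.
  genus-existence : ∀ h → Coprime (odd h) Q → alt h Sign.* J m h ≡ Sign.+ →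
    ∃ λ n → + n ≈ + odd h [ + Q ] × Good m n
  genus-existence h c e = let n , eq , g = exists in n , %⇒≈ Q {{nzQ}} n (odd h) eq , g
    where open Hyperbola Q m 1<Q 1≤m χ χ-1 χ-* (λ {{nz}} → χ-% {{nz}}) χ-unit χ-root χ-norm (odd h) c (χ-J+ h c e)

-- Ternary forms of small determinant

module TernaryForms where

  -- the form ax² + by² + cz² + 2dyz + 2exz + 2fxy
  record Form : Set where
    no-eta-equality
    pattern
    constructor form
    field a b c d e f : ℤ

    val : ℤ → ℤ → ℤ → ℤ
    val x y z = a ⊗ (x ⊗ x) ⊕ b ⊗ (y ⊗ y) ⊕ c ⊗ (z ⊗ z) ⊕ + 2 ⊗ (d ⊗ (y ⊗ z) ⊕ e ⊗ (x ⊗ z) ⊕ f ⊗ (x ⊗ y))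

    -- a·val = (ax + fy + ez)² + Ay² + 2Byz + Cz²
    A B C det : ℤ
    A = a ⊗ b ⊖ f ⊗ f
    B = a ⊗ d ⊖ e ⊗ f
    C = a ⊗ c ⊖ e ⊗ e
    det = a ⊗ b ⊗ c ⊕ + 2 ⊗ (d ⊗ e ⊗ f) ⊖ a ⊗ (d ⊗ d) ⊖ b ⊗ (e ⊗ e) ⊖ c ⊗ (f ⊗ f)

  open Form

  -- Jacobi's identity for complementary minors of the Gram matrix: the binary form (A, B, C) left
  -- after completing the square in x has determinant a·det.
  det-identity : ∀ F → A F ⊗ C F ≡ a F ⊗ det F ⊕ B F ⊗ B F
  det-identity (form a b c d e f) = lem a b c d e f
    where lem : ∀ a b c d e f → (a ⊗ b ⊖ f ⊗ f) ⊗ (a ⊗ c ⊖ e ⊗ e) ≡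
            a ⊗ (a ⊗ b ⊗ c ⊕ + 2 ⊗ (d ⊗ e ⊗ f) ⊖ a ⊗ (d ⊗ d) ⊖ b ⊗ (e ⊗ e) ⊖ c ⊗ (f ⊗ f)) ⊕ (a ⊗ d ⊖ e ⊗ f) ⊗
                (a ⊗ d ⊖ e ⊗ f)
          lem = ring-ℤ

  infix 4 _⊑_ _~_
  -- Inclusion of the sets of values. Equivalence of forms enters the argument as equality of these
  -- sets.
  _⊑_ : Form → Form → Set
  F ⊑ G = ∀ x y z → ∃ λ x′ → ∃ λ y′ → ∃ λ z′ → val F x y z ≡ val G x′ y′ z′

  _~_ : Form → Form → Set
  F ~ G = F ⊑ G × G ⊑ F

  ⊑-trans : ∀ {F G H} → F ⊑ G → G ⊑ H → F ⊑ H
  ⊑-trans p q x y z = let x₁ , y₁ , z₁ , e₁ = p x y z ; x₂ , y₂ , z₂ , e₂ = q x₁ y₁ z₁ in x₂ , y₂ , z₂ , trans e₁ e₂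

  ~-trans : ∀ {F G H} → F ~ G → G ~ H → F ~ H
  ~-trans {F} {G} {H} (p , p′) (q , q′) = ⊑-trans {F} {G} {H} p q , ⊑-trans {H} {G} {F} q′ p′

  add-back : ∀ x y → x ⊖ y ⊕ y ≡ x
  add-back = ring-ℤ

  module _ (k : ℤ) where
    shear-yz : Form → Form
    shear-yz (form a b c d e f) = form a b (c ⊕ + 2 ⊗ (k ⊗ d) ⊕ k ⊗ k ⊗ b) (d ⊕ k ⊗ b) (e ⊕ k ⊗ f) f

    shear-yz-val : ∀ F x y z → val (shear-yz F) x y z ≡ val F x (y ⊕ k ⊗ z) z
    shear-yz-val (form a b c d e f) x y z = lem a b c d e f k x y z
      where lem : ∀ a b c d e f k x y z → a ⊗ (x ⊗ x) ⊕ b ⊗ (y ⊗ y) ⊕ (c ⊕ + 2 ⊗ (k ⊗ d) ⊕ k ⊗ k ⊗ b) ⊗ (z ⊗ z) ⊕ + 2 ⊗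
                ((d ⊕ k ⊗ b) ⊗ (y ⊗ z) ⊕ (e ⊕ k ⊗ f) ⊗ (x ⊗ z) ⊕ f ⊗ (x ⊗ y))
               ≡ a ⊗ (x ⊗ x) ⊕ b ⊗ ((y ⊕ k ⊗ z) ⊗ (y ⊕ k ⊗ z)) ⊕ c ⊗ (z ⊗ z) ⊕ + 2 ⊗
                   (d ⊗ ((y ⊕ k ⊗ z) ⊗ z) ⊕ e ⊗ (x ⊗ z) ⊕ f ⊗ (x ⊗ (y ⊕ k ⊗ z)))
            lem = ring-ℤ

    shear-yz-~ : ∀ F → F ~ shear-yz F
    shear-yz-~ F = (λ x y z → x , y ⊖ k ⊗ z , z , sym (trans (shear-yz-val F x (y ⊖ k ⊗ z) z)
        (cong (λ t → val F x t z) (add-back y (k ⊗ z))))) ,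
      λ x y z → x , y ⊕ k ⊗ z , z , shear-yz-val F x y z

    shear-yz-a : ∀ F → a (shear-yz F) ≡ a F
    shear-yz-a (form a b c d e f) = refl

    shear-yz-A : ∀ F → A (shear-yz F) ≡ A F
    shear-yz-A (form a b c d e f) = refl

    shear-yz-B : ∀ F → B (shear-yz F) ≡ B F ⊕ k ⊗ A F
    shear-yz-B (form a b c d e f) = lem a b d e f k
      where lem : ∀ a b d e f k → a ⊗ (d ⊕ k ⊗ b) ⊖ (e ⊕ k ⊗ f) ⊗ f ≡ a ⊗ d ⊖ e ⊗ f ⊕ k ⊗ (a ⊗ b ⊖ f ⊗ f)
            lem = ring-ℤ

    shear-yz-det : ∀ F → det (shear-yz F) ≡ det F
    shear-yz-det (form a b c d e f) = lem a b c d e f k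
      where lem : ∀ a b c d e f k → a ⊗ b ⊗ (c ⊕ + 2 ⊗ (k ⊗ d) ⊕ k ⊗ k ⊗ b) ⊕ + 2 ⊗ ((d ⊕ k ⊗ b) ⊗ (e ⊕ k ⊗ f) ⊗ f) ⊖ a
                ⊗ ((d ⊕ k ⊗ b) ⊗ (d ⊕ k ⊗ b)) ⊖ b ⊗ ((e ⊕ k ⊗ f) ⊗ (e ⊕ k ⊗ f)) ⊖ (c ⊕ + 2 ⊗ (k ⊗ d) ⊕ k ⊗ k ⊗ b) ⊗
                (f ⊗ f)
               ≡ a ⊗ b ⊗ c ⊕ + 2 ⊗ (d ⊗ e ⊗ f) ⊖ a ⊗ (d ⊗ d) ⊖ b ⊗ (e ⊗ e) ⊖ c ⊗ (f ⊗ f)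
            lem = ring-ℤ

    shear-xy : Form → Form
    shear-xy (form a b c d e f) = form a (b ⊕ + 2 ⊗ (k ⊗ f) ⊕ k ⊗ k ⊗ a) c (d ⊕ k ⊗ e) e (f ⊕ k ⊗ a)

    shear-xy-val : ∀ F x y z → val (shear-xy F) x y z ≡ val F (x ⊕ k ⊗ y) y z
    shear-xy-val (form a b c d e f) x y z = lem a b c d e f k x y z
      where lem : ∀ a b c d e f k x y z → a ⊗ (x ⊗ x) ⊕ (b ⊕ + 2 ⊗ (k ⊗ f) ⊕ k ⊗ k ⊗ a) ⊗ (y ⊗ y) ⊕ c ⊗ (z ⊗ z) ⊕ + 2 ⊗
                ((d ⊕ k ⊗ e) ⊗ (y ⊗ z) ⊕ e ⊗ (x ⊗ z) ⊕ (f ⊕ k ⊗ a) ⊗ (x ⊗ y))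
               ≡ a ⊗ ((x ⊕ k ⊗ y) ⊗ (x ⊕ k ⊗ y)) ⊕ b ⊗ (y ⊗ y) ⊕ c ⊗ (z ⊗ z) ⊕ + 2 ⊗
                   (d ⊗ (y ⊗ z) ⊕ e ⊗ ((x ⊕ k ⊗ y) ⊗ z) ⊕ f ⊗ ((x ⊕ k ⊗ y) ⊗ y))
            lem = ring-ℤ

    shear-xy-~ : ∀ F → F ~ shear-xy F
    shear-xy-~ F = (λ x y z → x ⊖ k ⊗ y , y , z , sym (trans (shear-xy-val F (x ⊖ k ⊗ y) y z)
        (cong (λ t → val F t y z) (add-back x (k ⊗ y))))) ,
      λ x y z → x ⊕ k ⊗ y , y , z , shear-xy-val F x y z

    shear-xy-a : ∀ F → a (shear-xy F) ≡ a F
    shear-xy-a (form a b c d e f) = refl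

    shear-xy-f : ∀ F → f (shear-xy F) ≡ f F ⊕ k ⊗ a F
    shear-xy-f (form a b c d e f) = refl

    shear-xy-A : ∀ F → A (shear-xy F) ≡ A F
    shear-xy-A (form a b c d e f) = lem a b f k
      where lem : ∀ a b f k → a ⊗ (b ⊕ + 2 ⊗ (k ⊗ f) ⊕ k ⊗ k ⊗ a) ⊖ (f ⊕ k ⊗ a) ⊗ (f ⊕ k ⊗ a) ≡ a ⊗ b ⊖ f ⊗ f
            lem = ring-ℤ

    shear-xy-det : ∀ F → det (shear-xy F) ≡ det F
    shear-xy-det (form a b c d e f) = lem a b c d e f k
      where lem : ∀ a b c d e f k → a ⊗ (b ⊕ + 2 ⊗ (k ⊗ f) ⊕ k ⊗ k ⊗ a) ⊗ c ⊕ + 2 ⊗ ((d ⊕ k ⊗ e) ⊗ e ⊗ (f ⊕ k ⊗ a)) ⊖ a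
                ⊗ ((d ⊕ k ⊗ e) ⊗ (d ⊕ k ⊗ e)) ⊖ (b ⊕ + 2 ⊗ (k ⊗ f) ⊕ k ⊗ k ⊗ a) ⊗ (e ⊗ e) ⊖ c ⊗
                ((f ⊕ k ⊗ a) ⊗ (f ⊕ k ⊗ a))
               ≡ a ⊗ b ⊗ c ⊕ + 2 ⊗ (d ⊗ e ⊗ f) ⊖ a ⊗ (d ⊗ d) ⊖ b ⊗ (e ⊗ e) ⊖ c ⊗ (f ⊗ f)
            lem = ring-ℤ

  swap-yz : Form → Form
  swap-yz (form a b c d e f) = form a c b d f e

  swap-yz-a : ∀ F → a (swap-yz F) ≡ a F
  swap-yz-a (form a b c d e f) = refl

  swap-yz-A : ∀ F → A (swap-yz F) ≡ C F
  swap-yz-A (form a b c d e f) = refl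

  swap-yz-~ : ∀ F → F ~ swap-yz F
  swap-yz-~ (form a b c d e f) = (λ x y z → x , z , y , lem a b c d e f x y z) , λ x y z → x , z , y , lem a c b d f e x
      y z
    where lem : ∀ a b c d e f x y z → a ⊗ (x ⊗ x) ⊕ b ⊗ (y ⊗ y) ⊕ c ⊗ (z ⊗ z) ⊕ + 2 ⊗
              (d ⊗ (y ⊗ z) ⊕ e ⊗ (x ⊗ z) ⊕ f ⊗ (x ⊗ y))
             ≡ a ⊗ (x ⊗ x) ⊕ c ⊗ (z ⊗ z) ⊕ b ⊗ (y ⊗ y) ⊕ + 2 ⊗ (d ⊗ (z ⊗ y) ⊕ f ⊗ (x ⊗ y) ⊕ e ⊗ (x ⊗ z))
          lem = ring-ℤ

  swap-yz-det : ∀ F → det (swap-yz F) ≡ det F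
  swap-yz-det (form a b c d e f) = lem a b c d e f
    where lem : ∀ a b c d e f → a ⊗ c ⊗ b ⊕ + 2 ⊗ (d ⊗ f ⊗ e) ⊖ a ⊗ (d ⊗ d) ⊖ c ⊗ (f ⊗ f) ⊖ b ⊗ (e ⊗ e)
             ≡ a ⊗ b ⊗ c ⊕ + 2 ⊗ (d ⊗ e ⊗ f) ⊖ a ⊗ (d ⊗ d) ⊖ b ⊗ (e ⊗ e) ⊖ c ⊗ (f ⊗ f)
          lem = ring-ℤ

  swap-xy : Form → Form
  swap-xy (form a b c d e f) = form b a c e d f

  swap-xy-a : ∀ F → a (swap-xy F) ≡ b F
  swap-xy-a (form a b c d e f) = refl

  swap-xy-~ : ∀ F → F ~ swap-xy F
  swap-xy-~ (form a b c d e f) = (λ x y z → y , x , z , lem a b c d e f x y z) , λ x y z → y , x , z , lem b a c e d f x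
      y z
    where lem : ∀ a b c d e f x y z → a ⊗ (x ⊗ x) ⊕ b ⊗ (y ⊗ y) ⊕ c ⊗ (z ⊗ z) ⊕ + 2 ⊗
              (d ⊗ (y ⊗ z) ⊕ e ⊗ (x ⊗ z) ⊕ f ⊗ (x ⊗ y))
             ≡ b ⊗ (y ⊗ y) ⊕ a ⊗ (x ⊗ x) ⊕ c ⊗ (z ⊗ z) ⊕ + 2 ⊗ (e ⊗ (x ⊗ z) ⊕ d ⊗ (y ⊗ z) ⊕ f ⊗ (y ⊗ x))
          lem = ring-ℤ

  swap-xy-det : ∀ F → det (swap-xy F) ≡ det F
  swap-xy-det (form a b c d e f) = lem a b c d e f
    where lem : ∀ a b c d e f → b ⊗ a ⊗ c ⊕ + 2 ⊗ (e ⊗ d ⊗ f) ⊖ b ⊗ (e ⊗ e) ⊖ a ⊗ (d ⊗ d) ⊖ c ⊗ (f ⊗ f)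
             ≡ a ⊗ b ⊗ c ⊕ + 2 ⊗ (d ⊗ e ⊗ f) ⊖ a ⊗ (d ⊗ d) ⊖ b ⊗ (e ⊗ e) ⊖ c ⊗ (f ⊗ f)
          lem = ring-ℤ

  swap-xy-A : ∀ F → A (swap-xy F) ≡ A F
  swap-xy-A (form a b c d e f) = cong (_⊖ f ⊗ f) (ℤ.*-comm b a)

  -- Lagrange and Hermite reduction

  square-abs : ∀ x → x ⊗ x ≡ + (ℤ.∣ x ∣ * ℤ.∣ x ∣)
  square-abs (+ n) = sym (ℤ.pos-* n n)
  square-abs -[1+ n ] = refl

  balanced : ∀ n .{{_ : NonZero n}} x → ∃ λ k → ℤ.∣ x ⊕ k ⊗ + n ∣ + ℤ.∣ x ⊕ k ⊗ + n ∣ ≤ n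
  balanced n x with x ℤ.%ℕ n + x ℤ.%ℕ n ≤? n
  ... | yes le = ⊝ q , subst (λ y → ℤ.∣ y ∣ + ℤ.∣ y ∣ ≤ n) (sym
      (trans (cong (_⊕ (⊝ q) ⊗ + n) (ℤ.a≡a%ℕn+[a/ℕn]*n x n)) (lem (+ r) q (+ n)))) le
    where
    q = x ℤ./ℕ n
    r = x ℤ.%ℕ n
    lem : ∀ r q n → r ⊕ q ⊗ n ⊕ (⊝ q) ⊗ n ≡ r
    lem = ring-ℤ
  ... | no gt = ⊝ (q ⊕ + 1) , subst (λ y → y + y ≤ n) (sym (trans
      (cong ℤ.∣_∣ (trans (cong (_⊕ (⊝ (q ⊕ + 1)) ⊗ + n) (ℤ.a≡a%ℕn+[a/ℕn]*n x n)) (lem (+ r) q (+ n)))) abs)) small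
    where
    q = x ℤ./ℕ n
    r = x ℤ.%ℕ n
    lem : ∀ r q n → r ⊕ q ⊗ n ⊕ (⊝ (q ⊕ + 1)) ⊗ n ≡ r ⊖ n
    lem = ring-ℤ
    r≤n : r ≤ n
    r≤n = <⇒≤ (ℤ.n%ℕd<d x n)
    abs : ℤ.∣ + r ⊖ + n ∣ ≡ n ∸ r
    abs = trans (ℤ.∣i-j∣≡∣j-i∣ (+ r) (+ n)) (cong ℤ.∣_∣ (trans (ℤ.m-n≡m⊖n n r) (ℤ.⊖-≥ r≤n)))
    small : n ∸ r + (n ∸ r) ≤ n
    small = +-cancelʳ-≤ (r + r) _ _ (begin
      n ∸ r + (n ∸ r) + (r + r) ≡⟨ lem′ (n ∸ r) r ⟩
      (n ∸ r + r) + (n ∸ r + r) ≡⟨ cong₂ _+_ (m∸n+n≡m r≤n) (m∸n+n≡m r≤n) ⟩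
      n + n ≤⟨ +-monoʳ-≤ n (<⇒≤ (≰⇒> gt)) ⟩
      n + (r + r) ∎)
      where open ≤-Reasoning
            lem′ : ∀ a r → a + a + (r + r) ≡ (a + r) + (a + r)
            lem′ = ring-ℕ

  pos-factor : ∀ α x n → 1 ≤ n → + α ⊗ x ≡ + n → ∃ λ k → x ≡ + k × 1 ≤ k × α * k ≡ n
  pos-factor α (+ zero) n 1≤n e = ⊥-elim (<-irrefl (ℤ.+-injective (trans (sym (ℤ.*-zeroʳ (+ α))) e)) 1≤n)
  pos-factor α (+ suc k) n 1≤n e = suc k , refl , s≤s z≤n , ℤ.+-injective (trans (ℤ.pos-* α (suc k)) e)
  pos-factor zero -[1+ k ] n 1≤n e = ⊥-elim (<-irrefl (ℤ.+-injective e) 1≤n)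
  pos-factor (suc α) -[1+ k ] n 1≤n ()

  -- Sylvester's criterion: the leading minors are α, 𝒜 and the prescribed D.
  record Positive (D : ℕ) (F : Form) : Set where
    constructor positive
    field
      α 𝒜 : ℕ
      1≤α : 1 ≤ α
      1≤𝒜 : 1 ≤ 𝒜
      a≡ : a F ≡ + α
      A≡ : A F ≡ + 𝒜
      det≡ : det F ≡ + D

  -- The binary form (A, B, C) is reduced in the sense of Lagrange; its determinant is αD.
  record Reduced (D : ℕ) (F : Form) : Set where
    constructor reduced
    field
      pos : Positive D F
      𝒞 : ℕ
    open Positive pos public
    field
      C≡ : C F ≡ + 𝒞
      B-small : ℤ.∣ B F ∣ + ℤ.∣ B F ∣ ≤ 𝒜
      A≤C : 𝒜 ≤ 𝒞
      disc : 𝒜 * 𝒞 ≡ α * D + ℤ.∣ B F ∣ * ℤ.∣ B F ∣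

  disc-ℕ : ∀ {D F} (p : Positive D F) → + Positive.𝒜 p ⊗ C F ≡ + (Positive.α p * D + ℤ.∣ B F ∣ * ℤ.∣ B F ∣)
  disc-ℕ {D} {F} (positive α 𝒜 _ _ a≡ A≡ det≡) = trans (cong (_⊗ C F) (sym A≡)) (trans (det-identity F)
    (trans (cong₂ _⊕_ (trans (cong₂ _⊗_ a≡ det≡) (sym (ℤ.pos-* α D))) (square-abs (B F))) (sym (ℤ.pos-+ (α * D) _))))

  square-val : ∀ b c d e f x y z → val (form (+ 1) b c d e f) x y z ≡
    val (form (+ 1) (A (form (+ 1) b c d e f)) (C (form (+ 1) b c d e f)) (B (form (+ 1) b c d e f)) (+ 0) (+ 0))
        (x ⊕ f ⊗ y ⊕ e ⊗ z) y z
  square-val = l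
    where
    l : ∀ b c d e f x y z → + 1 ⊗ (x ⊗ x) ⊕ b ⊗ (y ⊗ y) ⊕ c ⊗ (z ⊗ z) ⊕ + 2 ⊗ (d ⊗ (y ⊗ z) ⊕ e ⊗ (x ⊗ z) ⊕ f ⊗ (x ⊗ y))
      ≡ + 1 ⊗ ((x ⊕ f ⊗ y ⊕ e ⊗ z) ⊗ (x ⊕ f ⊗ y ⊕ e ⊗ z)) ⊕ (+ 1 ⊗ b ⊖ f ⊗ f) ⊗ (y ⊗ y) ⊕ (+ 1 ⊗ c ⊖ e ⊗ e) ⊗ (z ⊗ z)
        ⊕ + 2 ⊗ ((+ 1 ⊗ d ⊖ e ⊗ f) ⊗ (y ⊗ z) ⊕ + 0 ⊗ ((x ⊕ f ⊗ y ⊕ e ⊗ z) ⊗ z) ⊕ + 0 ⊗ ((x ⊕ f ⊗ y ⊕ e ⊗ z) ⊗ y))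
    l = ring-ℤ

  complete-square : ∀ {p q} G → a G ≡ + 1 → A G ≡ p → C G ≡ q → G ~ form (+ 1) p q (B G) (+ 0) (+ 0)
  complete-square G@(form .(+ 1) b c d e f) refl refl refl =
    (λ x y z → x ⊕ f ⊗ y ⊕ e ⊗ z , y , z , square-val b c d e f x y z) ,
    (λ x y z → x ⊖ f ⊗ y ⊖ e ⊗ z , y , z , sym (trans (square-val b c d e f (x ⊖ f ⊗ y ⊖ e ⊗ z) y z)
       (cong (λ t → val (form (+ 1) (A G) (C G) (B G) (+ 0) (+ 0)) t y z) (back x (f ⊗ y) (e ⊗ z)))))
    where
    back : ∀ x u v → x ⊖ u ⊖ v ⊕ u ⊕ v ≡ x
    back = ring-ℤ

  module _ {D : ℕ} (1≤D : 1 ≤ D) where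

    ReducedStep : ℕ → Form → Set
    ReducedStep α F = ∃ λ G → F ~ G × Σ (Reduced D G) λ r → Reduced.α r ≡ α

    -- Shearing in y and z reduces B modulo A. If then C < A, exchanging y and z lowers A, on which
    -- the induction runs. The leading coefficient stays fixed throughout.
    lagrange-reduce : ∀ n F (p : Positive D F) → Positive.𝒜 p ≡ n → ReducedStep (Positive.α p) F
    lagrange-reduce = <-rec _ step
      where
      step : ∀ n → (∀ {n′} → n′ < n → ∀ F (p : Positive D F) → Positive.𝒜 p ≡ n′ → ReducedStep (Positive.α p) F) →
        ∀ F (p : Positive D F) → Positive.𝒜 p ≡ n → ReducedStep (Positive.α p) F
      step n rec F p@(positive α 𝒜 1≤α 1≤𝒜 a≡ A≡ det≡) refl = go (balanced 𝒜 {{>-nonZero 1≤𝒜}} (B F))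
        where
        go : (∃ λ k → ℤ.∣ B F ⊕ k ⊗ + 𝒜 ∣ + ℤ.∣ B F ⊕ k ⊗ + 𝒜 ∣ ≤ 𝒜) → ReducedStep α F
        go (k , le) = decide (pos-factor 𝒜 (C G) _ (≤-trans (*-mono-≤ 1≤α 1≤D) (m≤m+n (α * D) _)) (disc-ℕ pG))
          where
          G = shear-yz k F
          F~G : F ~ G
          F~G = shear-yz-~ k F
          pG : Positive D G
          pG = positive α 𝒜 1≤α 1≤𝒜 (trans (shear-yz-a k F) a≡) (trans (shear-yz-A k F) A≡)
              (trans (shear-yz-det k F) det≡)
          small : ℤ.∣ B G ∣ + ℤ.∣ B G ∣ ≤ 𝒜
          small = subst (λ x → ℤ.∣ x ∣ + ℤ.∣ x ∣ ≤ 𝒜) (sym (trans (shear-yz-B k F) (cong (λ x → B F ⊕ k ⊗ x) A≡))) le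
          decide : (∃ λ 𝒞 → C G ≡ + 𝒞 × 1 ≤ 𝒞 × 𝒜 * 𝒞 ≡ α * D + ℤ.∣ B G ∣ * ℤ.∣ B G ∣) → ReducedStep α F
          decide (𝒞 , C≡ , 1≤𝒞 , disc) with 𝒜 ≤? 𝒞
          ... | yes 𝒜≤𝒞 = G , F~G , reduced pG 𝒞 C≡ small 𝒜≤𝒞 disc , refl
          ... | no 𝒜≰𝒞 with rec (≰⇒> 𝒜≰𝒞) (swap-yz G) (positive α 𝒞 1≤α 1≤𝒞
              (trans (swap-yz-a G) (trans (shear-yz-a k F) a≡)) (trans (swap-yz-A G) C≡)
              (trans (swap-yz-det G) (trans (shear-yz-det k F) det≡))) refl
          ... | H , G~H , r , α≡ = H , ~-trans {F} {G} {H} F~G (~-trans {G} {swap-yz G} {H} (swap-yz-~ G) G~H) , r , α≡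

    -- Hermite's bound. The hypotheses give 3α² ≤ 4𝒜 and, as D ≤ 3, 𝒜² ≤ 4α. For α ≥ 2 the former
    -- yields 3α ≤ 2𝒜, hence 𝒜 ≥ 3; multiplied by 𝒜 and combined with the latter it yields 3𝒜 ≤ 8.
    α≡1 : D ≤ 3 → ∀ {α β 𝒜 𝒞 b φ} → 1 ≤ α → α ≤ β → α * β ≡ 𝒜 + φ * φ → φ + φ ≤ α → 𝒜 ≤ 𝒞 → b + b ≤ 𝒜 → 𝒜 * 𝒞 ≡ α * D +
        b * b → α ≡ 1
    α≡1 D≤3 {α} {β} {𝒜} {𝒞} {b} {φ} 1≤α α≤β ab φ≤ A≤C b≤ disc with α ≤? 1
    ... | yes α≤1 = ≤-antisym α≤1 1≤α
    ... | no α≰1 = ⊥-elim (<⇒≱ 𝒜<3 3≤𝒜)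
      where
      open ≤-Reasoning
      sq4 : ∀ x → (x + x) * (x + x) ≡ 4 * (x * x)
      sq4 = ring-ℕ
      s1 : 3 * (α * α) ≤ 4 * 𝒜
      s1 = +-cancelʳ-≤ (α * α) _ _ (begin
        3 * (α * α) + α * α ≡⟨ l1 (α * α) ⟩
        4 * (α * α) ≤⟨ *-monoʳ-≤ 4 (*-monoʳ-≤ α α≤β) ⟩
        4 * (α * β) ≡⟨ cong (4 *_) ab ⟩
        4 * (𝒜 + φ * φ) ≡⟨ *-distribˡ-+ 4 𝒜 (φ * φ) ⟩
        4 * 𝒜 + 4 * (φ * φ) ≡⟨ cong (λ x → 4 * 𝒜 + x) (sym (sq4 φ)) ⟩
        4 * 𝒜 + (φ + φ) * (φ + φ) ≤⟨ +-monoʳ-≤ (4 * 𝒜) (*-mono-≤ φ≤ φ≤) ⟩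
        4 * 𝒜 + α * α ∎)
        where l1 : ∀ x → 3 * x + x ≡ 4 * x
              l1 = ring-ℕ
      s2 : 𝒜 * 𝒜 ≤ 4 * α
      s2 = *-cancelˡ-≤ 3 (+-cancelʳ-≤ (𝒜 * 𝒜) _ _ (begin
        3 * (𝒜 * 𝒜) + 𝒜 * 𝒜 ≡⟨ l1 (𝒜 * 𝒜) ⟩
        4 * (𝒜 * 𝒜) ≤⟨ *-monoʳ-≤ 4 (*-monoʳ-≤ 𝒜 A≤C) ⟩
        4 * (𝒜 * 𝒞) ≡⟨ cong (4 *_) disc ⟩
        4 * (α * D + b * b) ≡⟨ *-distribˡ-+ 4 (α * D) (b * b) ⟩
        4 * (α * D) + 4 * (b * b) ≤⟨ +-mono-≤ (*-monoʳ-≤ 4 (*-monoʳ-≤ α D≤3))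
            (≤-trans (≤-reflexive (sym (sq4 b))) (*-mono-≤ b≤ b≤)) ⟩
        4 * (α * 3) + 𝒜 * 𝒜 ≡⟨ cong (_+ 𝒜 * 𝒜) (l2 α) ⟩
        3 * (4 * α) + 𝒜 * 𝒜 ∎))
        where l1 : ∀ x → 3 * x + x ≡ 4 * x
              l1 = ring-ℕ
              l2 : ∀ x → 4 * (x * 3) ≡ 3 * (4 * x)
              l2 = ring-ℕ
      s3 : 3 * α ≤ 2 * 𝒜
      s3 = *-cancelˡ-≤ 2 (begin
        2 * (3 * α) ≡⟨ l1 α ⟩
        3 * (2 * α) ≤⟨ *-monoʳ-≤ 3 (*-monoˡ-≤ α (≰⇒> α≰1)) ⟩
        3 * (α * α) ≤⟨ s1 ⟩
        4 * 𝒜 ≡⟨ l2 𝒜 ⟩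
        2 * (2 * 𝒜) ∎)
        where l1 : ∀ x → 2 * (3 * x) ≡ 3 * (2 * x)
              l1 = ring-ℕ
              l2 : ∀ x → 4 * x ≡ 2 * (2 * x)
              l2 = ring-ℕ
      3𝒜≤8 : 3 * 𝒜 ≤ 8
      3𝒜≤8 = *-cancelˡ-≤ α {{>-nonZero 1≤α}} (begin
        α * (3 * 𝒜) ≡⟨ l1 α 𝒜 ⟩
        (3 * α) * 𝒜 ≤⟨ *-monoˡ-≤ 𝒜 s3 ⟩
        2 * 𝒜 * 𝒜 ≡⟨ *-assoc 2 𝒜 𝒜 ⟩
        2 * (𝒜 * 𝒜) ≤⟨ *-monoʳ-≤ 2 s2 ⟩
        2 * (4 * α) ≡⟨ l2 α ⟩
        α * 8 ∎)
        where l1 : ∀ x y → x * (3 * y) ≡ 3 * x * y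
              l1 = ring-ℕ
              l2 : ∀ x → 2 * (4 * x) ≡ x * 8
              l2 = ring-ℕ
      𝒜<3 : 𝒜 < 3
      𝒜<3 = *-cancelˡ-< 3 𝒜 3 (s≤s 3𝒜≤8)
      3≤𝒜 : 3 ≤ 𝒜
      3≤𝒜 = *-cancelˡ-≤ 2 (≤-trans (*-monoʳ-≤ 3 (≰⇒> α≰1)) s3)

    record LeadingUnit (F : Form) : Set where
      constructor split
      field
        𝒜 𝒞 : ℕ
        b : ℤ
        1≤𝒜 : 1 ≤ 𝒜
        equiv : F ~ form (+ 1) (+ 𝒜) (+ 𝒞) b (+ 0) (+ 0)
        b-small : ℤ.∣ b ∣ + ℤ.∣ b ∣ ≤ 𝒜
        A≤C : 𝒜 ≤ 𝒞
        disc : 𝒜 * 𝒞 ≡ D + ℤ.∣ b ∣ * ℤ.∣ b ∣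

    split-~ : ∀ {F G} → F ~ G → LeadingUnit G → LeadingUnit F
    split-~ {F} {G} F~G (split 𝒜 𝒞 b 1≤𝒜 e s u d) = split 𝒜 𝒞 b 1≤𝒜
        (~-trans {F} {G} {form (+ 1) (+ 𝒜) (+ 𝒞) b (+ 0) (+ 0)} F~G e) s u d

    unit-split : ∀ {G} (r : Reduced D G) → Reduced.α r ≡ 1 → LeadingUnit G
    unit-split {G} (reduced (positive .1 𝒜 _ 1≤𝒜 a≡ A≡ _) 𝒞 C≡ B-small A≤C disc) refl =
      split 𝒜 𝒞 (B G) 1≤𝒜 (complete-square G a≡ A≡ C≡) B-small A≤C
          (trans disc (cong (_+ ℤ.∣ B G ∣ * ℤ.∣ B G ∣) (+-identityʳ D)))

    αb-identity : ∀ {H α 𝒜} → a H ≡ + α → A H ≡ + 𝒜 → + α ⊗ b H ≡ + (𝒜 + ℤ.∣ f H ∣ * ℤ.∣ f H ∣)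
    αb-identity {H} {α} {𝒜} a≡ A≡ = trans (cong (_⊗ b H) (sym a≡))
        (trans (lem (a H ⊗ b H) (f H ⊗ f H)) (trans (cong₂ _⊕_ A≡ (square-abs (f H))) (sym (ℤ.pos-+ 𝒜 _))))
      where lem : ∀ x y → x ≡ x ⊖ y ⊕ y
            lem = ring-ℤ

    module _ (D≤3 : D ≤ 3) where
      Hermite : ℕ → Set
      Hermite n = ∀ F (p : Positive D F) → Positive.α p ≡ n → LeadingUnit F

      descend : ∀ {H α 𝒜 β} → Positive D H → a H ≡ + α → A H ≡ + 𝒜 → 1 ≤ 𝒜 → b H ≡ + β → 1 ≤ β → Hermite β → LeadingUnit
          H
      descend {H} {α} {𝒜} {β} (positive _ _ _ _ _ _ det≡) a≡ A≡ 1≤𝒜 b≡ 1≤β rec =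
        split-~ {H} {swap-xy H} (swap-xy-~ H) (rec (swap-xy H) (positive β 𝒜 1≤β 1≤𝒜 (trans (swap-xy-a H) b≡)
            (trans (swap-xy-A H) A≡) (trans (swap-xy-det H) det≡)) refl)

      -- A shear in x and y makes f small against α without changing A. If b is now less than α,
      -- exchanging x and y lowers the leading coefficient; otherwise `α≡1` applies.
      outer : ∀ {G} (r : Reduced D G) → (∀ {n} → n < Reduced.α r → Hermite n) → LeadingUnit G
      outer {G} r@(reduced (positive α 𝒜 1≤α 1≤𝒜 a≡ A≡ det≡) 𝒞 C≡ B-small A≤C disc) rec = go
          (balanced α {{>-nonZero 1≤α}} (f G))
        where
        go : (∃ λ k → ℤ.∣ f G ⊕ k ⊗ + α ∣ + ℤ.∣ f G ⊕ k ⊗ + α ∣ ≤ α) → LeadingUnit G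
        go (k , le) = decide (pos-factor α (b H) (𝒜 + ℤ.∣ f H ∣ * ℤ.∣ f H ∣) (≤-trans 1≤𝒜 (m≤m+n 𝒜 _))
            (αb-identity {H} a≡H A≡H))
          where
          H = shear-xy k G
          a≡H : a H ≡ + α
          a≡H = trans (shear-xy-a k G) a≡
          A≡H : A H ≡ + 𝒜
          A≡H = trans (shear-xy-A k G) A≡
          small : ℤ.∣ f H ∣ + ℤ.∣ f H ∣ ≤ α
          small = subst (λ x → ℤ.∣ x ∣ + ℤ.∣ x ∣ ≤ α) (sym (trans (shear-xy-f k G) (cong (λ x → f G ⊕ k ⊗ x) a≡))) le
          decide : (∃ λ β → b H ≡ + β × 1 ≤ β × α * β ≡ 𝒜 + ℤ.∣ f H ∣ * ℤ.∣ f H ∣) → LeadingUnit G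
          decide (β , b≡ , 1≤β , αβ) = case α ≤? β of λ
            { (yes α≤β) → unit-split r (α≡1 D≤3 {b = ℤ.∣ B G ∣} {φ = ℤ.∣ f H ∣} 1≤α α≤β αβ small A≤C B-small disc)
            ; (no α≰β) → split-~ {G} {H} (shear-xy-~ k G) (descend {H}
                (positive α 𝒜 1≤α 1≤𝒜 a≡H A≡H (trans (shear-xy-det k G) det≡)) a≡H A≡H 1≤𝒜 b≡ 1≤β (rec (≰⇒> α≰β))) }

      hermite : ∀ n → Hermite n
      hermite = <-rec Hermite λ { n rec F p refl → let G , F~G , r , α≡ = lagrange-reduce (Positive.𝒜 p) F p refl in
        split-~ {F} {G} F~G (outer r λ {n} lt → rec (subst (n <_) α≡ lt)) }

  -- The classes of determinant 1 and 3

  SumForm : ℤ → ℤ → Set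
  SumForm t n = ∃ λ x → ∃ λ y → ∃ λ z → n ≡ x ⊗ x ⊕ y ⊗ y ⊕ t ⊗ (z ⊗ z)

  module _ {D 𝒜 𝒞 β : ℕ} (A≤C : 𝒜 ≤ 𝒞) (small : β + β ≤ 𝒜) (disc : 𝒜 * 𝒞 ≡ D + β * β) where
    𝒜≤2 : D ≤ 3 → 𝒜 ≤ 2
    𝒜≤2 D≤3 = ≮⇒≥ λ 3≤𝒜 → <⇒≱ (s≤s (≤-trans (m≤m+n 12 14) ≤-refl)) (≤-trans (*-monoʳ-≤ 3 (*-mono-≤ 3≤𝒜 3≤𝒜)) bound)
      where
      open ≤-Reasoning
      bound : 3 * (𝒜 * 𝒜) ≤ 12
      bound = +-cancelʳ-≤ (𝒜 * 𝒜) _ _ (begin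
        3 * (𝒜 * 𝒜) + 𝒜 * 𝒜 ≡⟨ l1 (𝒜 * 𝒜) ⟩
        4 * (𝒜 * 𝒜) ≤⟨ *-monoʳ-≤ 4 (*-monoʳ-≤ 𝒜 A≤C) ⟩
        4 * (𝒜 * 𝒞) ≡⟨ cong (4 *_) disc ⟩
        4 * (D + β * β) ≡⟨ l2 D β ⟩
        4 * D + (β + β) * (β + β) ≤⟨ +-mono-≤ (*-monoʳ-≤ 4 D≤3) (*-mono-≤ small small) ⟩
        12 + 𝒜 * 𝒜 ∎)
        where l1 : ∀ x → 3 * x + x ≡ 4 * x
              l1 = ring-ℕ
              l2 : ∀ d x → 4 * (d + x * x) ≡ 4 * d + (x + x) * (x + x)
              l2 = ring-ℕ

  -- Here β is the absolute value of the middle coefficient: `hexagonal` is 2y² ± 2yz + 2z².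
  data Binary : ℕ → ℕ → ℕ → ℕ → Set where
    diagonal : ∀ {D} → Binary D 1 0 D
    hexagonal : Binary 3 2 1 2

  classify : ∀ {D 𝒜 𝒞 β} → D ≡ 1 ⊎ D ≡ 3 → 1 ≤ 𝒜 → 𝒜 ≤ 2 → 𝒜 ≤ 𝒞 → β + β ≤ 𝒜 → 𝒜 * 𝒞 ≡ D + β * β → Binary D 𝒜 β 𝒞
  classify {D} {1} {𝒞} {0} _ _ _ _ _ e = subst (Binary D 1 0) (trans (sym (+-identityʳ D))
      (trans (sym e) (+-identityʳ 𝒞))) diagonal
  classify {_} {1} {𝒞} {suc β} _ _ _ _ s _ = ⊥-elim (<⇒≱ (s≤s (subst (0 <_) (sym (+-suc β β)) (s≤s z≤n))) s)
  classify {_} {2} {0} {0} (inj₁ refl) _ _ () s e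
  classify {_} {2} {suc 𝒞} {0} (inj₁ refl) _ _ l s e = case trans (sym (+-suc (suc 𝒞) (𝒞 + 0))) e of λ ()
  classify {_} {2} {1} {0} (inj₂ refl) _ _ (s≤s ()) s e
  classify {_} {2} {2} {0} (inj₂ refl) _ _ l s ()
  classify {_} {2} {suc (suc (suc 𝒞))} {0} (inj₂ refl) _ _ l s e = case trans (sym (lem 𝒞)) e of λ ()
    where lem : ∀ c → 2 * (3 + c) ≡ 4 + (2 + 2 * c)
          lem = ring-ℕ
  classify {_} {2} {1} {1} _ _ _ (s≤s ()) s e
  classify {_} {2} {2} {1} (inj₁ refl) _ _ l s ()
  classify {_} {2} {2} {1} (inj₂ refl) _ _ l s e = hexagonal
  classify {_} {2} {suc (suc (suc 𝒞))} {1} (inj₁ refl) _ _ l s e = case trans (sym (lem 𝒞)) e of λ ()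
    where lem : ∀ c → 2 * (3 + c) ≡ 5 + (1 + 2 * c)
          lem = ring-ℕ
  classify {_} {2} {suc (suc (suc 𝒞))} {1} (inj₂ refl) _ _ l s e = case trans (sym (lem 𝒞)) e of λ ()
    where lem : ∀ c → 2 * (3 + c) ≡ 5 + (1 + 2 * c)
          lem = ring-ℕ
  classify {_} {2} {𝒞} {suc (suc β)} _ _ _ _ s _ = ⊥-elim (<⇒≱
      (s≤s (s≤s (subst (0 <_) (sym (+-suc β (suc β))) (s≤s z≤n)))) s)
  classify {_} {suc (suc (suc _))} _ _ (s≤s (s≤s ())) _ _ _

  module _ {F : Form} where
    Split⇒Sum : ∀ D (1≤D : 1 ≤ D) → D ≡ 1 ⊎ D ≡ 3 → D ≤ 3 → (D ≡ 3 → ∀ x y z → val F x y z ≢ + 6) → LeadingUnit 1≤D F →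
        ∀ x y z → SumForm (+ D) (val F x y z)
    Split⇒Sum D 1≤D D13 D≤3 no6 (split 𝒜 𝒞 b 1≤𝒜 (F⊑ , ⊑F) small A≤C disc) =
      go 𝒜 𝒞 b (classify D13 1≤𝒜 (𝒜≤2 {β = ℤ.∣ b ∣} A≤C small disc D≤3) A≤C small disc) F⊑ ⊑F
      where
      go : ∀ 𝒜 𝒞 b → Binary D 𝒜 ℤ.∣ b ∣ 𝒞 → F ⊑ form (+ 1) (+ 𝒜) (+ 𝒞) b (+ 0) (+ 0) → form (+ 1) (+ 𝒜) (+ 𝒞) b (+ 0)
          (+ 0) ⊑ F → ∀ x y z → SumForm (+ D) (val F x y z)
      go _ _ (+ 0) diagonal F⊑ ⊑F x y z = let x′ , y′ , z′ , e = F⊑ x y z in x′ , y′ , z′ , trans e (lem (+ D) x′ y′ z′)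
        where lem : ∀ d x y z → + 1 ⊗ (x ⊗ x) ⊕ + 1 ⊗ (y ⊗ y) ⊕ d ⊗ (z ⊗ z) ⊕ + 2 ⊗
                  (+ 0 ⊗ (y ⊗ z) ⊕ + 0 ⊗ (x ⊗ z) ⊕ + 0 ⊗ (x ⊗ y)) ≡ x ⊗ x ⊕ y ⊗ y ⊕ d ⊗ (z ⊗ z)
              lem = ring-ℤ
      -- x² + 2y² ± 2yz + 2z² is 6 at (2, 1, 0).
      go _ _ (+ 1) hexagonal F⊑ ⊑F x y z = let x′ , y′ , z′ , e = ⊑F (+ 2) (+ 1) (+ 0) in ⊥-elim (no6 refl x′ y′ z′ (sym e))
      go _ _ -[1+ 0 ] hexagonal F⊑ ⊑F x y z = let x′ , y′ , z′ , e = ⊑F (+ 2) (+ 1) (+ 0) in ⊥-elim (no6 refl x′ y′ z′ (sym e))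

  -- With n = s²q, km' = kn + 1 and qc = b² + mη, this form of determinant kη represents km and satisfies
  -- m·val = qX² + 2bXY + cY² + k(sqX + sbY + mZ)².
  genusForm : (q e c s b k m η : ℤ) → Form
  genusForm q e c s b k m η = form (q ⊗ e) (c ⊗ e ⊖ k ⊗ η ⊗ (s ⊗ s)) (k ⊗ m) (k ⊗ (s ⊗ b)) (k ⊗ (s ⊗ q)) (b ⊗ e)

  module GenusForm (q e c s b k m η : ℤ) (qc : q ⊗ c ≡ b ⊗ b ⊕ m ⊗ η) (me : m ⊗ e ≡ k ⊗ (s ⊗ s ⊗ q) ⊕ + 1) where
    T : Form
    T = genusForm q e c s b k m η

    private
      -- The two relations are kept as terms with values 0 and 1. Every statement below is then a
      -- polynomial identity in the parameters, into which these values are substituted.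
      u v : ℤ
      u = q ⊗ c ⊖ (b ⊗ b ⊕ m ⊗ η)
      v = m ⊗ e ⊖ k ⊗ (s ⊗ s ⊗ q)
      u≡0 : u ≡ + 0
      u≡0 = ℤ.i≡j⇒i-j≡0 qc
      v≡1 : v ≡ + 1
      v≡1 = trans (cong (_⊖ k ⊗ (s ⊗ s ⊗ q)) me) (lem (k ⊗ (s ⊗ s ⊗ q)))
        where lem : ∀ x → x ⊕ + 1 ⊖ x ≡ + 1
              lem = ring-ℤ

    T-det : det T ≡ k ⊗ η
    T-det = trans (lem q e c s b k m η) (trans (cong₂ (λ v u → k ⊗ η ⊗ (v ⊗ v) ⊕ u ⊗
        (k ⊗ (e ⊗ (m ⊗ e ⊖ k ⊗ (s ⊗ s ⊗ q))))) v≡1 u≡0) (lem′ (k ⊗ η) (k ⊗ (e ⊗ (m ⊗ e ⊖ k ⊗ (s ⊗ s ⊗ q))))))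
      where
      lem′ : ∀ x y → x ⊗ (+ 1 ⊗ + 1) ⊕ + 0 ⊗ y ≡ x
      lem′ = ring-ℤ
      lem : ∀ q e c s b k m η → (q ⊗ e) ⊗ (c ⊗ e ⊖ k ⊗ η ⊗ (s ⊗ s)) ⊗ (k ⊗ m) ⊕ + 2 ⊗
          ((k ⊗ (s ⊗ b)) ⊗ (k ⊗ (s ⊗ q)) ⊗ (b ⊗ e))
          ⊖ (q ⊗ e) ⊗ ((k ⊗ (s ⊗ b)) ⊗ (k ⊗ (s ⊗ b))) ⊖ (c ⊗ e ⊖ k ⊗ η ⊗ (s ⊗ s)) ⊗ ((k ⊗ (s ⊗ q)) ⊗ (k ⊗ (s ⊗ q))) ⊖
              (k ⊗ m) ⊗ ((b ⊗ e) ⊗ (b ⊗ e))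
        ≡ k ⊗ η ⊗ ((m ⊗ e ⊖ k ⊗ (s ⊗ s ⊗ q)) ⊗ (m ⊗ e ⊖ k ⊗ (s ⊗ s ⊗ q))) ⊕ (q ⊗ c ⊖ (b ⊗ b ⊕ m ⊗ η)) ⊗
            (k ⊗ (e ⊗ (m ⊗ e ⊖ k ⊗ (s ⊗ s ⊗ q))))
      lem = ring-ℤ

    T-A : A T ≡ e ⊗ η
    T-A = trans (lem q e c s b k m η) (trans (cong₂ (λ v u → e ⊗ η ⊗ v ⊕ u ⊗ (e ⊗ e)) v≡1 u≡0) (lem′ (e ⊗ η) (e ⊗ e)))
      where
      lem′ : ∀ x y → x ⊗ + 1 ⊕ + 0 ⊗ y ≡ x
      lem′ = ring-ℤ
      lem : ∀ q e c s b k m η → (q ⊗ e) ⊗ (c ⊗ e ⊖ k ⊗ η ⊗ (s ⊗ s)) ⊖ (b ⊗ e) ⊗ (b ⊗ e)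
        ≡ e ⊗ η ⊗ (m ⊗ e ⊖ k ⊗ (s ⊗ s ⊗ q)) ⊕ (q ⊗ c ⊖ (b ⊗ b ⊕ m ⊗ η)) ⊗ (e ⊗ e)
      lem = ring-ℤ

    T-001 : val T (+ 0) (+ 0) (+ 1) ≡ k ⊗ m
    T-001 = lem (q ⊗ e) (c ⊗ e ⊖ k ⊗ η ⊗ (s ⊗ s)) (k ⊗ m) (k ⊗ (s ⊗ b)) (k ⊗ (s ⊗ q)) (b ⊗ e)
      where
      lem : ∀ a b c d e f → a ⊗ (+ 0 ⊗ + 0) ⊕ b ⊗ (+ 0 ⊗ + 0) ⊕ c ⊗ (+ 1 ⊗ + 1) ⊕ + 2 ⊗
          (d ⊗ (+ 0 ⊗ + 1) ⊕ e ⊗ (+ 0 ⊗ + 1) ⊕ f ⊗ (+ 0 ⊗ + 0)) ≡ c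
      lem = ring-ℤ

    -- The further factor q completes the square in the binary part as well, which gives the
    -- diagonal shape needed for the argument modulo 3.
    T-diagonal : ∀ x y z → let U = q ⊗ x ⊕ b ⊗ y ; L = s ⊗ (q ⊗ x ⊕ b ⊗ y) ⊕ m ⊗ z in
      q ⊗ (m ⊗ val T x y z) ≡ U ⊗ U ⊕ m ⊗ η ⊗ (y ⊗ y) ⊕ k ⊗ q ⊗ (L ⊗ L)
    T-diagonal x y z = trans (lem q e c s b k m η x y z) (trans (cong₂ (rhs x y z) v≡1 u≡0)
        (lem′ q b y (q ⊗ x ⊕ b ⊗ y) (m ⊗ η) (k ⊗ q ⊗ (L ⊗ L)) (k ⊗ (s ⊗ s ⊗ q))))
      where
      L = s ⊗ (q ⊗ x ⊕ b ⊗ y) ⊕ m ⊗ z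
      rhs : ℤ → ℤ → ℤ → ℤ → ℤ → ℤ
      rhs x y z v u = v ⊗ ((q ⊗ x ⊕ b ⊗ y) ⊗ (q ⊗ x ⊕ b ⊗ y) ⊕ m ⊗ η ⊗ (y ⊗ y)) ⊕ k ⊗ q ⊗
          ((s ⊗ (q ⊗ x ⊕ b ⊗ y) ⊕ m ⊗ z) ⊗ (s ⊗ (q ⊗ x ⊕ b ⊗ y) ⊕ m ⊗ z)) ⊕ u ⊗ (y ⊗ y ⊗ (v ⊕ k ⊗ (s ⊗ s ⊗ q)))
      lem′ : ∀ q b y U w t j → + 1 ⊗ (U ⊗ U ⊕ w ⊗ (y ⊗ y)) ⊕ t ⊕ + 0 ⊗ (y ⊗ y ⊗ (+ 1 ⊕ j)) ≡ U ⊗ U ⊕ w ⊗ (y ⊗ y) ⊕ t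
      lem′ = ring-ℤ
      lem : ∀ q e c s b k m η x y z → q ⊗ (m ⊗ ((q ⊗ e) ⊗ (x ⊗ x) ⊕ (c ⊗ e ⊖ k ⊗ η ⊗ (s ⊗ s)) ⊗ (y ⊗ y) ⊕ (k ⊗ m) ⊗
          (z ⊗ z) ⊕ + 2 ⊗ ((k ⊗ (s ⊗ b)) ⊗ (y ⊗ z) ⊕ (k ⊗ (s ⊗ q)) ⊗ (x ⊗ z) ⊕ (b ⊗ e) ⊗ (x ⊗ y))))
        ≡ (m ⊗ e ⊖ k ⊗ (s ⊗ s ⊗ q)) ⊗ ((q ⊗ x ⊕ b ⊗ y) ⊗ (q ⊗ x ⊕ b ⊗ y) ⊕ m ⊗ η ⊗ (y ⊗ y)) ⊕ k ⊗ q ⊗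
            ((s ⊗ (q ⊗ x ⊕ b ⊗ y) ⊕ m ⊗ z) ⊗ (s ⊗ (q ⊗ x ⊕ b ⊗ y) ⊕ m ⊗ z)) ⊕ (q ⊗ c ⊖ (b ⊗ b ⊕ m ⊗ η)) ⊗
            (y ⊗ y ⊗ (m ⊗ e ⊖ k ⊗ (s ⊗ s ⊗ q) ⊕ k ⊗ (s ⊗ s ⊗ q)))
      lem = ring-ℤ

  -- Arithmetic modulo 3 and the excluded class

  mod3 : ∀ x → (∃ λ k → x ≡ + 3 ⊗ k) ⊎ (∃ λ k → x ⊗ x ≡ + 1 ⊕ + 3 ⊗ k)
  mod3 x with balanced 3 x
  ... | j , small = go (x ⊕ j ⊗ + 3) refl small
    where
    back : ∀ x j → x ≡ (x ⊕ j ⊗ + 3) ⊖ j ⊗ + 3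
    back = ring-ℤ
    l0 : ∀ j → + 0 ⊖ j ⊗ + 3 ≡ + 3 ⊗ (⊝ j)
    l0 = ring-ℤ
    sq : ∀ y j → (y ⊖ j ⊗ + 3) ⊗ (y ⊖ j ⊗ + 3) ≡ y ⊗ y ⊕ + 3 ⊗ (+ 3 ⊗ (j ⊗ j) ⊖ + 2 ⊗ (y ⊗ j))
    sq = ring-ℤ
    go : ∀ y → x ⊕ j ⊗ + 3 ≡ y → ℤ.∣ y ∣ + ℤ.∣ y ∣ ≤ 3 → (∃ λ k → x ≡ + 3 ⊗ k) ⊎ (∃ λ k → x ⊗ x ≡ + 1 ⊕ + 3 ⊗ k)
    go (+ 0) e _ = inj₁ (⊝ j , trans (back x j) (trans (cong (_⊖ j ⊗ + 3) e) (l0 j)))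
    go (+ 1) e _ = inj₂ (+ 3 ⊗ (j ⊗ j) ⊖ + 2 ⊗ (+ 1 ⊗ j) , trans (cong₂ _⊗_ xe xe) (sq (+ 1) j))
      where xe = trans (back x j) (cong (_⊖ j ⊗ + 3) e)
    go -[1+ 0 ] e _ = inj₂ (+ 3 ⊗ (j ⊗ j) ⊖ + 2 ⊗ (-[1+ 0 ] ⊗ j) , trans (cong₂ _⊗_ xe xe) (sq -[1+ 0 ] j))
      where xe = trans (back x j) (cong (_⊖ j ⊗ + 3) e)
    go (+ suc (suc n)) e (s≤s (s≤s s)) = ⊥-elim (<⇒≱ (s≤s (s≤s z≤n))
        (subst (_≤ 1) (trans (+-suc n (suc n)) (cong suc (+-suc n n))) s))
    go -[1+ suc n ] e (s≤s (s≤s s)) = ⊥-elim (<⇒≱ (s≤s (s≤s z≤n))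
        (subst (_≤ 1) (trans (+-suc n (suc n)) (cong suc (+-suc n n))) s))

  3*≢1 : ∀ y → + 3 ⊗ y ≢ + 1
  3*≢1 y e = from-no (3 ∣? 1) (divides ℤ.∣ y ∣ (trans (cong ℤ.∣_∣ (sym e))
      (trans (ℤ.abs-* (+ 3) y) (*-comm 3 ℤ.∣ y ∣))))

  3*≢2 : ∀ y → + 3 ⊗ y ≢ + 2
  3*≢2 y e = from-no (3 ∣? 2) (divides ℤ.∣ y ∣ (trans (cong ℤ.∣_∣ (sym e))
      (trans (ℤ.abs-* (+ 3) y) (*-comm 3 ℤ.∣ y ∣))))

  -- -1 is not a square modulo 3.
  anisotropic : ∀ U V t → U ⊗ U ⊕ V ⊗ V ≡ + 3 ⊗ t → (∃ λ k → U ≡ + 3 ⊗ k) × (∃ λ k → V ≡ + 3 ⊗ k)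
  anisotropic U V t eq with mod3 U | mod3 V
  ... | inj₁ p | inj₁ q = p , q
  ... | inj₁ (i , p) | inj₂ (j , q) = ⊥-elim (3*≢1 (t ⊖ + 3 ⊗ (i ⊗ i) ⊖ j)
      (trans (lem t i j) (trans (cong (λ x → x ⊖ + 3 ⊗ (+ 3 ⊗ (i ⊗ i) ⊕ j))
      (trans (sym eq) (cong₂ _⊕_ (cong₂ _⊗_ p p) q))) (lem′ i j))))
    where lem : ∀ t i j → + 3 ⊗ (t ⊖ + 3 ⊗ (i ⊗ i) ⊖ j) ≡ + 3 ⊗ t ⊖ + 3 ⊗ (+ 3 ⊗ (i ⊗ i) ⊕ j)
          lem = ring-ℤ
          lem′ : ∀ i j → + 3 ⊗ i ⊗ (+ 3 ⊗ i) ⊕ (+ 1 ⊕ + 3 ⊗ j) ⊖ + 3 ⊗ (+ 3 ⊗ (i ⊗ i) ⊕ j) ≡ + 1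
          lem′ = ring-ℤ
  ... | inj₂ (i , p) | inj₁ (j , q) = ⊥-elim (3*≢1 (t ⊖ + 3 ⊗ (j ⊗ j) ⊖ i)
      (trans (lem t i j) (trans (cong (λ x → x ⊖ + 3 ⊗ (+ 3 ⊗ (j ⊗ j) ⊕ i))
      (trans (sym eq) (cong₂ _⊕_ p (cong₂ _⊗_ q q)))) (lem′ i j))))
    where lem : ∀ t i j → + 3 ⊗ (t ⊖ + 3 ⊗ (j ⊗ j) ⊖ i) ≡ + 3 ⊗ t ⊖ + 3 ⊗ (+ 3 ⊗ (j ⊗ j) ⊕ i)
          lem = ring-ℤ
          lem′ : ∀ i j → + 1 ⊕ + 3 ⊗ i ⊕ + 3 ⊗ j ⊗ (+ 3 ⊗ j) ⊖ + 3 ⊗ (+ 3 ⊗ (j ⊗ j) ⊕ i) ≡ + 1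
          lem′ = ring-ℤ
  ... | inj₂ (i , p) | inj₂ (j , q) = ⊥-elim (3*≢2 (t ⊖ i ⊖ j)
      (trans (lem t i j) (trans (cong (λ x → x ⊖ + 3 ⊗ (i ⊕ j)) (trans (sym eq) (cong₂ _⊕_ p q))) (lem′ i j))))
    where lem : ∀ t i j → + 3 ⊗ (t ⊖ i ⊖ j) ≡ + 3 ⊗ t ⊖ + 3 ⊗ (i ⊕ j)
          lem = ring-ℤ
          lem′ : ∀ i j → + 1 ⊕ + 3 ⊗ i ⊕ (+ 1 ⊕ + 3 ⊗ j) ⊖ + 3 ⊗ (i ⊕ j) ≡ + 2
          lem′ = ring-ℤ

  -- Excludes x² + 2(y² + yz + z²), the other class of determinant 3, which takes the value 6.
  omits-six : ∀ p p′ r r′ U V W → p ≡ + 1 ⊕ + 3 ⊗ p′ → r ⊗ r ≡ + 1 ⊕ + 3 ⊗ r′ →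
    r ⊗ (p ⊗ + 6) ≢ U ⊗ U ⊕ p ⊗ (V ⊗ V) ⊕ + 3 ⊗ r ⊗ (W ⊗ W)
  omits-six p p′ r r′ U V W refl rr eq with anisotropic U V (+ 2 ⊗ (p ⊗ r) ⊖ r ⊗ (W ⊗ W) ⊖ p′ ⊗ (V ⊗ V))
      (trans (lem₁ p′ r U V W) (trans (cong (λ x → x ⊖ + 3 ⊗ r ⊗ (W ⊗ W) ⊖ + 3 ⊗ p′ ⊗ (V ⊗ V)) (sym eq))
          (lem₂ p′ r V W)))
    where
    lem₁ : ∀ p′ r U V W → U ⊗ U ⊕ V ⊗ V ≡ U ⊗ U ⊕ (+ 1 ⊕ + 3 ⊗ p′) ⊗ (V ⊗ V) ⊕ + 3 ⊗ r ⊗ (W ⊗ W) ⊖ + 3 ⊗ r ⊗ (W ⊗ W) ⊖ +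
        3 ⊗ p′ ⊗ (V ⊗ V)
    lem₁ = ring-ℤ
    lem₂ : ∀ p′ r V W → r ⊗ ((+ 1 ⊕ + 3 ⊗ p′) ⊗ + 6) ⊖ + 3 ⊗ r ⊗ (W ⊗ W) ⊖ + 3 ⊗ p′ ⊗ (V ⊗ V) ≡ + 3 ⊗
        (+ 2 ⊗ ((+ 1 ⊕ + 3 ⊗ p′) ⊗ r) ⊖ r ⊗ (W ⊗ W) ⊖ p′ ⊗ (V ⊗ V))
    lem₂ = ring-ℤ
  ... | (x , refl) , (y , refl) = third (mod3 W)
    where
    E = x ⊗ x ⊕ (+ 1 ⊕ + 3 ⊗ p′) ⊗ (y ⊗ y)
    -- U and V being multiples of 3, one factor 3 cancels and leaves 2pr ≡ rW² (mod 3), that is W² ≡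
    -- 2.
    divided : + 2 ⊗ (p ⊗ r) ≡ + 3 ⊗ E ⊕ r ⊗ (W ⊗ W)
    divided = ℤ.*-cancelˡ-≡ (+ 3) _ _ (trans (l₁ p r) (trans eq (l₂ p′ r x y W)))
      where
      l₁ : ∀ p r → + 3 ⊗ (+ 2 ⊗ (p ⊗ r)) ≡ r ⊗ (p ⊗ + 6)
      l₁ = ring-ℤ
      l₂ : ∀ p′ r x y W → + 3 ⊗ x ⊗ (+ 3 ⊗ x) ⊕ (+ 1 ⊕ + 3 ⊗ p′) ⊗ (+ 3 ⊗ y ⊗ (+ 3 ⊗ y)) ⊕ + 3 ⊗ r ⊗ (W ⊗ W) ≡ + 3 ⊗
          (+ 3 ⊗ (x ⊗ x ⊕ (+ 1 ⊕ + 3 ⊗ p′) ⊗ (y ⊗ y)) ⊕ r ⊗ (W ⊗ W))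
      l₂ = ring-ℤ
    -- Of r only the square is known modulo 3, hence the extra factor r.
    scaled : + 2 ⊗ (p ⊗ (r ⊗ r)) ≡ + 3 ⊗ (E ⊗ r) ⊕ (r ⊗ r) ⊗ (W ⊗ W)
    scaled = trans (l₁ p r) (trans (cong (_⊗ r) divided) (l₂ E r W))
      where
      l₁ : ∀ p r → + 2 ⊗ (p ⊗ (r ⊗ r)) ≡ + 2 ⊗ (p ⊗ r) ⊗ r
      l₁ = ring-ℤ
      l₂ : ∀ E r W → (+ 3 ⊗ E ⊕ r ⊗ (W ⊗ W)) ⊗ r ≡ + 3 ⊗ (E ⊗ r) ⊕ (r ⊗ r) ⊗ (W ⊗ W)
      l₂ = ring-ℤ
    third : (∃ λ k → W ≡ + 3 ⊗ k) ⊎ (∃ λ k → W ⊗ W ≡ + 1 ⊕ + 3 ⊗ k) → ⊥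
    third (inj₁ (w , refl)) = 3*≢2 (E ⊗ r ⊕ (r ⊗ r) ⊗ (+ 3 ⊗ (w ⊗ w)) ⊖ + 2 ⊗ (p′ ⊗ (r ⊗ r)) ⊖ + 2 ⊗ r′)
      (trans (l₁ (E ⊗ r) (r ⊗ r) w p′ r′) (trans (cong (λ t → t ⊖ + 6 ⊗ (p′ ⊗ (r ⊗ r)) ⊖ + 6 ⊗ r′) (sym scaled))
          (trans (l₂ p′ (r ⊗ r) r′) (trans (cong (λ t → + 2 ⊗ t ⊖ + 6 ⊗ r′) rr) (l₃ r′)))))
      where
      l₁ : ∀ e R w p′ r′ → + 3 ⊗ (e ⊕ R ⊗ (+ 3 ⊗ (w ⊗ w)) ⊖ + 2 ⊗ (p′ ⊗ R) ⊖ + 2 ⊗ r′) ≡ + 3 ⊗ e ⊕ R ⊗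
          (+ 3 ⊗ w ⊗ (+ 3 ⊗ w)) ⊖ + 6 ⊗ (p′ ⊗ R) ⊖ + 6 ⊗ r′
      l₁ = ring-ℤ
      l₂ : ∀ p′ R r′ → + 2 ⊗ ((+ 1 ⊕ + 3 ⊗ p′) ⊗ R) ⊖ + 6 ⊗ (p′ ⊗ R) ⊖ + 6 ⊗ r′ ≡ + 2 ⊗ R ⊖ + 6 ⊗ r′
      l₂ = ring-ℤ
      l₃ : ∀ r′ → + 2 ⊗ (+ 1 ⊕ + 3 ⊗ r′) ⊖ + 6 ⊗ r′ ≡ + 2
      l₃ = ring-ℤ
    third (inj₂ (j , ww)) = 3*≢1 (E ⊗ r ⊕ (r ⊗ r) ⊗ j ⊖ + 2 ⊗ (p′ ⊗ (r ⊗ r)) ⊖ r′)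
      (trans (l₁ (E ⊗ r) (r ⊗ r) j p′ r′) (trans (cong (λ t → + 3 ⊗ (E ⊗ r) ⊕ (r ⊗ r) ⊗ t ⊖ (r ⊗ r) ⊖ + 6 ⊗
          (p′ ⊗ (r ⊗ r)) ⊖ + 3 ⊗ r′) (sym ww))
        (trans (cong (λ t → t ⊖ (r ⊗ r) ⊖ + 6 ⊗ (p′ ⊗ (r ⊗ r)) ⊖ + 3 ⊗ r′) (sym scaled))
            (trans (l₂ p′ (r ⊗ r) r′) (trans (cong (λ t → t ⊖ + 3 ⊗ r′) rr) (l₃ r′))))))
      where
      l₁ : ∀ e R j p′ r′ → + 3 ⊗ (e ⊕ R ⊗ j ⊖ + 2 ⊗ (p′ ⊗ R) ⊖ r′) ≡ + 3 ⊗ e ⊕ R ⊗ (+ 1 ⊕ + 3 ⊗ j) ⊖ R ⊖ + 6 ⊗ (p′ ⊗ R)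
          ⊖ + 3 ⊗ r′
      l₁ = ring-ℤ
      l₂ : ∀ p′ R r′ → + 2 ⊗ ((+ 1 ⊕ + 3 ⊗ p′) ⊗ R) ⊖ R ⊖ + 6 ⊗ (p′ ⊗ R) ⊖ + 3 ⊗ r′ ≡ R ⊖ + 3 ⊗ r′
      l₂ = ring-ℤ
      l₃ : ∀ r′ → + 1 ⊕ + 3 ⊗ r′ ⊖ + 3 ⊗ r′ ≡ + 1
      l₃ = ring-ℤ

  -- From a root of -mη to a representation of km

  module FromGood (k m η : ℕ) (1≤k : 1 ≤ k) (1≤m : 1 ≤ m) (1≤η : 1 ≤ η) (D : k * η ≡ 1 ⊎ k * η ≡ 3) where

    D≤3 : k * η ≤ 3
    D≤3 = go D
      where
      go : k * η ≡ 1 ⊎ k * η ≡ 3 → k * η ≤ 3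
      go (inj₁ e) = ≤-trans (≤-reflexive e) (s≤s z≤n)
      go (inj₂ e) = ≤-reflexive e

    -- `T-diagonal` with the value 6 is refuted for every decomposition n = s²q and every root b,
    -- since the existence argument does not say which ones it delivers.
    Omits : ℕ → Set
    Omits n = ∀ s q b c → n ≡ s * s * q → + q ⊗ c ≡ b ⊗ b ⊕ + m ⊗ + η → ∀ U V W →
      + q ⊗ (+ m ⊗ + 6) ≢ U ⊗ U ⊕ + m ⊗ + η ⊗ (V ⊗ V) ⊕ + k ⊗ + q ⊗ (W ⊗ W)

    from-good : ∀ {n} → 1 ≤ n → Good (m * η) n → m ∣ k * n + 1 → (k * η ≡ 3 → Omits n) → SumForm (+ (k * η)) (+ (k * m))
    from-good {n} 1≤n (good s q n≡ (b , via c root)) (divides e me′) omits =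
      subst (SumForm (+ (k * η))) (trans T-001 (sym (ℤ.pos-* k m)))
        (Split⇒Sum {T} (k * η) (*-mono-≤ 1≤k 1≤η) D D≤3 no6 (hermite (*-mono-≤ 1≤k 1≤η) D≤3 (q * e) T pos refl) (+ 0)
            (+ 0) (+ 1))
      where
      qc : + q ⊗ c ≡ b ⊗ b ⊕ + m ⊗ + η
      qc = trans (ℤ.*-comm (+ q) c) (trans (sym (ℤ.+-identityˡ (c ⊗ + q)))
          (trans (sym root) (cong (_⊕_ (b ⊗ b)) (ℤ.pos-* m η))))
      me : + m ⊗ + e ≡ + k ⊗ (+ s ⊗ + s ⊗ + q) ⊕ + 1
      me = trans (sym (ℤ.pos-* m e)) (trans (cong +_ (trans (*-comm m e) (sym me′)))
          (trans (ℤ.pos-+ (k * n) 1) (cong (_⊕ + 1)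
        (trans (ℤ.pos-* k n) (cong (_⊗_ (+ k)) (trans (cong +_ n≡)
            (trans (ℤ.pos-* (s * s) q) (cong (_⊗ + q) (ℤ.pos-* s s)))))))))
      open GenusForm (+ q) (+ e) c (+ s) b (+ k) (+ m) (+ η) qc me
      1≤q : 1 ≤ q
      1≤q = n≢0⇒n>0 λ q≡0 → <⇒≢ 1≤n (sym (trans n≡ (trans (cong (s * s *_) q≡0) (*-zeroʳ (s * s)))))
      1≤e : 1 ≤ e
      1≤e = n≢0⇒n>0 λ e≡0 → 0≢1+n (sym (trans (sym (+-comm (k * n) 1)) (trans me′ (cong (_* m) e≡0))))
      pos : Positive (k * η) T
      pos = positive (q * e) (e * η) (*-mono-≤ 1≤q 1≤e) (*-mono-≤ 1≤e 1≤η) (sym (ℤ.pos-* q e))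
          (trans T-A (sym (ℤ.pos-* e η))) (trans T-det (sym (ℤ.pos-* k η)))
      no6 : k * η ≡ 3 → ∀ x y z → val T x y z ≢ + 6
      no6 D≡3 x y z eq = omits D≡3 s q b c n≡ qc (+ q ⊗ x ⊕ b ⊗ y) y (+ s ⊗ (+ q ⊗ x ⊕ b ⊗ y) ⊕ + m ⊗ z)
        (trans (cong (λ t → + q ⊗ (+ m ⊗ t)) (sym eq)) (T-diagonal x y z))

  coprime-8* : ∀ {h m} → Coprime (odd h) m → Coprime (odd h) (8 * m)
  coprime-8* {h} {m} c = cop-sym (coprime-* {8} {m} (coprime-* {2} {4} (coprime-2 h)
      (coprime-* {2} {2} (coprime-2 h) (coprime-2 h))) (cop-sym c))

  module Represent (β l k m η : ℕ) (1≤k : 1 ≤ k) (1≤m : 1 ≤ m) (1≤η : 1 ≤ η) (D : k * η ≡ 1 ⊎ k * η ≡ 3)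
    (δ≡ : Kronecker.m β l ≡ m * η) where
    open FromGood k m η 1≤k 1≤m 1≤η D public

    -- The number n supplied by the existence argument is known only through its class modulo 8mη.
    -- That class carries `m ∣ k * n + 1` over from `odd h`, and `omits` receives the congruence to
    -- deduce what it needs modulo 3.
    represent : ∀ h → Coprime (odd h) (m * η) → alt h Sign.* J (m * η) h ≡ Sign.+ → m ∣ k * odd h + 1 →
      (∀ n t → + n ≡ + odd h ⊕ t ⊗ + (m * η) → k * η ≡ 3 → Omits n) → SumForm (+ (k * η)) (+ (k * m))
    represent h c χ+ (divides g ka) omits = let n , n≈a , G = genus in conclude n n≈a (subst (λ x → Good x n) δ≡ G)
      where
      genus : ∃ λ n → + n ≈ + odd h [ + (8 * Kronecker.m β l) ] × Good (Kronecker.m β l) n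
      genus = Character.genus-existence β l h (coprime-8* {h} (subst (Coprime (odd h)) (sym δ≡) c))
          (subst (λ x → alt h Sign.* J x h ≡ Sign.+) (sym δ≡) χ+)
      conclude : ∀ n → + n ≈ + odd h [ + (8 * Kronecker.m β l) ] → Good (m * η) n → SumForm (+ (k * η)) (+ (k * m))
      conclude n (via t e) G = from-good {n} 1≤n G m∣kn+1 (omits n (t ⊗ + 8) n≡)
       where
        n≡ : + n ≡ + odd h ⊕ t ⊗ + 8 ⊗ + (m * η)
        n≡ = trans e (cong (_⊕_ (+ odd h)) (trans (cong (_⊗_ t) (trans (cong (λ x → + (8 * x)) δ≡) (ℤ.pos-* 8 (m * η))))
            (sym (ℤ.*-assoc t (+ 8) (+ (m * η))))))
        m∣kn+1 : m ∣ k * n + 1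
        m∣kn+1 = subst (m ∣_) (cong ℤ.∣_∣ (ℤ.+-identityʳ (+ (k * n + 1)))) (≈⇒∣ {m} {+ (k * n + 1)} {+ 0}
          (via (+ g ⊕ + k ⊗ (t ⊗ + 8) ⊗ + η) (trans (ℤ.pos-+ (k * n) 1)
              (trans (cong (_⊕ + 1) (trans (ℤ.pos-* k n) (cong (_⊗_ (+ k)) n≡)))
            (trans (cong (λ x → + k ⊗ (+ odd h ⊕ t ⊗ + 8 ⊗ x) ⊕ + 1) (ℤ.pos-* m η))
            (trans (lem (+ k) (+ odd h) (t ⊗ + 8) (+ m) (+ η)) (trans
                (cong (_⊕ + k ⊗ ((t ⊗ + 8) ⊗ (+ m ⊗ + η))) (trans (trans (cong (_⊕ + 1) (sym (ℤ.pos-* k (odd h))))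
                (sym (ℤ.pos-+ (k * odd h) 1))) (trans (cong +_ ka) (ℤ.pos-* g m))))
                (lem′ (+ g) (+ m) (+ k) (t ⊗ + 8) (+ η)))))))))
          where
          lem : ∀ k a t m η → k ⊗ (a ⊕ t ⊗ (m ⊗ η)) ⊕ + 1 ≡ k ⊗ a ⊕ + 1 ⊕ k ⊗ (t ⊗ (m ⊗ η))
          lem = ring-ℤ
          lem′ : ∀ g m k t η → g ⊗ m ⊕ k ⊗ (t ⊗ (m ⊗ η)) ≡ + 0 ⊕ (g ⊕ k ⊗ t ⊗ η) ⊗ m
          lem′ = ring-ℤ
        -- If n were 0, mη would divide `odd h`. Coprimality would force mη = 1, and then the odd
        -- number `odd h` would be a multiple of 8.
        1≤n : 1 ≤ n
        1≤n = n≢0⇒n>0 λ n≡0 → mη≢1 n≡0 (c {m * η} (divides ℤ.∣ ⊝ (t ⊗ + 8) ∣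
            (trans (cong ℤ.∣_∣ (neg n≡0)) (ℤ.abs-* (⊝ (t ⊗ + 8)) (+ (m * η)))) , ∣-refl))
          where
          lem₀ : ∀ a x → a ≡ ⊝ x ⊕ (a ⊕ x)
          lem₀ = ring-ℤ
          neg : n ≡ 0 → + odd h ≡ ⊝ (t ⊗ + 8) ⊗ + (m * η)
          neg z = trans (lem₀ (+ odd h) (t ⊗ + 8 ⊗ + (m * η))) (trans
              (cong (_⊕_ (⊝ (t ⊗ + 8 ⊗ + (m * η)))) (trans (sym n≡) (cong +_ z)))
            (trans (ℤ.+-identityʳ (⊝ (t ⊗ + 8 ⊗ + (m * η)))) (ℤ.neg-distribˡ-* (t ⊗ + 8) (+ (m * η)))))
          mη≢1 : n ≡ 0 → m * η ≢ 1
          mη≢1 z e = 8*≢odd h (trans (neg z) (cong (λ x → ⊝ (t ⊗ + 8) ⊗ + x) e))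
            where
            8*≢odd : ∀ h → + odd h ≢ ⊝ (t ⊗ + 8) ⊗ + 1
            8*≢odd h eq = case coprime-2 h (∣-refl , divides (ℤ.∣ ⊝ t ∣ * 4)
                (trans (cong ℤ.∣_∣ (trans eq (trans (ℤ.*-identityʳ _) (ℤ.neg-distribˡ-* t (+ 8)))))
                (trans (ℤ.abs-* (⊝ t) (+ 8)) (sym (*-assoc ℤ.∣ ⊝ t ∣ 4 2))))) of λ ()

open TernaryForms

-- Numbers represented by x² + y² + z² and x² + y² + 3z²

coprime-pred : ∀ {a w m} → w * m ≡ 1 + a → Coprime a m
coprime-pred {a} {w} {m} e {d} (d∣a , d∣m) = ∣1⇒≡1 (∣m+n∣m⇒∣n (subst (d ∣_) (trans e (+-comm 1 a)) (∣n⇒∣m*n w d∣m)) d∣a)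

J-≡1 : ∀ h {x} → x ≡ 1 + odd h → J x h ≡ Sign.+
J-≡1 h {x} e = trans (J-mod x 1 h (trans (cong (_% odd h) e) ([m+n]%n≡m%n 1 (odd h)))) (J-one h)

-- Here k = η = 1 and the class is that of a = m - 1 = 4t + 1. Modulo a one has m ≡ 1, and -1 has
-- symbol + because a ≡ 1 (mod 4).
three-squares : ∀ t → SumForm (+ 1) (+ (4 * t + 2))
three-squares t = subst (λ x → SumForm (+ 1) (+ x)) (+-identityʳ m) (represent (2 * t) c χ+ (divides 1 div) λ _ _ _ ())
  where
  m = 4 * t + 2
  l₁ : ∀ t → 2 * 1 * suc (2 * t) ≡ (4 * t + 2) * 1
  l₁ = ring-ℕ
  l₂ : ∀ t → (4 * t + 2) * 1 ≡ 1 + suc (2 * (2 * t))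
  l₂ = ring-ℕ
  l₃ : ∀ t → 1 * suc (2 * (2 * t)) + 1 ≡ 1 * (4 * t + 2)
  l₃ = ring-ℕ
  open Represent 1 t 1 m 1 ≤-refl (≤-trans (s≤s z≤n) (m≤n+m 2 (4 * t))) ≤-refl (inj₁ refl) (l₁ t)
  c : Coprime (odd (2 * t)) (m * 1)
  c = coprime-pred {odd (2 * t)} {1} (trans (+-identityʳ (m * 1)) (l₂ t))
  χ+ : alt (2 * t) Sign.* J (m * 1) (2 * t) ≡ Sign.+
  χ+ = cong₂ Sign._*_ (alt-2* t) (J-≡1 (2 * t) (l₂ t))
  div : 1 * odd (2 * t) + 1 ≡ 1 * m
  div = l₃ t

⟨_⟩≡1mod3 : ℤ → Set
⟨ x ⟩≡1mod3 = ∃ λ y → x ≡ + 1 ⊕ + 3 ⊗ y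

cofactor-mod3 : ∀ s q → ⟨ s ⊗ s ⊗ q ⟩≡1mod3 → ⟨ q ⟩≡1mod3
cofactor-mod3 s q (y , e) with mod3 s
... | inj₁ (k , refl) = ⊥-elim (3*≢1 (+ 3 ⊗ (k ⊗ k ⊗ q) ⊖ y) (trans (l₁ k q y) (trans (cong (_⊖ + 3 ⊗ y) e) (l₂ y))))
  where l₁ : ∀ k q y → + 3 ⊗ (+ 3 ⊗ (k ⊗ k ⊗ q) ⊖ y) ≡ + 3 ⊗ k ⊗ (+ 3 ⊗ k) ⊗ q ⊖ + 3 ⊗ y
        l₁ = ring-ℤ
        l₂ : ∀ y → + 1 ⊕ + 3 ⊗ y ⊖ + 3 ⊗ y ≡ + 1
        l₂ = ring-ℤ
... | inj₂ (k , ss) = y ⊖ k ⊗ q , trans (l₁ k q) (trans (cong (_⊖ + 3 ⊗ (k ⊗ q)) (trans (cong (_⊗ q) (sym ss)) e))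
    (l₂ y (k ⊗ q)))
  where l₁ : ∀ k q → q ≡ (+ 1 ⊕ + 3 ⊗ k) ⊗ q ⊖ + 3 ⊗ (k ⊗ q)
        l₁ = ring-ℤ
        l₂ : ∀ y z → + 1 ⊕ + 3 ⊗ y ⊖ + 3 ⊗ z ≡ + 1 ⊕ + 3 ⊗ (y ⊖ z)
        l₂ = ring-ℤ

square-mod3 : ∀ x → (∀ k → x ≢ + 3 ⊗ k) → ⟨ x ⊗ x ⟩≡1mod3
square-mod3 x n with mod3 x
... | inj₁ (k , e) = ⊥-elim (n k e)
... | inj₂ p = p

-- With a = odd h and wM ≡ 1 (mod a), the symbol (-3M / a) is (a / 3)(w / a) = 1.
module _ (β l M w h i : ℕ) (δ≡ : Kronecker.m β l ≡ M * 3) (1≤M : 1 ≤ M) (a≡ : w * M ≡ 1 + odd h)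
    (h-odd : alt h ≡ Sign.-)
  (a≡1 : odd h ≡ 1 + 3 * i) (J-w : J w h ≡ Sign.+) (cw : Coprime w (odd h)) (M≢0 : ∀ k → + M ≢ + 3 ⊗ k) where

  sum-3 : SumForm (+ 3) (+ M)
  sum-3 = subst (λ x → SumForm (+ 3) (+ x)) (+-identityʳ M) (represent h c χ+
      (divides w (trans (cong (_+ 1) (*-identityˡ (odd h))) (trans (+-comm (odd h) 1) (sym a≡)))) omits)
    where
    open Represent β l 1 M 3 ≤-refl 1≤M (s≤s z≤n) (inj₂ refl) δ≡
    cM : Coprime (odd h) M
    cM = coprime-pred {odd h} {w} a≡
    c3 : Coprime 3 (odd h)
    c3 {d} (d∣3 , d∣a) = ∣1⇒≡1 (∣m+n∣m⇒∣n (subst (d ∣_) (trans a≡1 (+-comm 1 (3 * i))) d∣a) (∣m⇒∣m*n i d∣3))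
    c : Coprime (odd h) (M * 3)
    c = cop-sym (coprime-* {M} {3} (cop-sym cM) c3)
    J-M : J M h ≡ Sign.+
    J-M = trans (sym (trans (cong (Sign._* J M h) J-w) refl)) (trans (sym (J-* w M h cw (cop-sym cM))) (J-≡1 h a≡))
    -- Reciprocity: (a / 3) = 1 because a ≡ 1 (mod 3), and the remaining sign is - because a ≡ 3
    -- (mod 4).
    J-3 : J 3 h ≡ Sign.-
    J-3 = begin
      J 3 h ≡⟨ sym (Sign.*-identityʳ (J 3 h)) ⟩
      J 3 h Sign.* Sign.+ ≡⟨ cong (J 3 h Sign.*_) (sym (trans (J-mod (odd h) 1 1
          (trans (cong (_% 3) (trans a≡1 (cong (λ x → 1 + x) (*-comm 3 i)))) ([m+kn]%n≡m%n 1 i 3))) refl)) ⟩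
      J 3 h Sign.* J (odd h) 1 ≡⟨ reciprocity h 1 c3 ⟩
      alt (h * 1) ≡⟨ cong alt (*-identityʳ h) ⟩
      alt h ≡⟨ h-odd ⟩
      Sign.- ∎
      where open ≡-Reasoning
    χ+ : alt h Sign.* J (M * 3) h ≡ Sign.+
    χ+ = cong₂ Sign._*_ h-odd (trans (J-* M 3 h (cop-sym cM) c3) (cong₂ Sign._*_ J-M J-3))
    -- From n ≡ a ≡ 1 (mod 3) the cofactor q is also ≡ 1, so `omits-six` applies with p = q and r =
    -- M.
    omits : ∀ n t → + n ≡ + odd h ⊕ t ⊗ + (M * 3) → 1 * 3 ≡ 3 → Omits n
    omits n t n≡ _ s q b′ c′ nsq qc U V W eq with cofactor-mod3 (+ s) (+ q) (+ i ⊕ t ⊗ + M ,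
        trans (sym (trans (cong +_ nsq) (trans (ℤ.pos-* (s * s) q) (cong (_⊗ + q) (ℤ.pos-* s s)))))
            (trans n≡ (trans (cong₂ (λ x y → x ⊕ t ⊗ y) (trans (cong +_ a≡1)
            (trans (ℤ.pos-+ 1 (3 * i)) (cong (_⊕_ (+ 1)) (ℤ.pos-* 3 i)))) (ℤ.pos-* M 3)) (lem (+ i) t (+ M)))))
      where lem : ∀ i t m → + 1 ⊕ + 3 ⊗ i ⊕ t ⊗ (m ⊗ + 3) ≡ + 1 ⊕ + 3 ⊗ (i ⊕ t ⊗ m)
            lem = ring-ℤ
    ... | q′ , q≡ = omits-six (+ q) q′ (+ M) (proj₁ (square-mod3 (+ M) M≢0)) U W V q≡ (proj₂ (square-mod3 (+ M) M≢0))
        (trans (l₁ (+ q) (+ M)) (trans eq (l₂ (+ q) (+ M) U V W)))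
      where
      l₁ : ∀ q m → m ⊗ (q ⊗ + 6) ≡ q ⊗ (m ⊗ + 6)
      l₁ = ring-ℤ
      l₂ : ∀ q m U V W → U ⊗ U ⊕ m ⊗ + 3 ⊗ (V ⊗ V) ⊕ + 1 ⊗ q ⊗ (W ⊗ W) ≡ U ⊗ U ⊕ q ⊗ (W ⊗ W) ⊕ + 3 ⊗ m ⊗ (V ⊗ V)
      l₂ = ring-ℤ

not-3* : ∀ M j r → + M ≡ + r ⊕ + 3 ⊗ j → r ≡ 1 ⊎ r ≡ 2 → ∀ k → + M ≢ + 3 ⊗ k
not-3* M j r e r12 k e′ = go r12 (trans (l₁ k j) (trans (cong (_⊖ + 3 ⊗ j) (trans (sym e′) e)) (l₂ (+ r) (+ 3 ⊗ j))))
  where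
  l₁ : ∀ k j → + 3 ⊗ (k ⊖ j) ≡ + 3 ⊗ k ⊖ + 3 ⊗ j
  l₁ = ring-ℤ
  l₂ : ∀ r x → r ⊕ x ⊖ x ≡ r
  l₂ = ring-ℤ
  go : r ≡ 1 ⊎ r ≡ 2 → + 3 ⊗ (k ⊖ j) ≡ + r → ⊥
  go (inj₁ refl) = 3*≢1 (k ⊖ j)
  go (inj₂ refl) = 3*≢2 (k ⊖ j)

-- The multiplier w = 8 puts a = 8M - 1 into the class 1 (mod 3), as M ≡ 1, and into 7 (mod 8),
-- where 2 and therefore 8 has symbol +.
sum-3-even : ∀ t → SumForm (+ 3) (+ (12 * t + 10))
sum-3-even t = sum-3 1 (9 * t + 7) M 8 h (32 * t + 26) (l₁ t) (≤-trans (s≤s z≤n) (m≤n+m 10 (12 * t))) (l₂ t)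
    (trans (cong alt (l₄ t)) (cong (Sign.- Sign.*_) (alt-2* (24 * t + 19)))) (l₃ t) J-8 c8
    (not-3* M (+ (4 * t + 3)) 1 (trans (cong +_ (l₅ t)) (trans (ℤ.pos-+ 1 (3 * (4 * t + 3)))
        (cong (_⊕_ (+ 1)) (ℤ.pos-* 3 (4 * t + 3))))) (inj₁ refl))
  where
  M = 12 * t + 10
  h = 48 * t + 39
  l₁ : ∀ t → 2 * 1 * suc (2 * (9 * t + 7)) ≡ (12 * t + 10) * 3
  l₁ = ring-ℕ
  l₂ : ∀ t → 8 * (12 * t + 10) ≡ 1 + suc (2 * (48 * t + 39))
  l₂ = ring-ℕ
  l₃ : ∀ t → suc (2 * (48 * t + 39)) ≡ 1 + 3 * (32 * t + 26)
  l₃ = ring-ℕ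
  l₄ : ∀ t → 48 * t + 39 ≡ suc (2 * (24 * t + 19))
  l₄ = ring-ℕ
  l₅ : ∀ t → 12 * t + 10 ≡ 1 + 3 * (4 * t + 3)
  l₅ = ring-ℕ
  l₆ : ∀ t → 48 * t + 39 ≡ 3 + 4 * (12 * t + 9)
  l₆ = ring-ℕ
  c2 = coprime-2 h
  c4 = coprime-* {2} {2} c2 c2
  c8 = coprime-* {2} {4} c2 c4
  J-8 : J 8 h ≡ Sign.+
  J-8 = trans (J-* 2 4 h c2 c4) (cong₂ Sign._*_ (trans (J-2 h) (trans (cong second (l₆ t)) (second-+4 (12 * t + 9) 3)))
      (J-square 2 h c2))

-- As M ≡ 2 (mod 3), a = 4M - 1 is ≡ 1 (mod 3); the multiplier 4 is a square, so its symbol is +.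
sum-3-odd : ∀ t → SumForm (+ 3) (+ (24 * t + 23))
sum-3-odd t = sum-3 0 (36 * t + 34) M 4 h (32 * t + 30) (l₁ t) (≤-trans (s≤s z≤n) (m≤n+m 23 (24 * t))) (l₂ t)
    (trans (cong alt (l₄ t)) (cong (Sign.- Sign.*_) (alt-2* (24 * t + 22)))) (l₃ t) (J-square 2 h c2)
        (coprime-* {2} {2} c2 c2)
    (not-3* M (+ (8 * t + 7)) 2 (trans (cong +_ (l₅ t)) (trans (ℤ.pos-+ 2 (3 * (8 * t + 7)))
        (cong (_⊕_ (+ 2)) (ℤ.pos-* 3 (8 * t + 7))))) (inj₂ refl))
  where
  M = 24 * t + 23
  h = 48 * t + 45
  l₁ : ∀ t → 1 * suc (2 * (36 * t + 34)) ≡ (24 * t + 23) * 3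
  l₁ = ring-ℕ
  l₂ : ∀ t → 4 * (24 * t + 23) ≡ 1 + suc (2 * (48 * t + 45))
  l₂ = ring-ℕ
  l₃ : ∀ t → suc (2 * (48 * t + 45)) ≡ 1 + 3 * (32 * t + 30)
  l₃ = ring-ℕ
  l₄ : ∀ t → 48 * t + 45 ≡ suc (2 * (24 * t + 22))
  l₄ = ring-ℕ
  l₅ : ∀ t → 24 * t + 23 ≡ 2 + 3 * (8 * t + 7)
  l₅ = ring-ℕ
  c2 = coprime-2 h

-- Now the 3 of the determinant is k instead of η. The class a = (4M - 1) / 3 satisfies 3a + 1 = 4M
-- and a ≡ 1 (mod 4), and (M / a) = (4M / a) = 1. In `omits-six` the parts of M and q are exchanged.
sum-3-triple : ∀ t → SumForm (+ 3) (+ (3 * (24 * t + 22)))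
sum-3-triple t = represent h c χ+ (divides 4 (l₃ t)) omits
  where
  M = 24 * t + 22
  h = 16 * t + 14
  l₁ : ∀ t → 2 * 1 * suc (2 * (6 * t + 5)) ≡ (24 * t + 22) * 1
  l₁ = ring-ℕ
  l₃ : ∀ t → 3 * suc (2 * (16 * t + 14)) + 1 ≡ 4 * (24 * t + 22)
  l₃ = ring-ℕ
  l₄ : ∀ t → 16 * t + 14 ≡ 2 * (8 * t + 7)
  l₄ = ring-ℕ
  l₅ : ∀ t → 24 * t + 22 ≡ 1 + 3 * (8 * t + 7)
  l₅ = ring-ℕ
  l₆ : ∀ t → 4 * (24 * t + 22) ≡ 1 + 3 * suc (2 * (16 * t + 14))
  l₆ = ring-ℕ
  open Represent 1 (6 * t + 5) 3 M 1 (s≤s z≤n) (≤-trans (s≤s z≤n) (m≤n+m 22 (24 * t))) ≤-refl (inj₂ refl) (l₁ t)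
  c2 = coprime-2 h
  c4 = coprime-* {2} {2} c2 c2
  cM : Coprime M (odd h)
  cM = cop-sym (λ {d} (d∣a , d∣M) → ∣1⇒≡1 (∣m+n∣m⇒∣n (subst (d ∣_) (trans (l₆ t) (+-comm 1 (3 * odd h)))
      (∣n⇒∣m*n 4 d∣M)) (∣n⇒∣m*n 3 d∣a)))
  c : Coprime (odd h) (M * 1)
  c = subst (Coprime (odd h)) (sym (*-identityʳ M)) (cop-sym cM)
  χ+ : alt h Sign.* J (M * 1) h ≡ Sign.+
  χ+ = cong₂ Sign._*_ (trans (cong alt (l₄ t)) (alt-2* (8 * t + 7))) (begin
    J (M * 1) h ≡⟨ cong (λ x → J x h) (*-identityʳ M) ⟩
    J M h ≡⟨ sym (trans (J-* 4 M h c4 cM) (cong (Sign._* J M h) (J-square 2 h c2))) ⟩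
    J (4 * M) h ≡⟨ J-mod (4 * M) 1 h (trans (cong (_% odd h) (l₆ t)) ([m+kn]%n≡m%n 1 3 (odd h))) ⟩
    J 1 h ≡⟨ J-one h ⟩
    Sign.+ ∎)
    where open ≡-Reasoning
  p′ = + (8 * t + 7)
  M≡ : + M ≡ + 1 ⊕ + 3 ⊗ p′
  M≡ = trans (cong +_ (l₅ t)) (trans (ℤ.pos-+ 1 (3 * (8 * t + 7))) (cong (_⊕_ (+ 1)) (ℤ.pos-* 3 (8 * t + 7))))
  omits : ∀ n u → + n ≡ + odd h ⊕ u ⊗ + (M * 1) → 3 * 1 ≡ 3 → Omits n
  omits n u n≡ _ s q b c nsq qc U V W eq = omits-six (+ M) p′ (+ q) (proj₁ qq) U V W M≡ (proj₂ qq)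
      (trans eq (cong (λ x → U ⊗ U ⊕ x ⊗ (V ⊗ V) ⊕ + 3 ⊗ + q ⊗ (W ⊗ W)) (ℤ.*-identityʳ (+ M))))
    where
    -- If 3 divided q, then b² + M ≡ b² + 1 would vanish modulo 3.
    impossible : ∀ k → + q ≢ + 3 ⊗ k
    impossible k q≡ = 3*≢1 (proj₁ third) (proj₂ third)
      where
      eq′ : b ⊗ b ⊕ + 1 ⊗ + 1 ≡ + 3 ⊗ (k ⊗ c ⊖ p′)
      eq′ = trans (l₇ (b ⊗ b) p′) (trans (cong (λ z → b ⊗ b ⊕ z ⊗ + 1 ⊖ + 3 ⊗ p′) (sym M≡))
          (trans (cong (_⊖ + 3 ⊗ p′) (trans (sym qc) (cong (_⊗ c) q≡))) (l₈ k c p′)))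
        where
        l₇ : ∀ x p → x ⊕ + 1 ⊗ + 1 ≡ x ⊕ (+ 1 ⊕ + 3 ⊗ p) ⊗ + 1 ⊖ + 3 ⊗ p
        l₇ = ring-ℤ
        l₈ : ∀ k c p → + 3 ⊗ k ⊗ c ⊖ + 3 ⊗ p ≡ + 3 ⊗ (k ⊗ c ⊖ p)
        l₈ = ring-ℤ
      third : ∃ λ y → + 3 ⊗ y ≡ + 1
      third = let (y , e) = proj₂ (anisotropic b (+ 1) (k ⊗ c ⊖ p′) eq′) in y , sym e
    qq = square-mod3 (+ q) impossible

-- The eleven tuples

module _ (N : ℕ) .{{_ : NonZero N}} (α β γ r : ℕ) where
  Table : (ℕ → ℕ → ℕ → Set) → Set
  Table P = ∀ {i} → i < N → ∀ {j} → j < N → ∀ {k} → k < N → (α * (i * i) + β * (j * j) + γ * (k * k)) % N ≡ r → P i j k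

  table? : ∀ {P} → (∀ i j k → Dec (P i j k)) → Dec (Table P)
  table? P? = allUpTo? (λ i → allUpTo? (λ j → allUpTo? (λ k → ((α * (i * i) + β * (j * j) + γ * (k * k)) % N ≟ r) →-dec
      P? i j k) N) N) N

  table-lookup : ∀ {P M} x y z → Table P → M ≡ α * (x * x) + β * (y * y) + γ * (z * z) → ∀ c k → M ≡ c + k * N → c % N ≡
      r → P (x % N) (y % N) (z % N)
  table-lookup {P} {M} x y z t e c k e′ cr = t (m%n<n x N) (m%n<n y N) (m%n<n z N)
      (trans (sym reduce) (trans (cong (_% N) (trans (sym e) e′)) (trans ([m+kn]%n≡m%n c k N) cr)))
    where
    lem : ∀ n α β γ i a j b k c → α * ((i + a * n) * (i + a * n)) + β * ((j + b * n) * (j + b * n)) + γ *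
        ((k + c * n) * (k + c * n))
      ≡ (α * (i * i) + β * (j * j) + γ * (k * k)) + (α * (2 * i * a + a * a * n) + β * (2 * j * b + b * b * n) + γ *
          (2 * k * c + c * c * n)) * n
    lem = ring-ℕ
    i = x % N
    j = y % N
    l = z % N
    reduce : (α * (x * x) + β * (y * y) + γ * (z * z)) % N ≡ (α * (i * i) + β * (j * j) + γ * (l * l)) % N
    reduce = trans (cong (_% N) (trans (cong₂ _+_ (cong₂ _+_ (cong (λ t → α * (t * t)) (m≡m%n+[m/n]*n x N))
        (cong (λ t → β * (t * t)) (m≡m%n+[m/n]*n y N))) (cong (λ t → γ * (t * t)) (m≡m%n+[m/n]*n z N)))
      (lem N α β γ i (x / N) j (y / N) l (z / N)))) ([m+kn]%n≡m%n (α * (i * i) + β * (j * j) + γ * (l * l))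
          (α * (2 * i * (x / N) + x / N * (x / N) * N) + β * (2 * j * (y / N) + y / N * (y / N) * N) + γ *
          (2 * l * (z / N) + z / N * (z / N) * N)) N)

Rep : (α β γ M : ℕ) → Set
Rep α β γ M = ∃ λ x → ∃ λ y → ∃ λ z → M ≡ α * (x * x) + β * (y * y) + γ * (z * z)

cast-rep : ∀ {α β γ M} X Y Z → M ≡ α * X + β * Y + γ * Z → + M ≡ + α ⊗ + X ⊕ + β ⊗ + Y ⊕ + γ ⊗ + Z
cast-rep {α} {β} {γ} X Y Z e = trans (cong +_ e) (trans (ℤ.pos-+ (α * X + β * Y) (γ * Z))
    (cong₂ _⊕_ (trans (ℤ.pos-+ (α * X) (β * Y)) (cong₂ _⊕_ (ℤ.pos-* α X) (ℤ.pos-* β Y))) (ℤ.pos-* γ Z)))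

rep-abs : ∀ {α β γ M} x y z → + M ≡ + α ⊗ (x ⊗ x) ⊕ + β ⊗ (y ⊗ y) ⊕ + γ ⊗ (z ⊗ z) →
  M ≡ α * (ℤ.∣ x ∣ * ℤ.∣ x ∣) + β * (ℤ.∣ y ∣ * ℤ.∣ y ∣) + γ * (ℤ.∣ z ∣ * ℤ.∣ z ∣)
rep-abs {α} {β} {γ} {M} x y z e = ℤ.+-injective (trans e (trans
    (cong₂ _⊕_ (cong₂ _⊕_ (cong (_⊗_ (+ α)) (square-abs x)) (cong (_⊗_ (+ β)) (square-abs y)))
    (cong (_⊗_ (+ γ)) (square-abs z)))
  (sym (cast-rep {α} {β} {γ} (ℤ.∣ x ∣ * ℤ.∣ x ∣) (ℤ.∣ y ∣ * ℤ.∣ y ∣) (ℤ.∣ z ∣ * ℤ.∣ z ∣) refl))))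

sum-rep : ∀ {t M} → SumForm (+ t) (+ M) → Rep 1 1 t M
sum-rep {t} (x , y , z , e) = ℤ.∣ x ∣ , ℤ.∣ y ∣ , ℤ.∣ z ∣ , rep-abs {1} {1} {t} x y z
    (trans e (cong₂ (λ a b → a ⊕ b ⊕ + t ⊗ (z ⊗ z)) (sym (ℤ.*-identityˡ (x ⊗ x))) (sym (ℤ.*-identityˡ (y ⊗ y)))))

SquareOf : ℕ → ℕ → ℕ → Set
SquareOf N ρ X = ∃ λ x → (+ N ⊗ x ⊕ + ρ) ⊗ (+ N ⊗ x ⊕ + ρ) ≡ + (X * X)

-- Only the square of X matters, so its sign is free and X ≡ -ρ is as good as X ≡ ρ.
square-of : ∀ N .{{_ : NonZero N}} ρ → ρ ≤ N → ∀ X → X % N ≡ ρ ⊎ X % N ≡ N ∸ ρ → SquareOf N ρ X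
square-of N ρ ρ≤N X (inj₁ e) = + (X / N) , trans (cong₂ _⊗_ eq eq) (sym (ℤ.pos-* X X))
  where
  eq : + N ⊗ + (X / N) ⊕ + ρ ≡ + X
  eq = trans (cong (_⊕ + ρ) (sym (ℤ.pos-* N (X / N)))) (trans (sym (ℤ.pos-+ (N * (X / N)) ρ))
      (cong +_ (trans (+-comm (N * (X / N)) ρ) (trans (cong₂ _+_ (sym e) (*-comm N (X / N)))
      (sym (m≡m%n+[m/n]*n X N))))))
square-of N ρ ρ≤N X (inj₂ e) = ⊝ + suc (X / N) , trans (lem (+ N) (+ suc (X / N)) (+ ρ))
    (trans (cong₂ _⊗_ eq eq) (sym (ℤ.pos-* X X)))
  where
  lem : ∀ n k r → (n ⊗ (⊝ k) ⊕ r) ⊗ (n ⊗ (⊝ k) ⊕ r) ≡ (n ⊗ k ⊖ r) ⊗ (n ⊗ k ⊖ r)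
  lem = ring-ℤ
  add : ∀ x y → x ≡ x ⊕ y ⊖ y
  add = ring-ℤ
  eq : + N ⊗ + suc (X / N) ⊖ + ρ ≡ + X
  eq = trans (cong (_⊖ + ρ) (trans (sym (ℤ.pos-* N (suc (X / N)))) (trans (cong +_ key) (ℤ.pos-+ X ρ))))
      (sym (add (+ X) (+ ρ)))
    where
    key : N * suc (X / N) ≡ X + ρ
    key = begin
      N * suc (X / N) ≡⟨ *-comm N (suc (X / N)) ⟩
      N + X / N * N ≡⟨ cong (_+ X / N * N) (sym (m∸n+n≡m ρ≤N)) ⟩
      N ∸ ρ + ρ + X / N * N ≡⟨ l (N ∸ ρ) ρ (X / N * N) ⟩
      N ∸ ρ + X / N * N + ρ ≡⟨ cong (λ y → y + X / N * N + ρ) (sym e) ⟩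
      X % N + X / N * N + ρ ≡⟨ cong (_+ ρ) (sym (m≡m%n+[m/n]*n X N)) ⟩
      X + ρ ∎
      where open ≡-Reasoning
            l : ∀ a b c → a + b + c ≡ a + c + b
            l = ring-ℕ

Three∤ : ℕ → Set
Three∤ X = X % 3 ≢ 0

Odd : ℕ → Set
Odd X = X % 2 ≡ 1

unit-3 : ∀ X → Three∤ X → SquareOf 3 1 X
unit-3 X h = square-of 3 1 (s≤s z≤n) X (from-yes (allUpTo? (λ i → ¬? (i ≟ 0) →-dec ((i ≟ 1) ⊎-dec (i ≟ 2))) 3)
    (m%n<n X 3) h)

unit-4 : ∀ X → Odd X → SquareOf 4 1 X
unit-4 X o = square-of 4 1 (s≤s z≤n) X (from-yes (allUpTo? (λ i → (i % 2 ≟ 1) →-dec ((i ≟ 1) ⊎-dec (i ≟ 3))) 4)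
    (m%n<n X 4) (trans (m∣n⇒o%n%m≡o%m 2 4 X (divides 2 refl)) o))

unit-6 : ∀ X → Odd X → Three∤ X → SquareOf 6 1 X
unit-6 X o h = square-of 6 1 (s≤s z≤n) X (from-yes (allUpTo? (λ i → (i % 2 ≟ 1) →-dec
    (¬? (i % 3 ≟ 0) →-dec ((i ≟ 1) ⊎-dec (i ≟ 5)))) 6) (m%n<n X 6)
  (trans (m∣n⇒o%n%m≡o%m 2 6 X (divides 3 refl)) o) (h ∘ trans (sym (m∣n⇒o%n%m≡o%m 3 6 X (divides 2 refl)))))

half-of : ∀ X → X % 2 ≡ 0 → X ≡ 2 * (X / 2)
half-of X e = trans (m≡m%n+[m/n]*n X 2) (trans (cong (_+ X / 2 * 2) e) (*-comm (X / 2) 2))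

%-via : ∀ k m X {r} .{{_ : NonZero m}} .{{_ : NonZero (k * m)}} → X % (k * m) % m ≡ r → X % m ≡ r
%-via k m X e = trans (sym (m∣n⇒o%n%m≡o%m m (k * m) X (n∣m*n k))) e

three∤-* : ∀ c x y .{{_ : NonZero c}} → x ≡ c * y → Three∤ x → Three∤ y
three∤-* c x y e h z = h (trans (cong (_% 3) e) (n∣m⇒m%n≡0 (c * y) 3 (∣n⇒∣m*n c (m%n≡0⇒n∣m y 3 z))))

conclude : ∀ K .{{_ : NonZero K}} c n {S R} → + (2 * K * n + c) ≡ R → + K ⊗ S ⊕ + c ≡ R → + 2 ⊗ + n ≡ S
conclude K@(suc _) c n {S} {R} e e′ = ℤ.*-cancelˡ-≡ (+ K) _ _ (trans (lem₁ (+ K) (+ n) (+ c)) (trans (cong (_⊖ + c)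
    (trans (sym (trans (ℤ.pos-+ (2 * K * n) c) (cong (_⊕ + c) (trans (ℤ.pos-* (2 * K) n)
        (cong (_⊗ + n) (ℤ.pos-* 2 K)))))) (trans e (sym e′)))) (lem₂ (+ K ⊗ S) (+ c))))
  where
  lem₁ : ∀ k n c → k ⊗ (+ 2 ⊗ n) ≡ + 2 ⊗ k ⊗ n ⊕ c ⊖ c
  lem₁ = ring-ℤ
  lem₂ : ∀ x c → x ⊕ c ⊖ c ≡ x
  lem₂ = ring-ℤ

half-sum : ∀ u v → u % 2 ≡ v % 2 → ∃ λ x → ∃ λ y → u * u + v * v ≡ 2 * (x * x + y * y)
half-sum u v e = case ≤-total v u of λ
  { (inj₁ v≤u) → let x , y , eq = ordered u v v≤u e in x , y , eq
  ; (inj₂ u≤v) → let x , y , eq = ordered v u u≤v (sym e) in x , y , trans (+-comm (u * u) (v * v)) eq }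
  where
  ordered : ∀ u v → v ≤ u → u % 2 ≡ v % 2 → ∃ λ x → ∃ λ y → u * u + v * v ≡ 2 * (x * x + y * y)
  ordered u v v≤u e = v + t , t , trans (cong (λ u → u * u + v * v) u≡) (lem v t)
    where
    t = u / 2 ∸ v / 2
    u≡ : u ≡ v + 2 * t
    u≡ = begin
      u ≡⟨ m≡m%n+[m/n]*n u 2 ⟩
      u % 2 + u / 2 * 2 ≡⟨ cong₂ (λ a b → a + b * 2) e (sym (m+[n∸m]≡n (/-monoˡ-≤ 2 v≤u))) ⟩
      v % 2 + (v / 2 + t) * 2 ≡⟨ l (v % 2) (v / 2) t ⟩
      v % 2 + v / 2 * 2 + 2 * t ≡⟨ cong (_+ 2 * t) (sym (m≡m%n+[m/n]*n v 2)) ⟩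
      v + 2 * t ∎
      where open ≡-Reasoning
            l : ∀ a b t → a + (b + t) * 2 ≡ a + b * 2 + 2 * t
            l = ring-ℕ
    lem : ∀ v t → (v + 2 * t) * (v + 2 * t) + v * v ≡ 2 * ((v + t) * (v + t) + t * t)
    lem = ring-ℕ

-- Tuples from x² + y² + 3z² = 12n + 10

Senary : ℕ → Set
Senary n = ∃ λ x → ∃ λ y → ∃ λ z → 6 * n + 5 ≡ 4 * (x * x) + 1 * (y * y) + 6 * (z * z) × Odd y × Three∤ x × Three∤ y

-- In 12n + 10 = u² + v² + 3w², u and v have equal parity and w is even. Passing to (u ± v) / 2 and
-- w / 2 gives 6n + 5 = x² + y² + 6z², where exactly one of x and y is even and, modulo 3, neither
-- vanishes.
senary : ∀ n → Senary n
senary n = start (sum-rep {3} (sum-3-even n))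
  where
  table₄ : Table 4 1 1 3 2 λ i j k → i % 2 ≡ j % 2 × k % 2 ≡ 0
  table₄ = from-yes (table? 4 1 1 3 2 λ i j k → (i % 2 ≟ j % 2) ×-dec (k % 2 ≟ 0))
  table₂ : Table 2 1 1 6 1 λ i j k → (i ≡ 0 × j ≡ 1) ⊎ (j ≡ 0 × i ≡ 1)
  table₂ = from-yes (table? 2 1 1 6 1 λ i j k → ((i ≟ 0) ×-dec (j ≟ 1)) ⊎-dec ((j ≟ 0) ×-dec (i ≟ 1)))
  table₃ : Table 3 1 1 6 2 λ i j k → i ≢ 0 × j ≢ 0
  table₃ = from-yes (table? 3 1 1 6 2 λ i j k → ¬? (i ≟ 0) ×-dec ¬? (j ≟ 0))
  l₁ : ∀ n → 12 * n + 10 ≡ 2 + (3 * n + 2) * 4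
  l₁ = ring-ℕ
  l₂ : ∀ n → 6 * n + 5 ≡ 1 + (3 * n + 2) * 2
  l₂ = ring-ℕ
  l₃ : ∀ n → 6 * n + 5 ≡ 2 + (2 * n + 1) * 3
  l₃ = ring-ℕ
  pick : ∀ x y z → x % 2 ≡ 0 → Odd y → Three∤ x × Three∤ y → 6 * n + 5 ≡ 1 * (x * x) + 1 * (y * y) + 6 * (z * z) →
      Senary n
  pick x y z xe yo (x3 , y3) e = x / 2 , y , z , trans e (cong (λ t → t + 1 * (y * y) + 6 * (z * z))
      (trans (cong (λ t → 1 * (t * t)) (half-of x xe)) (l₄ (x / 2)))) , yo , three∤-* 2 x (x / 2) (half-of x xe) x3 , y3
    where l₄ : ∀ h → 1 * (2 * h * (2 * h)) ≡ 4 * (h * h)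
          l₄ = ring-ℕ
  order : ∀ x y z → 6 * n + 5 ≡ 1 * (x * x) + 1 * (y * y) + 6 * (z * z) → Senary n
  order x y z e = choose (table-lookup 2 1 1 6 1 x y z table₂ e 1 (3 * n + 2) (l₂ n) refl)
    where
    nz : Three∤ x × Three∤ y
    nz = table-lookup 3 1 1 6 2 x y z table₃ e 2 (2 * n + 1) (l₃ n) refl
    swap′ : ∀ a b c → 1 * a + 1 * b + c ≡ 1 * b + 1 * a + c
    swap′ = ring-ℕ
    choose : (x % 2 ≡ 0 × y % 2 ≡ 1) ⊎ (y % 2 ≡ 0 × x % 2 ≡ 1) → Senary n
    choose (inj₁ (a , b)) = pick x y z a b nz e
    choose (inj₂ (a , b)) = pick y x z a b (swap nz) (trans e (swap′ (x * x) (y * y) (6 * (z * z))))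
  start : Rep 1 1 3 (12 * n + 10) → Senary n
  start (u , v , w , e) = join (half-sum u v (%-via 2 2 u (trans (proj₁ parities)
      (m∣n⇒o%n%m≡o%m 2 4 v (divides 2 refl)))))
    where
    parities : u % 4 % 2 ≡ v % 4 % 2 × w % 4 % 2 ≡ 0
    parities = table-lookup 4 1 1 3 2 u v w table₄ e 2 (3 * n + 2) (l₁ n) refl
    z = w / 2
    join : (∃ λ x → ∃ λ y → u * u + v * v ≡ 2 * (x * x + y * y)) → Senary n
    join (x , y , hs) = order x y z (*-cancelˡ-≡ _ _ 2 (trans (l₅ n)
        (trans e (trans (cong (_+ 3 * (w * w)) (trans (l₆ (u * u) (v * v)) hs))
        (trans (cong (λ t → 2 * (x * x + y * y) + 3 * (t * t)) (half-of w (%-via 2 2 w (proj₂ parities))))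
            (l₇ (x * x) (y * y) z))))))
      where
      l₅ : ∀ n → 2 * (6 * n + 5) ≡ 12 * n + 10
      l₅ = ring-ℕ
      l₆ : ∀ a b → 1 * a + 1 * b ≡ a + b
      l₆ = ring-ℕ
      l₇ : ∀ a b z → 2 * (a + b) + 3 * (2 * z * (2 * z)) ≡ 2 * (1 * a + 1 * b + 6 * (z * z))
      l₇ = ring-ℕ

unit-1 : ∀ X → SquareOf 1 0 X
unit-1 X = square-of 1 0 z≤n X (inj₁ (n%1≡0 X))

module _ (K c α β γ N₁ ρ₁ N₂ ρ₂ N₃ ρ₃ : ℕ) where
  Source : ℕ → Set
  Source n = ∃ λ X → ∃ λ Y → ∃ λ Z → 2 * K * n + c ≡ α * (X * X) + β * (Y * Y) + γ * (Z * Z) ×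
    SquareOf N₁ ρ₁ X × SquareOf N₂ ρ₂ Y × SquareOf N₃ ρ₃ Z

  square : ℕ → ℕ → ℤ → ℤ
  square N ρ x = (+ N ⊗ x ⊕ + ρ) ⊗ (+ N ⊗ x ⊕ + ρ)

  -- Multiplying by K and adding c completes all three squares at once. The pairs N, ρ are the
  -- residue classes in which the square roots then have to lie, up to sign.
  universal : ∀ a₁ a₂ b₁ b₂ c₁ c₂ .{{_ : NonZero K}} → (∀ n → Source n) →
    (∀ x y z → + K ⊗ (numer a₁ a₂ x ⊕ numer b₁ b₂ y ⊕ numer c₁ c₂ z) ⊕ + c ≡ + α ⊗ square N₁ ρ₁ x ⊕ + β ⊗ square N₂ ρ₂ y
        ⊕ + γ ⊗ square N₃ ρ₃ z) →
    Universal a₁ a₂ b₁ b₂ c₁ c₂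
  universal a₁ a₂ b₁ b₂ c₁ c₂ source identity n = go (source n)
    where
    go : Source n → ∃ λ x → ∃ λ y → ∃ λ z → + 2 ⊗ + n ≡ numer a₁ a₂ x ⊕ numer b₁ b₂ y ⊕ numer c₁ c₂ z
    go (X , Y , Z , e , (x , ex) , (y , ey) , (z , ez)) = x , y , z , conclude K c n
        (cast-rep {α} {β} {γ} (X * X) (Y * Y) (Z * Z) e)
      (trans (identity x y z) (cong₂ _⊕_ (cong₂ _⊕_ (cong (_⊗_ (+ α)) ex) (cong (_⊗_ (+ β)) ey)) (cong (_⊗_ (+ γ)) ez)))

tuple-11 : Universal (+ 12) (+ 8) (+ 12) (+ 4) (+ 2) (+ 0)
tuple-11 = universal 3 5 4 1 6 3 1 6 1 1 0 (+ 12) (+ 8) (+ 12) (+ 4) (+ 2) (+ 0) (λ n → source n (senary n)) lem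
  where
  source : ∀ n → Senary n → Source 3 5 4 1 6 3 1 6 1 1 0 n
  source n (X , Y , Z , e , yo , x3 , y3) = X , Y , Z , e , unit-3 X x3 , unit-6 Y yo y3 , unit-1 Z
  lem : ∀ x y z → + 3 ⊗ (x ⊗ (+ 12 ⊗ x ⊕ + 8) ⊕ y ⊗ (+ 12 ⊗ y ⊕ + 4) ⊕ z ⊗ (+ 2 ⊗ z ⊕ + 0)) ⊕ + 5
    ≡ + 4 ⊗ ((+ 3 ⊗ x ⊕ + 1) ⊗ (+ 3 ⊗ x ⊕ + 1)) ⊕ + 1 ⊗ ((+ 6 ⊗ y ⊕ + 1) ⊗ (+ 6 ⊗ y ⊕ + 1)) ⊕ + 6 ⊗
        ((+ 1 ⊗ z ⊕ + 0) ⊗ (+ 1 ⊗ z ⊕ + 0))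
  lem = ring-ℤ

-- `senary` at 4n gives 24n + 5, whose residue modulo 8 forces X odd and Z even. In the same way
-- `tuple-6` and `tuple-10` use the indices 4n + 2 and 4n + 3, where X comes out even.
tuple-1 : Universal (+ 12) (+ 4) (+ 3) (+ 1) (+ 2) (+ 0)
tuple-1 = universal 12 5 4 1 24 6 1 6 1 1 0 (+ 12) (+ 4) (+ 3) (+ 1) (+ 2) (+ 0) (λ n → source n (senary (4 * n))) lem
  where
  table₈ : Table 8 4 1 6 5 λ i j k → i % 2 ≡ 1 × k % 2 ≡ 0
  table₈ = from-yes (table? 8 4 1 6 5 λ i j k → (i % 2 ≟ 1) ×-dec (k % 2 ≟ 0))
  l₁ : ∀ n → 6 * (4 * n) + 5 ≡ 5 + (3 * n) * 8
  l₁ = ring-ℕ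
  l₂ : ∀ n → 24 * n + 5 ≡ 6 * (4 * n) + 5
  l₂ = ring-ℕ
  l₃ : ∀ z → 6 * (2 * z * (2 * z)) ≡ 24 * (z * z)
  l₃ = ring-ℕ
  source : ∀ n → Senary (4 * n) → Source 12 5 4 1 24 6 1 6 1 1 0 n
  source n (X , Y , Z , e , yo , x3 , y3) = X , Y , Z / 2 ,
      trans (l₂ n) (trans e (cong (λ t → 4 * (X * X) + 1 * (Y * Y) + t)
          (trans (cong (λ t → 6 * (t * t)) (half-of Z (%-via 4 2 Z (proj₂ p)))) (l₃ (Z / 2))))) ,
      unit-6 X (%-via 4 2 X (proj₁ p)) x3 , unit-6 Y yo y3 , unit-1 (Z / 2)
    where
    p : X % 8 % 2 ≡ 1 × Z % 8 % 2 ≡ 0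
    p = table-lookup 8 4 1 6 5 X Y Z table₈ e 5 (3 * n) (l₁ n) refl
  lem : ∀ x y z → + 12 ⊗ (x ⊗ (+ 12 ⊗ x ⊕ + 4) ⊕ y ⊗ (+ 3 ⊗ y ⊕ + 1) ⊕ z ⊗ (+ 2 ⊗ z ⊕ + 0)) ⊕ + 5
    ≡ + 4 ⊗ ((+ 6 ⊗ x ⊕ + 1) ⊗ (+ 6 ⊗ x ⊕ + 1)) ⊕ + 1 ⊗ ((+ 6 ⊗ y ⊕ + 1) ⊗ (+ 6 ⊗ y ⊕ + 1)) ⊕ + 24 ⊗
        ((+ 1 ⊗ z ⊕ + 0) ⊗ (+ 1 ⊗ z ⊕ + 0))
  lem = ring-ℤ

tuple-6 : Universal (+ 12) (+ 8) (+ 3) (+ 1) (+ 2) (+ 0)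
tuple-6 = universal 12 17 16 1 24 3 1 6 1 1 0 (+ 12) (+ 8) (+ 3) (+ 1) (+ 2) (+ 0) (λ n → source n (senary (4 * n + 2)))
    lem
  where
  table₈ : Table 8 4 1 6 1 λ i j k → i % 2 ≡ 0 × k % 2 ≡ 0
  table₈ = from-yes (table? 8 4 1 6 1 λ i j k → (i % 2 ≟ 0) ×-dec (k % 2 ≟ 0))
  l₁ : ∀ n → 6 * (4 * n + 2) + 5 ≡ 1 + (3 * n + 2) * 8
  l₁ = ring-ℕ
  l₂ : ∀ n → 24 * n + 17 ≡ 6 * (4 * n + 2) + 5
  l₂ = ring-ℕ
  l₃ : ∀ x b z → 4 * (2 * x * (2 * x)) + 1 * b + 6 * (2 * z * (2 * z)) ≡ 16 * (x * x) + 1 * b + 24 * (z * z)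
  l₃ = ring-ℕ
  source : ∀ n → Senary (4 * n + 2) → Source 12 17 16 1 24 3 1 6 1 1 0 n
  source n (X , Y , Z , e , yo , x3 , y3) = X / 2 , Y , Z / 2 ,
      trans (l₂ n) (trans e (trans (cong₂ (λ s t → 4 * (s * s) + 1 * (Y * Y) + 6 * (t * t)) X≡
          (half-of Z (%-via 4 2 Z (proj₂ p)))) (l₃ (X / 2) (Y * Y) (Z / 2)))) ,
      unit-3 (X / 2) (three∤-* 2 X (X / 2) X≡ x3) , unit-6 Y yo y3 , unit-1 (Z / 2)
    where
    p : X % 8 % 2 ≡ 0 × Z % 8 % 2 ≡ 0
    p = table-lookup 8 4 1 6 1 X Y Z table₈ e 1 (3 * n + 2) (l₁ n) refl
    X≡ : X ≡ 2 * (X / 2)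
    X≡ = half-of X (%-via 4 2 X (proj₁ p))
  lem : ∀ x y z → + 12 ⊗ (x ⊗ (+ 12 ⊗ x ⊕ + 8) ⊕ y ⊗ (+ 3 ⊗ y ⊕ + 1) ⊕ z ⊗ (+ 2 ⊗ z ⊕ + 0)) ⊕ + 17
    ≡ + 16 ⊗ ((+ 3 ⊗ x ⊕ + 1) ⊗ (+ 3 ⊗ x ⊕ + 1)) ⊕ + 1 ⊗ ((+ 6 ⊗ y ⊕ + 1) ⊗ (+ 6 ⊗ y ⊕ + 1)) ⊕ + 24 ⊗
        ((+ 1 ⊗ z ⊕ + 0) ⊗ (+ 1 ⊗ z ⊕ + 0))
  lem = ring-ℤ

tuple-10 : Universal (+ 12) (+ 8) (+ 8) (+ 4) (+ 3) (+ 1)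
tuple-10 = universal 12 23 16 6 1 3 1 4 1 6 1 (+ 12) (+ 8) (+ 8) (+ 4) (+ 3) (+ 1) (λ n → source n (senary (4 * n + 3)))
    lem
  where
  table₈ : Table 8 4 1 6 7 λ i j k → i % 2 ≡ 0 × k % 2 ≡ 1
  table₈ = from-yes (table? 8 4 1 6 7 λ i j k → (i % 2 ≟ 0) ×-dec (k % 2 ≟ 1))
  l₁ : ∀ n → 6 * (4 * n + 3) + 5 ≡ 7 + (3 * n + 2) * 8
  l₁ = ring-ℕ
  l₂ : ∀ n → 24 * n + 23 ≡ 6 * (4 * n + 3) + 5
  l₂ = ring-ℕ
  l₃ : ∀ x b c → 4 * (2 * x * (2 * x)) + 1 * b + 6 * c ≡ 16 * (x * x) + 6 * c + 1 * b
  l₃ = ring-ℕ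
  source : ∀ n → Senary (4 * n + 3) → Source 12 23 16 6 1 3 1 4 1 6 1 n
  source n (X , Y , Z , e , yo , x3 , y3) = X / 2 , Z , Y ,
      trans (l₂ n) (trans e (trans (cong (λ s → 4 * (s * s) + 1 * (Y * Y) + 6 * (Z * Z)) X≡)
          (l₃ (X / 2) (Y * Y) (Z * Z)))) ,
      unit-3 (X / 2) (three∤-* 2 X (X / 2) X≡ x3) , unit-4 Z (%-via 4 2 Z (proj₂ p)) , unit-6 Y yo y3
    where
    p : X % 8 % 2 ≡ 0 × Z % 8 % 2 ≡ 1
    p = table-lookup 8 4 1 6 7 X Y Z table₈ e 7 (3 * n + 2) (l₁ n) refl
    X≡ : X ≡ 2 * (X / 2)
    X≡ = half-of X (%-via 4 2 X (proj₁ p))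
  lem : ∀ x y z → + 12 ⊗ (x ⊗ (+ 12 ⊗ x ⊕ + 8) ⊕ y ⊗ (+ 8 ⊗ y ⊕ + 4) ⊕ z ⊗ (+ 3 ⊗ z ⊕ + 1)) ⊕ + 23
    ≡ + 16 ⊗ ((+ 3 ⊗ x ⊕ + 1) ⊗ (+ 3 ⊗ x ⊕ + 1)) ⊕ + 6 ⊗ ((+ 4 ⊗ y ⊕ + 1) ⊗ (+ 4 ⊗ y ⊕ + 1)) ⊕ + 1 ⊗
        ((+ 6 ⊗ z ⊕ + 1) ⊗ (+ 6 ⊗ z ⊕ + 1))
  lem = ring-ℤ

times-of : ∀ N .{{_ : NonZero N}} X → X % N ≡ 0 → X ≡ N * (X / N)
times-of N X e = trans (m≡m%n+[m/n]*n X N) (trans (cong (_+ X / N * N) e) (*-comm (X / N) N))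

-- Tuples from x² + y² + 3z² = 3(24n + 22)

OddPair : ℕ → Set
OddPair n = ∃ λ x → ∃ λ u → ∃ λ v → 24 * n + 22 ≡ 16 * (x * x) + 3 * (u * u) + 3 * (v * v) × Three∤ x × Odd u × Odd v

-- Since u² + v² ≡ 0 (mod 3), both u and v are multiples of 3. Division by 3 moves the coefficient 3
-- to them, and the residue 6 modulo 8 then makes w a multiple of 4 and the other two odd.
oddPair : ∀ n → OddPair n
oddPair n = divide-by-3 (sum-rep {3} (sum-3-triple n))
  where
  table₃ : Table 3 1 1 3 0 λ i j k → i ≡ 0 × j ≡ 0
  table₃ = from-yes (table? 3 1 1 3 0 λ i j k → (i ≟ 0) ×-dec (j ≟ 0))
  table₃′ : Table 3 1 3 3 1 λ i j k → i ≢ 0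
  table₃′ = from-yes (table? 3 1 3 3 1 λ i j k → ¬? (i ≟ 0))
  table₈ : Table 8 1 3 3 6 λ i j k → i % 4 ≡ 0 × j % 2 ≡ 1 × k % 2 ≡ 1
  table₈ = from-yes (table? 8 1 3 3 6 λ i j k → (i % 4 ≟ 0) ×-dec ((j % 2 ≟ 1) ×-dec (k % 2 ≟ 1)))
  l₁ : ∀ n → 3 * (24 * n + 22) ≡ 0 + (24 * n + 22) * 3
  l₁ = ring-ℕ
  l₂ : ∀ u v c → 1 * (3 * u * (3 * u)) + 1 * (3 * v * (3 * v)) + 3 * c ≡ 3 * (1 * c + 3 * (u * u) + 3 * (v * v))
  l₂ = ring-ℕ
  l₃ : ∀ n → 24 * n + 22 ≡ 1 + (8 * n + 7) * 3
  l₃ = ring-ℕ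
  l₄ : ∀ n → 24 * n + 22 ≡ 6 + (3 * n + 2) * 8
  l₄ = ring-ℕ
  l₅ : ∀ x → 1 * (4 * x * (4 * x)) ≡ 16 * (x * x)
  l₅ = ring-ℕ
  finish : ∀ w u v → 24 * n + 22 ≡ 1 * (w * w) + 3 * (u * u) + 3 * (v * v) → OddPair n
  finish w u v e = w / 4 , u , v , trans e (cong (λ t → t + 3 * (u * u) + 3 * (v * v))
      (trans (cong (λ t → 1 * (t * t)) w≡) (l₅ (w / 4)))) ,
      three∤-* 4 w (w / 4) w≡ (table-lookup 3 1 3 3 1 w u v table₃′ e 1 (8 * n + 7) (l₃ n) refl) ,
      %-via 4 2 u (proj₁ (proj₂ p)) , %-via 4 2 v (proj₂ (proj₂ p))
    where
    p : w % 8 % 4 ≡ 0 × u % 8 % 2 ≡ 1 × v % 8 % 2 ≡ 1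
    p = table-lookup 8 1 3 3 6 w u v table₈ e 6 (3 * n + 2) (l₄ n) refl
    w≡ : w ≡ 4 * (w / 4)
    w≡ = times-of 4 w (%-via 2 4 w (proj₁ p))
  divide-by-3 : Rep 1 1 3 (3 * (24 * n + 22)) → OddPair n
  divide-by-3 (u , v , w , e) = finish w (u / 3) (v / 3) (*-cancelˡ-≡ _ _ 3
      (trans e (trans (cong₂ (λ s t → 1 * (s * s) + 1 * (t * t) + 3 * (w * w)) (times-of 3 u (proj₁ p))
      (times-of 3 v (proj₂ p))) (l₂ (u / 3) (v / 3) (w * w)))))
    where
    p : u % 3 ≡ 0 × v % 3 ≡ 0
    p = table-lookup 3 1 1 3 0 u v w table₃ e 0 (24 * n + 22) (l₁ n) refl

tuple-8 : Universal (+ 12) (+ 8) (+ 4) (+ 2) (+ 4) (+ 2)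
tuple-8 = universal 12 22 16 3 3 3 1 4 1 4 1 (+ 12) (+ 8) (+ 4) (+ 2) (+ 4) (+ 2) (λ n → source n (oddPair n)) lem
  where
  source : ∀ n → OddPair n → Source 12 22 16 3 3 3 1 4 1 4 1 n
  source n (X , Y , Z , e , x3 , yo , zo) = X , Y , Z , e , unit-3 X x3 , unit-4 Y yo , unit-4 Z zo
  lem : ∀ x y z → + 12 ⊗ (x ⊗ (+ 12 ⊗ x ⊕ + 8) ⊕ y ⊗ (+ 4 ⊗ y ⊕ + 2) ⊕ z ⊗ (+ 4 ⊗ z ⊕ + 2)) ⊕ + 22
    ≡ + 16 ⊗ ((+ 3 ⊗ x ⊕ + 1) ⊗ (+ 3 ⊗ x ⊕ + 1)) ⊕ + 3 ⊗ ((+ 4 ⊗ y ⊕ + 1) ⊗ (+ 4 ⊗ y ⊕ + 1)) ⊕ + 3 ⊗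
        ((+ 4 ⊗ z ⊕ + 1) ⊗ (+ 4 ⊗ z ⊕ + 1))
  lem = ring-ℤ

MixedPair : ℕ → Set
MixedPair n = ∃ λ x → ∃ λ p → ∃ λ r → 12 * n + 11 ≡ 8 * (x * x) + 3 * (p * p) + 3 * (r * r) × Three∤ x

-- Both u and v are odd in `OddPair`, so u² + v² is twice a sum of two squares and the equation can
-- be halved.
mixedPair : ∀ n → MixedPair n
mixedPair n = go (oddPair n)
  where
  l₁ : ∀ n → 2 * (12 * n + 11) ≡ 24 * n + 22
  l₁ = ring-ℕ
  l₂ : ∀ a b c → 16 * a + 3 * b + 3 * c ≡ 16 * a + 3 * (b + c)
  l₂ = ring-ℕ
  l₃ : ∀ a b c → 16 * a + 3 * (2 * (b + c)) ≡ 2 * (8 * a + 3 * b + 3 * c)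
  l₃ = ring-ℕ
  go : OddPair n → MixedPair n
  go (x , u , v , e , x3 , uo , vo) = join (half-sum u v (trans uo (sym vo)))
    where
    join : (∃ λ p → ∃ λ r → u * u + v * v ≡ 2 * (p * p + r * r)) → MixedPair n
    join (p , r , hs) = x , p , r , *-cancelˡ-≡ _ _ 2 (trans (l₁ n)
        (trans e (trans (l₂ (x * x) (u * u) (v * v)) (trans (cong (λ t → 16 * (x * x) + 3 * t) hs)
        (l₃ (x * x) (p * p) (r * r)))))) , x3

tuple-9 : Universal (+ 12) (+ 8) (+ 8) (+ 4) (+ 2) (+ 0)
tuple-9 = universal 6 11 8 3 12 3 1 4 1 1 0 (+ 12) (+ 8) (+ 8) (+ 4) (+ 2) (+ 0) (λ n → source n (mixedPair n)) lem
  where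
  table₂ : Table 2 8 3 3 1 λ i j k → (j ≡ 1 × k ≡ 0) ⊎ (k ≡ 1 × j ≡ 0)
  table₂ = from-yes (table? 2 8 3 3 1 λ i j k → ((j ≟ 1) ×-dec (k ≟ 0)) ⊎-dec ((k ≟ 1) ×-dec (j ≟ 0)))
  l₁ : ∀ n → 12 * n + 11 ≡ 1 + (6 * n + 5) * 2
  l₁ = ring-ℕ
  l₂ : ∀ z → 3 * (2 * z * (2 * z)) ≡ 12 * (z * z)
  l₂ = ring-ℕ
  l₃ : ∀ a b c → 8 * a + 3 * b + 3 * c ≡ 8 * a + 3 * c + 3 * b
  l₃ = ring-ℕ
  finish : ∀ n x y z → 12 * n + 11 ≡ 8 * (x * x) + 3 * (y * y) + 3 * (z * z) → Three∤ x → Odd y → z % 2 ≡ 0 → Source 6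
      11 8 3 12 3 1 4 1 1 0 n
  finish n x y z e x3 yo ze = x , y , z / 2 , trans e (cong (λ t → 8 * (x * x) + 3 * (y * y) + t)
      (trans (cong (λ t → 3 * (t * t)) (half-of z ze)) (l₂ (z / 2)))) , unit-3 x x3 , unit-4 y yo , unit-1 (z / 2)
  source : ∀ n → MixedPair n → Source 6 11 8 3 12 3 1 4 1 1 0 n
  source n (x , p , r , e , x3) = choose (table-lookup 2 8 3 3 1 x p r table₂ e 1 (6 * n + 5) (l₁ n) refl)
    where
    choose : (p % 2 ≡ 1 × r % 2 ≡ 0) ⊎ (r % 2 ≡ 1 × p % 2 ≡ 0) → Source 6 11 8 3 12 3 1 4 1 1 0 n
    choose (inj₁ (po , re)) = finish n x p r e x3 po re
    choose (inj₂ (ro , pe)) = finish n x r p (trans e (l₃ (x * x) (p * p) (r * r))) x3 ro pe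
  lem : ∀ x y z → + 6 ⊗ (x ⊗ (+ 12 ⊗ x ⊕ + 8) ⊕ y ⊗ (+ 8 ⊗ y ⊕ + 4) ⊕ z ⊗ (+ 2 ⊗ z ⊕ + 0)) ⊕ + 11
    ≡ + 8 ⊗ ((+ 3 ⊗ x ⊕ + 1) ⊗ (+ 3 ⊗ x ⊕ + 1)) ⊕ + 3 ⊗ ((+ 4 ⊗ y ⊕ + 1) ⊗ (+ 4 ⊗ y ⊕ + 1)) ⊕ + 12 ⊗
        ((+ 1 ⊗ z ⊕ + 0) ⊗ (+ 1 ⊗ z ⊕ + 0))
  lem = ring-ℤ

-- Sums of two squares and the prime 5

linear-% : ∀ N .{{_ : NonZero N}} a b x y → (a * x + b * y) % N ≡ (a * (x % N) + b * (y % N)) % N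
linear-% N a b x y = trans (cong (_% N) (trans (cong₂ (λ s t → a * s + b * t) (m≡m%n+[m/n]*n x N) (m≡m%n+[m/n]*n y N))
    (lem a b (x % N) (x / N) (y % N) (y / N) N)))
  ([m+kn]%n≡m%n (a * (x % N) + b * (y % N)) (a * (x / N) + b * (y / N)) N)
  where lem : ∀ a b x x′ y y′ n → a * (x + x′ * n) + b * (y + y′ * n) ≡ a * x + b * y + (a * x′ + b * y′) * n
        lem = ring-ℕ

abs-diff : ∀ a b → ∃ λ w → a ≡ b + w ⊎ b ≡ a + w
abs-diff a b with ≤-total b a
... | inj₁ b≤a = a ∸ b , inj₁ (sym (m+[n∸m]≡n b≤a))
... | inj₂ a≤b = b ∸ a , inj₂ (sym (m+[n∸m]≡n a≤b))

sum-of-squares : ∀ U w a b → a ≡ b + w ⊎ b ≡ a + w → U * U + w * w ≡ ℤ.∣ + U ⊗ + U ⊕ (+ a ⊖ + b) ⊗ (+ a ⊖ + b) ∣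
sum-of-squares U w a b d = cong ℤ.∣_∣ (trans (ℤ.pos-+ (U * U) (w * w))
    (cong₂ _⊕_ (ℤ.pos-* U U) (trans (ℤ.pos-* w w) (square′ d))))
  where
  l₁ : ∀ x y → y ≡ x ⊕ y ⊖ x
  l₁ = ring-ℤ
  l₂ : ∀ x y → y ⊗ y ≡ (x ⊖ (x ⊕ y)) ⊗ (x ⊖ (x ⊕ y))
  l₂ = ring-ℤ
  square′ : a ≡ b + w ⊎ b ≡ a + w → + w ⊗ + w ≡ (+ a ⊖ + b) ⊗ (+ a ⊖ + b)
  square′ (inj₁ e) = cong₂ _⊗_ eq eq
    where eq : + w ≡ + a ⊖ + b
          eq = trans (l₁ (+ b) (+ w)) (cong (_⊖ + b) (sym (trans (cong +_ e) (ℤ.pos-+ b w))))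
  square′ (inj₂ e) = trans (l₂ (+ a) (+ w)) (cong (λ x → (+ a ⊖ x) ⊗ (+ a ⊖ x)) (sym (trans (cong +_ e) (ℤ.pos-+ a w))))

squares-% : ∀ N .{{_ : NonZero N}} x y → (x * x + y * y) % N ≡ (x % N * (x % N) + y % N * (y % N)) % N
squares-% N x y = trans (cong (_% N) (trans (cong₂ (λ s t → s * s + t * t) (m≡m%n+[m/n]*n x N) (m≡m%n+[m/n]*n y N))
    (lem (x % N) (x / N) (y % N) (y / N) N)))
  ([m+kn]%n≡m%n (x % N * (x % N) + y % N * (y % N)) (2 * (x % N) * (x / N) + x / N * (x / N) * N +
      (2 * (y % N) * (y / N) + y / N * (y / N) * N)) N)
  where lem : ∀ x x′ y y′ n → (x + x′ * n) * (x + x′ * n) + (y + y′ * n) * (y + y′ * n) ≡ x * x + y * y +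
            (2 * x * x′ + x′ * x′ * n + (2 * y * y′ + y′ * y′ * n)) * n
        lem = ring-ℕ

Five∤ : ℕ → ℕ → Set
Five∤ p r = ¬ (p % 5 ≡ 0 × r % 5 ≡ 0)

-- If 5 divides both p and r, divide by 5 and repair the quotient recursively; the lost factor 25
-- comes back through 3 + 4i or 3 - 4i, one of which does not make both coordinates divisible by 5.
prim-5 : ∀ N p r → p * p + r * r ≡ N → 1 ≤ N → ∃ λ p′ → ∃ λ r′ → p′ * p′ + r′ * r′ ≡ N × Five∤ p′ r′
prim-5 = <-rec _ step
  where
  Goal : ℕ → Set
  Goal N = ∃ λ p′ → ∃ λ r′ → p′ * p′ + r′ * r′ ≡ N × Five∤ p′ r′
  table : ∀ {i} → i < 5 → ∀ {j} → j < 5 → ¬ (i ≡ 0 × j ≡ 0) → (3 * i + 4 * j) % 5 ≢ 0 ⊎ (4 * i + 3 * j) % 5 ≢ 0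
  table = from-yes (allUpTo? (λ i → allUpTo? (λ j → ¬? ((i ≟ 0) ×-dec (j ≟ 0)) →-dec
      (¬? ((3 * i + 4 * j) % 5 ≟ 0) ⊎-dec ¬? ((4 * i + 3 * j) % 5 ≟ 0))) 5) 5)
  norm-identity : ∀ s t w → 4 * s ≡ 3 * t + w ⊎ 3 * t ≡ 4 * s + w → (3 * s + 4 * t) * (3 * s + 4 * t) + w * w ≡ 25 *
      (s * s + t * t)
  norm-identity s t w d = trans (sum-of-squares (3 * s + 4 * t) w (4 * s) (3 * t) d)
      (cong ℤ.∣_∣ (trans (cong₂ (λ a b → a ⊗ a ⊕ b ⊗ b)
      (trans (ℤ.pos-+ (3 * s) (4 * t)) (cong₂ _⊕_ (ℤ.pos-* 3 s) (ℤ.pos-* 4 t))) (cong₂ _⊖_ (ℤ.pos-* 4 s) (ℤ.pos-* 3 t)))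
      (trans (lem (+ s) (+ t)) (sym (trans (ℤ.pos-* 25 (s * s + t * t))
          (cong (_⊗_ (+ 25)) (trans (ℤ.pos-+ (s * s) (t * t)) (cong₂ _⊕_ (ℤ.pos-* s s) (ℤ.pos-* t t)))))))))
    where
    lem : ∀ s t → (+ 3 ⊗ s ⊕ + 4 ⊗ t) ⊗ (+ 3 ⊗ s ⊕ + 4 ⊗ t) ⊕ (+ 4 ⊗ s ⊖ + 3 ⊗ t) ⊗ (+ 4 ⊗ s ⊖ + 3 ⊗ t) ≡ + 25 ⊗
        (s ⊗ s ⊕ t ⊗ t)
    lem = ring-ℤ
  -- Multiplication by 3 ± 4i.
  rotate : ∀ s t → Five∤ s t → Goal (25 * (s * s + t * t))
  rotate s t n = choose (table (m%n<n s 5) (m%n<n t 5) n)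
    where
    go : ∀ s t → (3 * (s % 5) + 4 * (t % 5)) % 5 ≢ 0 → (∃ λ w → 4 * s ≡ 3 * t + w ⊎ 3 * t ≡ 4 * s + w) → Goal
        (25 * (s * s + t * t))
    go s t h (w , d) = 3 * s + 4 * t , w , norm-identity s t w d , λ (z , _) → h (trans (sym (linear-% 5 3 4 s t)) z)
    choose : (3 * (s % 5) + 4 * (t % 5)) % 5 ≢ 0 ⊎ (4 * (s % 5) + 3 * (t % 5)) % 5 ≢ 0 → Goal (25 * (s * s + t * t))
    choose (inj₁ h) = go s t h (abs-diff (4 * s) (3 * t))
    choose (inj₂ h) = subst (λ x → Goal (25 * x)) (+-comm (t * t) (s * s))
        (go t s (h ∘ trans (cong (_% 5) (+-comm (4 * (s % 5)) (3 * (t % 5))))) (abs-diff (4 * t) (3 * s)))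
  step : ∀ N → (∀ {M} → M < N → ∀ p r → p * p + r * r ≡ M → 1 ≤ M → Goal M) → ∀ p r → p * p + r * r ≡ N → 1 ≤ N → Goal N
  step N rec p r e 1≤N with (p % 5 ≟ 0) ×-dec (r % 5 ≟ 0)
  ... | no n = p , r , e , n
  ... | yes (pz , rz) = rescale (rec M<N P R refl 1≤M)
    where
    P = p / 5
    R = r / 5
    M = P * P + R * R
    N≡ : N ≡ 25 * M
    N≡ = trans (sym e) (trans (cong₂ (λ a b → a * a + b * b) (times-of 5 p pz) (times-of 5 r rz)) (l P R))
      where l : ∀ P R → 5 * P * (5 * P) + 5 * R * (5 * R) ≡ 25 * (P * P + R * R)
            l = ring-ℕ
    1≤M : 1 ≤ M
    1≤M = n≢0⇒n>0 λ z → <⇒≢ 1≤N (sym (trans N≡ (cong (25 *_) z)))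
    M<N : M < N
    M<N = subst (M <_) (trans (*-comm M 25) (sym N≡)) (m<m*n M 25 {{>-nonZero 1≤M}} (s≤s (s≤s z≤n)))
    rescale : Goal M → Goal N
    rescale (s , t , e′ , n) = subst Goal (trans (cong (25 *_) e′) (sym N≡)) (rotate s t n)

-- The factor 10 in 120n + 110 = 10(12n + 11) is the norm of 3 ± i. With ρ = p + 7r, the coordinates
-- 3p + r and |p - 3r| are 3ρ and ±ρ modulo 10; for a unit ρ they are thus ±3 and ±1 in some order.
-- When p, r have opposite parity and are not both divisible by 5, ρ is a unit for one of the two
-- orders of p and r.
tuple-7 : Universal (+ 12) (+ 8) (+ 5) (+ 3) (+ 5) (+ 1)
tuple-7 = universal 60 110 80 3 3 3 1 10 3 10 1 (+ 12) (+ 8) (+ 5) (+ 3) (+ 5) (+ 1) (λ n → source n (mixedPair n)) lem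
  where
  Unit : ℕ → Set
  Unit ρ = (ρ ≡ 1 ⊎ ρ ≡ 9) ⊎ (ρ ≡ 3 ⊎ ρ ≡ 7)
  unit? : ∀ ρ → Dec (Unit ρ)
  unit? ρ = ((ρ ≟ 1) ⊎-dec (ρ ≟ 9)) ⊎-dec ((ρ ≟ 3) ⊎-dec (ρ ≟ 7))
  table₁₀ : ∀ {i} → i < 10 → ∀ {j} → j < 10 → (i * i + j * j) % 2 ≡ 1 → ¬ (i % 5 ≡ 0 × j % 5 ≡ 0) → Unit
      ((1 * i + 7 * j) % 10) ⊎ Unit ((1 * j + 7 * i) % 10)
  table₁₀ = from-yes (allUpTo? (λ i → allUpTo? (λ j → ((i * i + j * j) % 2 ≟ 1) →-dec
      (¬? ((i % 5 ≟ 0) ×-dec (j % 5 ≟ 0)) →-dec (unit? ((1 * i + 7 * j) % 10) ⊎-dec unit? ((1 * j + 7 * i) % 10)))) 10)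
      10)
  Pair : ℕ → Set
  Pair q = ∃ λ y → ∃ λ z → y * y + z * z ≡ 10 * q × SquareOf 10 3 y × SquareOf 10 1 z
  times : ∀ k ρ x → x % 10 ≡ ρ → (k * x) % 10 ≡ (k * ρ) % 10
  times k ρ x e = trans (%-distribˡ-* k x 10) (trans (cong (λ t → (k % 10 * t) % 10)
      (trans (sym (m%n%n≡m%n x 10)) (cong (_% 10) e))) (sym (%-distribˡ-* k ρ 10)))
  pair : ∀ p r w → p ≡ 3 * r + w ⊎ 3 * r ≡ p + w → Unit ((1 * p + 7 * r) % 10) → Pair (p * p + r * r)
  pair p r w d = dispatch
    where
    U = 3 * p + r
    ρ = (1 * p + 7 * r) % 10
    U% : U % 10 ≡ (3 * ρ) % 10
    U% = trans (sym ([m+kn]%n≡m%n U (2 * r) 10)) (trans (cong (_% 10) (l p r)) (times 3 ρ (1 * p + 7 * r) refl))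
      where l : ∀ p r → 3 * p + r + 2 * r * 10 ≡ 3 * (1 * p + 7 * r)
            l = ring-ℕ
    w% : w % 10 ≡ ρ ⊎ w % 10 ≡ (9 * ρ) % 10
    w% = case d of λ
      { (inj₁ e) → inj₁ (trans (sym ([m+kn]%n≡m%n w r 10)) (cong (_% 10)
          (trans (l w r) (cong (λ p → 1 * p + 7 * r) (sym e)))))
      ; (inj₂ e) → inj₂ (trans (sym ([m+kn]%n≡m%n w (p + 6 * r) 10))
          (trans (cong (_% 10) (trans (l′ w p r) (trans (cong (λ t → 9 * p + t + 60 * r) (sym e)) (l″ p r))))
          (times 9 ρ (1 * p + 7 * r) refl))) }
      where l : ∀ w r → w + r * 10 ≡ 1 * (3 * r + w) + 7 * r
            l = ring-ℕ
            l′ : ∀ w p r → w + (p + 6 * r) * 10 ≡ 9 * p + (p + w) + 60 * r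
            l′ = ring-ℕ
            l″ : ∀ p r → 9 * p + 3 * r + 60 * r ≡ 9 * (1 * p + 7 * r)
            l″ = ring-ℕ
    sum : U * U + w * w ≡ 10 * (p * p + r * r)
    sum = trans (sum-of-squares U w p (3 * r) d) (cong ℤ.∣_∣ (trans (cong₂ (λ a b → a ⊗ a ⊕ b ⊗ b)
        (trans (ℤ.pos-+ (3 * p) r) (cong (_⊕ + r) (ℤ.pos-* 3 p))) (cong (_⊖_ (+ p)) (ℤ.pos-* 3 r)))
        (trans (l (+ p) (+ r)) (sym (trans (ℤ.pos-* 10 (p * p + r * r))
            (cong (_⊗_ (+ 10)) (trans (ℤ.pos-+ (p * p) (r * r)) (cong₂ _⊕_ (ℤ.pos-* p p) (ℤ.pos-* r r)))))))))
      where
      l : ∀ p r → (+ 3 ⊗ p ⊕ r) ⊗ (+ 3 ⊗ p ⊕ r) ⊕ (p ⊖ + 3 ⊗ r) ⊗ (p ⊖ + 3 ⊗ r) ≡ + 10 ⊗ (p ⊗ p ⊕ r ⊗ r)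
      l = ring-ℤ
    U≡ : ∀ {k} → ρ ≡ k → U % 10 ≡ (3 * k) % 10
    U≡ e = trans U% (cong (λ t → (3 * t) % 10) e)
    w≡ : ∀ {k} → ρ ≡ k → w % 10 ≡ k ⊎ w % 10 ≡ (9 * k) % 10
    w≡ e = case w% of λ { (inj₁ x) → inj₁ (trans x e) ; (inj₂ x) → inj₂ (trans x (cong (λ t → (9 * t) % 10) e)) }
    flip : ∀ {A B : Set} → A ⊎ B → B ⊎ A
    flip (inj₁ x) = inj₂ x
    flip (inj₂ x) = inj₁ x
    3≤10 : 3 ≤ 10
    3≤10 = s≤s (s≤s (s≤s z≤n))
    dispatch : Unit ρ → Pair (p * p + r * r)
    dispatch (inj₁ (inj₁ e)) = U , w , sum , square-of 10 3 3≤10 U (inj₁ (U≡ e)) , square-of 10 1 (s≤s z≤n) w (w≡ e)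
    dispatch (inj₁ (inj₂ e)) = U , w , sum , square-of 10 3 3≤10 U (inj₂ (U≡ e)) , square-of 10 1 (s≤s z≤n) w
        (flip (w≡ e))
    dispatch (inj₂ (inj₁ e)) = w , U , trans (+-comm (w * w) (U * U)) sum , square-of 10 3 3≤10 w (w≡ e) , square-of 10
        1 (s≤s z≤n) U (inj₂ (U≡ e))
    dispatch (inj₂ (inj₂ e)) = w , U , trans (+-comm (w * w) (U * U)) sum , square-of 10 3 3≤10 w (flip (w≡ e)) ,
        square-of 10 1 (s≤s z≤n) U (inj₁ (U≡ e))
  table₂ : Table 2 8 3 3 1 λ i j k → (j * j + k * k) % 2 ≡ 1
  table₂ = from-yes (table? 2 8 3 3 1 λ i j k → ((j * j + k * k) % 2 ≟ 1))
  l₂ : ∀ n → 12 * n + 11 ≡ 1 + (6 * n + 5) * 2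
  l₂ = ring-ℕ
  l₃ : ∀ n → 120 * n + 110 ≡ 10 * (12 * n + 11)
  l₃ = ring-ℕ
  l₄ : ∀ x p r → 10 * (8 * x + 3 * p + 3 * r) ≡ 80 * x + 3 * (10 * (p + r))
  l₄ = ring-ℕ
  l₅ : ∀ x y z → 80 * x + 3 * (y + z) ≡ 80 * x + 3 * y + 3 * z
  l₅ = ring-ℕ
  source : ∀ n → MixedPair n → Source 60 110 80 3 3 3 1 10 3 10 1 n
  source n (x , p , r , e , x3) = primitive-pair (prim-5 (p * p + r * r) p r refl
      (n≢0⇒n>0 λ z → 0≢1+n (trans (sym (cong (_% 2) z)) q-odd)))
    where
    q-odd : (p * p + r * r) % 2 ≡ 1
    q-odd = trans (squares-% 2 p r) (table-lookup 2 8 3 3 1 x p r table₂ e 1 (6 * n + 5) (l₂ n) refl)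
    finish : Pair (p * p + r * r) → Source 60 110 80 3 3 3 1 10 3 10 1 n
    finish (Y , Z , s , sy , sz) = x , Y , Z , trans (l₃ n) (trans (cong (10 *_) e)
        (trans (l₄ (x * x) (p * p) (r * r)) (trans (cong (λ t → 80 * (x * x) + 3 * t) (sym s))
        (l₅ (x * x) (Y * Y) (Z * Z))))) ,
      unit-3 x x3 , sy , sz
    primitive-pair : (∃ λ p′ → ∃ λ r′ → p′ * p′ + r′ * r′ ≡ p * p + r * r × Five∤ p′ r′) → Source 60 110 80 3 3 3 1 10 3
        10 1 n
    primitive-pair (p′ , r′ , s , n5) = choose (table₁₀ (m%n<n p′ 10) (m%n<n r′ 10)
        (%-via 5 2 (p′ % 10 * (p′ % 10) + r′ % 10 * (r′ % 10)) (trans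
            (cong (_% 2) (trans (sym (squares-% 10 p′ r′)) (cong (_% 10) s)))
            (trans (m∣n⇒o%n%m≡o%m 2 10 (p * p + r * r) (divides 5 refl)) q-odd)))
        λ (a , b) → n5 (%-via 2 5 p′ a , %-via 2 5 r′ b))
      where
      orient : ∀ p′ r′ → p′ * p′ + r′ * r′ ≡ p * p + r * r → Unit ((1 * (p′ % 10) + 7 * (r′ % 10)) % 10) →
          (∃ λ w → p′ ≡ 3 * r′ + w ⊎ 3 * r′ ≡ p′ + w) → Source 60 110 80 3 3 3 1 10 3 10 1 n
      orient p′ r′ s u (w , d) = finish (subst Pair s (pair p′ r′ w d (subst Unit (sym (linear-% 10 1 7 p′ r′)) u)))
      choose : Unit ((1 * (p′ % 10) + 7 * (r′ % 10)) % 10) ⊎ Unit ((1 * (r′ % 10) + 7 * (p′ % 10)) % 10) → Source 60 110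
          80 3 3 3 1 10 3 10 1 n
      choose (inj₁ u) = orient p′ r′ s u (abs-diff p′ (3 * r′))
      choose (inj₂ u) = orient r′ p′ (trans (+-comm (r′ * r′) (p′ * p′)) s) u (abs-diff r′ (3 * p′))
  lem : ∀ x y z → + 60 ⊗ (x ⊗ (+ 12 ⊗ x ⊕ + 8) ⊕ y ⊗ (+ 5 ⊗ y ⊕ + 3) ⊕ z ⊗ (+ 5 ⊗ z ⊕ + 1)) ⊕ + 110
    ≡ + 80 ⊗ ((+ 3 ⊗ x ⊕ + 1) ⊗ (+ 3 ⊗ x ⊕ + 1)) ⊕ + 3 ⊗ ((+ 10 ⊗ y ⊕ + 3) ⊗ (+ 10 ⊗ y ⊕ + 3)) ⊕ + 3 ⊗
        ((+ 10 ⊗ z ⊕ + 1) ⊗ (+ 10 ⊗ z ⊕ + 1))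
  lem = ring-ℤ

-- Tuples from x² + y² + 3z² = 24n + 23

EvenPair : ℕ → Set
EvenPair n = ∃ λ x → ∃ λ y → ∃ λ z → 24 * n + 23 ≡ 18 * (x * x) + 3 * (y * y) + 2 * (z * z) × Odd x × Odd z × Three∤ z

-- Modulo 8, u and v have equal parity, which gives 2a² + 2b² + 3w² with a and b odd. Modulo 3,
-- exactly one of a and b vanishes; its factor 9 turns the coefficient 2 into 18.
evenPair : ∀ n → EvenPair n
evenPair n = start (sum-rep {3} (sum-3-odd n))
  where
  table₈ : Table 8 1 1 3 7 λ i j k → i % 2 ≡ j % 2
  table₈ = from-yes (table? 8 1 1 3 7 λ i j k → (i % 2 ≟ j % 2))
  table₈′ : Table 8 2 2 3 7 λ i j k → i % 2 ≡ 1 × j % 2 ≡ 1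
  table₈′ = from-yes (table? 8 2 2 3 7 λ i j k → (i % 2 ≟ 1) ×-dec (j % 2 ≟ 1))
  table₃ : Table 3 2 2 3 2 λ i j k → (i ≡ 0 × j ≢ 0) ⊎ (j ≡ 0 × i ≢ 0)
  table₃ = from-yes (table? 3 2 2 3 2 λ i j k → ((i ≟ 0) ×-dec ¬? (j ≟ 0)) ⊎-dec ((j ≟ 0) ×-dec ¬? (i ≟ 0)))
  l₁ : ∀ n → 24 * n + 23 ≡ 7 + (3 * n + 2) * 8
  l₁ = ring-ℕ
  l₂ : ∀ n → 24 * n + 23 ≡ 2 + (8 * n + 7) * 3
  l₂ = ring-ℕ
  l₃ : ∀ a b c → 1 * a + 1 * b + c ≡ a + b + c
  l₃ = ring-ℕ
  l₄ : ∀ a b c → 2 * (a + b) + c ≡ 2 * a + 2 * b + c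
  l₄ = ring-ℕ
  l₅ : ∀ a b w → 2 * (3 * a * (3 * a)) + 2 * b + 3 * w ≡ 18 * (a * a) + 3 * w + 2 * b
  l₅ = ring-ℕ
  l₆ : ∀ a b w → 2 * a + 2 * b + 3 * w ≡ 2 * b + 2 * a + 3 * w
  l₆ = ring-ℕ
  odd-third : ∀ x → x % 3 ≡ 0 → Odd x → Odd (x / 3)
  odd-third x z o = trans (sym ([m+kn]%n≡m%n (x / 3) (x / 3) 2))
      (trans (cong (_% 2) (trans (l (x / 3)) (sym (times-of 3 x z)))) o)
    where l : ∀ t → t + t * 2 ≡ 3 * t
          l = ring-ℕ
  cases : ∀ a b w → 24 * n + 23 ≡ 2 * (a * a) + 2 * (b * b) + 3 * (w * w) → a % 3 ≡ 0 → Three∤ b → Odd a → Odd b →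
      EvenPair n
  cases a b w e az b3 ao bo = a / 3 , w , b , trans e (trans (cong (λ t → 2 * (t * t) + 2 * (b * b) + 3 * (w * w))
      (times-of 3 a az)) (l₅ (a / 3) (b * b) (w * w))) ,
    odd-third a az ao , bo , b3
  start : Rep 1 1 3 (24 * n + 23) → EvenPair n
  start (u , v , w , e) = join (half-sum u v (%-via 4 2 u (trans
      (table-lookup 8 1 1 3 7 u v w table₈ e 7 (3 * n + 2) (l₁ n) refl) (m∣n⇒o%n%m≡o%m 2 8 v (divides 4 refl)))))
    where
    join : (∃ λ a → ∃ λ b → u * u + v * v ≡ 2 * (a * a + b * b)) → EvenPair n
    join (a , b , hs) = choose (table-lookup 3 2 2 3 2 a b w table₃ e′ 2 (8 * n + 7) (l₂ n) refl)
      where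
      e′ : 24 * n + 23 ≡ 2 * (a * a) + 2 * (b * b) + 3 * (w * w)
      e′ = trans e (trans (l₃ (u * u) (v * v) (3 * (w * w))) (trans (cong (_+ 3 * (w * w)) hs)
          (l₄ (a * a) (b * b) (3 * (w * w)))))
      p : a % 8 % 2 ≡ 1 × b % 8 % 2 ≡ 1
      p = table-lookup 8 2 2 3 7 a b w table₈′ e′ 7 (3 * n + 2) (l₁ n) refl
      ao : Odd a
      ao = %-via 4 2 a (proj₁ p)
      bo : Odd b
      bo = %-via 4 2 b (proj₂ p)
      choose : (a % 3 ≡ 0 × b % 3 ≢ 0) ⊎ (b % 3 ≡ 0 × a % 3 ≢ 0) → EvenPair n
      choose (inj₁ (az , b3)) = cases a b w e′ az b3 ao bo
      choose (inj₂ (bz , a3)) = cases b a w (trans e′ (l₆ (a * a) (b * b) (w * w))) bz a3 bo ao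

-- For odd X and Z, 18X² + 2Z² ≡ 4 (mod 16). Hence 48n + 23 leaves Y² ≡ 1, so Y ≡ ±1 (mod 8),
-- whereas 48n + 47 in `tuple-5` leaves Y² ≡ 9, so Y ≡ ±3.
tuple-4 : Universal (+ 12) (+ 6) (+ 8) (+ 2) (+ 3) (+ 1)
tuple-4 = universal 24 23 18 3 2 4 1 8 1 6 1 (+ 12) (+ 6) (+ 8) (+ 2) (+ 3) (+ 1) (λ n → source n (evenPair (2 * n)))
    lem
  where
  table₁₆ : Table 16 18 3 2 7 λ i j k → j % 8 ≡ 1 ⊎ j % 8 ≡ 7
  table₁₆ = from-yes (table? 16 18 3 2 7 λ i j k → (j % 8 ≟ 1) ⊎-dec (j % 8 ≟ 7))
  l₁ : ∀ n → 48 * n + 23 ≡ 7 + (3 * n + 1) * 16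
  l₁ = ring-ℕ
  l₂ : ∀ n → 48 * n + 23 ≡ 24 * (2 * n) + 23
  l₂ = ring-ℕ
  source : ∀ n → EvenPair (2 * n) → Source 24 23 18 3 2 4 1 8 1 6 1 n
  source n (X , Y , Z , e , xo , zo , z3) = X , Y , Z , e′ , unit-4 X xo ,
      square-of 8 1 (s≤s z≤n) Y (subst (λ y → y ≡ 1 ⊎ y ≡ 7) (m∣n⇒o%n%m≡o%m 8 16 Y (divides 2 refl))
          (table-lookup 16 18 3 2 7 X Y Z table₁₆ e′ 7 (3 * n + 1) (l₁ n) refl)) , unit-6 Z zo z3
    where
    e′ : 48 * n + 23 ≡ 18 * (X * X) + 3 * (Y * Y) + 2 * (Z * Z)
    e′ = trans (l₂ n) e
  lem : ∀ x y z → + 24 ⊗ (x ⊗ (+ 12 ⊗ x ⊕ + 6) ⊕ y ⊗ (+ 8 ⊗ y ⊕ + 2) ⊕ z ⊗ (+ 3 ⊗ z ⊕ + 1)) ⊕ + 23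
    ≡ + 18 ⊗ ((+ 4 ⊗ x ⊕ + 1) ⊗ (+ 4 ⊗ x ⊕ + 1)) ⊕ + 3 ⊗ ((+ 8 ⊗ y ⊕ + 1) ⊗ (+ 8 ⊗ y ⊕ + 1)) ⊕ + 2 ⊗
        ((+ 6 ⊗ z ⊕ + 1) ⊗ (+ 6 ⊗ z ⊕ + 1))
  lem = ring-ℤ

tuple-5 : Universal (+ 12) (+ 6) (+ 8) (+ 6) (+ 3) (+ 1)
tuple-5 = universal 24 47 18 3 2 4 1 8 3 6 1 (+ 12) (+ 6) (+ 8) (+ 6) (+ 3) (+ 1)
    (λ n → source n (evenPair (2 * n + 1))) lem
  where
  table₁₆ : Table 16 18 3 2 15 λ i j k → j % 8 ≡ 3 ⊎ j % 8 ≡ 5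
  table₁₆ = from-yes (table? 16 18 3 2 15 λ i j k → (j % 8 ≟ 3) ⊎-dec (j % 8 ≟ 5))
  l₁ : ∀ n → 48 * n + 47 ≡ 15 + (3 * n + 2) * 16
  l₁ = ring-ℕ
  l₂ : ∀ n → 48 * n + 47 ≡ 24 * (2 * n + 1) + 23
  l₂ = ring-ℕ
  source : ∀ n → EvenPair (2 * n + 1) → Source 24 47 18 3 2 4 1 8 3 6 1 n
  source n (X , Y , Z , e , xo , zo , z3) = X , Y , Z , e′ , unit-4 X xo ,
      square-of 8 3 (s≤s (s≤s (s≤s z≤n))) Y (subst (λ y → y ≡ 3 ⊎ y ≡ 5) (m∣n⇒o%n%m≡o%m 8 16 Y (divides 2 refl))
          (table-lookup 16 18 3 2 15 X Y Z table₁₆ e′ 15 (3 * n + 2) (l₁ n) refl)) , unit-6 Z zo z3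
    where
    e′ : 48 * n + 47 ≡ 18 * (X * X) + 3 * (Y * Y) + 2 * (Z * Z)
    e′ = trans (l₂ n) e
  lem : ∀ x y z → + 24 ⊗ (x ⊗ (+ 12 ⊗ x ⊕ + 6) ⊕ y ⊗ (+ 8 ⊗ y ⊕ + 6) ⊕ z ⊗ (+ 3 ⊗ z ⊕ + 1)) ⊕ + 47
    ≡ + 18 ⊗ ((+ 4 ⊗ x ⊕ + 1) ⊗ (+ 4 ⊗ x ⊕ + 1)) ⊕ + 3 ⊗ ((+ 8 ⊗ y ⊕ + 3) ⊗ (+ 8 ⊗ y ⊕ + 3)) ⊕ + 2 ⊗
        ((+ 6 ⊗ z ⊕ + 1) ⊗ (+ 6 ⊗ z ⊕ + 1))
  lem = ring-ℤ

-- Tuples from three squares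

Multiple3 : ℤ → Set
Multiple3 x = ∃ λ k → x ≡ + 3 ⊗ k

multiple3-abs : ∀ x → ¬ Multiple3 x → Three∤ ℤ.∣ x ∣
multiple3-abs x n z with ∣ᵤ⇒∣ {+ 3} {x} (m%n≡0⇒n∣m ℤ.∣ x ∣ 3 z)
... | ℤdivides q e = n (q , trans e (ℤ.*-comm q (+ 3)))

abs-multiple3 : ∀ x → Multiple3 (+ x) → x % 3 ≡ 0
abs-multiple3 x (k , e) = n∣m⇒m%n≡0 x 3 (divides ℤ.∣ k ∣ (trans (cong ℤ.∣_∣ e)
    (trans (ℤ.abs-* (+ 3) k) (*-comm 3 ℤ.∣ k ∣))))

multiple3? : ∀ x → Multiple3 x ⊎ ¬ Multiple3 x
multiple3? x with mod3 x
... | inj₁ p = inj₁ p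
... | inj₂ (j , e) = inj₂ λ { (k , refl) → 3*≢1 (+ 3 ⊗ (k ⊗ k) ⊖ j)
    (trans (l₁ k j) (trans (cong (_⊖ + 3 ⊗ j) e) (l₂ j))) }
  where
  l₁ : ∀ k j → + 3 ⊗ (+ 3 ⊗ (k ⊗ k) ⊖ j) ≡ + 3 ⊗ k ⊗ (+ 3 ⊗ k) ⊖ + 3 ⊗ j
  l₁ = ring-ℤ
  l₂ : ∀ j → + 1 ⊕ + 3 ⊗ j ⊖ + 3 ⊗ j ≡ + 1
  l₂ = ring-ℤ

via-double : ∀ x y z → + 2 ⊗ x ≡ z ⊕ + 3 ⊗ y → Multiple3 z → Multiple3 x
via-double x y z e (k , refl) = x ⊖ k ⊖ y , trans (l₁ x) (trans (cong (_⊖_ (+ 3 ⊗ x)) e) (l₂ x y k))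
  where
  l₁ : ∀ x → x ≡ + 3 ⊗ x ⊖ + 2 ⊗ x
  l₁ = ring-ℤ
  l₂ : ∀ x y k → + 3 ⊗ x ⊖ (+ 3 ⊗ k ⊕ + 3 ⊗ y) ≡ + 3 ⊗ (x ⊖ k ⊖ y)
  l₂ = ring-ℤ

nat-squares : ∀ a b c α β γ → + (α * (a * a) + β * (b * b) + γ * (c * c)) ≡ + α ⊗ (+ a ⊗ + a) ⊕ + β ⊗ (+ b ⊗ + b) ⊕ + γ
    ⊗ (+ c ⊗ + c)
nat-squares a b c α β γ = trans (cast-rep {α} {β} {γ} (a * a) (b * b) (c * c) refl)
    (cong₂ _⊕_ (cong₂ _⊕_ (cong (_⊗_ (+ α)) (ℤ.pos-* a a)) (cong (_⊗_ (+ β)) (ℤ.pos-* b b)))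
    (cong (_⊗_ (+ γ)) (ℤ.pos-* c c)))

sum3 : ℕ → ℕ → ℕ → ℕ
sum3 a b c = 1 * (a * a) + 1 * (b * b) + 1 * (c * c)

Prim3 : ℕ → Set
Prim3 N = ∃ λ a → ∃ λ b → ∃ λ c → N ≡ sum3 a b c × ¬ (a % 3 ≡ 0 × b % 3 ≡ 0 × c % 3 ≡ 0)

-- The entries -s + 2t + 2u, 2s - t + 2u and 2s + 2t - u are all ≡ 2(s + t + u) (mod 3); signs are flipped until 3 does
-- not divide s + t + u.
rotate-3 : ∀ a b c → ¬ (a % 3 ≡ 0 × b % 3 ≡ 0 × c % 3 ≡ 0) → Prim3 (9 * sum3 a b c)
rotate-3 a b c n = choose (multiple3? (A ⊕ B ⊕ C)) (multiple3? (⊝ A ⊕ B ⊕ C)) (multiple3? (A ⊖ B ⊕ C))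
    (multiple3? (A ⊕ B ⊖ C))
  where
  A = + a
  B = + b
  C = + c
  Goal = Prim3 (9 * sum3 a b c)
  l₀ : ∀ s t u → + 9 ⊗ (+ 1 ⊗ (s ⊗ s) ⊕ + 1 ⊗ (t ⊗ t) ⊕ + 1 ⊗ (u ⊗ u)) ≡
    + 1 ⊗ ((⊝ s ⊕ + 2 ⊗ t ⊕ + 2 ⊗ u) ⊗ (⊝ s ⊕ + 2 ⊗ t ⊕ + 2 ⊗ u)) ⊕ + 1 ⊗
        ((+ 2 ⊗ s ⊖ t ⊕ + 2 ⊗ u) ⊗ (+ 2 ⊗ s ⊖ t ⊕ + 2 ⊗ u)) ⊕ + 1 ⊗ ((+ 2 ⊗ s ⊕ + 2 ⊗ t ⊖ u) ⊗ (+ 2 ⊗ s ⊕ + 2 ⊗ t ⊖ u))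
  l₀ = ring-ℤ
  l₁ : ∀ s t u → + 2 ⊗ (s ⊕ t ⊕ u) ≡ ⊝ s ⊕ + 2 ⊗ t ⊕ + 2 ⊗ u ⊕ + 3 ⊗ s
  l₁ = ring-ℤ
  go : ∀ S T U → S ⊗ S ≡ A ⊗ A → T ⊗ T ≡ B ⊗ B → U ⊗ U ≡ C ⊗ C → ¬ Multiple3 (S ⊕ T ⊕ U) → Goal
  go S T U es et eu h = ℤ.∣ X ∣ , ℤ.∣ Y ∣ , ℤ.∣ Z ∣ ,
      rep-abs {1} {1} {1} X Y Z (trans (ℤ.pos-* 9 (sum3 a b c)) (trans
          (cong (_⊗_ (+ 9)) (trans (nat-squares a b c 1 1 1) (sym (cong₂ _⊕_ (cong₂ (λ x y → + 1 ⊗ x ⊕ + 1 ⊗ y) es et)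
          (cong (_⊗_ (+ 1)) eu))))) (l₀ S T U))) ,
      λ (x0 , _) → multiple3-abs X (h ∘ via-double (S ⊕ T ⊕ U) S X (l₁ S T U)) x0
    where
    X = ⊝ S ⊕ + 2 ⊗ T ⊕ + 2 ⊗ U
    Y = + 2 ⊗ S ⊖ T ⊕ + 2 ⊗ U
    Z = + 2 ⊗ S ⊕ + 2 ⊗ T ⊖ U
  neg : ∀ x → (⊝ x) ⊗ (⊝ x) ≡ x ⊗ x
  neg = ring-ℤ
  d₁ : ∀ s t u → + 2 ⊗ s ≡ (s ⊕ t ⊕ u ⊖ (⊝ s ⊕ t ⊕ u)) ⊕ + 3 ⊗ + 0
  d₁ = ring-ℤ
  d₂ : ∀ s t u → + 2 ⊗ t ≡ (s ⊕ t ⊕ u ⊖ (s ⊖ t ⊕ u)) ⊕ + 3 ⊗ + 0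
  d₂ = ring-ℤ
  d₃ : ∀ s t u → + 2 ⊗ u ≡ (s ⊕ t ⊕ u ⊖ (s ⊕ t ⊖ u)) ⊕ + 3 ⊗ + 0
  d₃ = ring-ℤ
  minus : ∀ {x y} → Multiple3 x → Multiple3 y → Multiple3 (x ⊖ y)
  minus (k , refl) (j , refl) = k ⊖ j , l k j
    where l : ∀ k j → + 3 ⊗ k ⊖ + 3 ⊗ j ≡ + 3 ⊗ (k ⊖ j)
          l = ring-ℤ
  Test : ℤ → Set
  Test x = Multiple3 x ⊎ ¬ Multiple3 x
  choose : Test (A ⊕ B ⊕ C) → Test (⊝ A ⊕ B ⊕ C) → Test (A ⊖ B ⊕ C) → Test (A ⊕ B ⊖ C) → Goal
  choose (inj₂ h) _ _ _ = go A B C refl refl refl h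
  choose (inj₁ _) (inj₂ h) _ _ = go (⊝ A) B C (neg A) refl refl h
  choose (inj₁ _) (inj₁ _) (inj₂ h) _ = go A (⊝ B) C refl (neg B) refl h
  choose (inj₁ _) (inj₁ _) (inj₁ _) (inj₂ h) = go A B (⊝ C) refl refl (neg C) h
  choose (inj₁ p) (inj₁ q) (inj₁ r) (inj₁ s) = ⊥-elim (n
    ( abs-multiple3 a (via-double A (+ 0) (A ⊕ B ⊕ C ⊖ (⊝ A ⊕ B ⊕ C)) (d₁ A B C) (minus {A ⊕ B ⊕ C} {⊝ A ⊕ B ⊕ C} p q))
    , abs-multiple3 b (via-double B (+ 0) (A ⊕ B ⊕ C ⊖ (A ⊖ B ⊕ C)) (d₂ A B C) (minus {A ⊕ B ⊕ C} {A ⊖ B ⊕ C} p r))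
    , abs-multiple3 c (via-double C (+ 0) (A ⊕ B ⊕ C ⊖ (A ⊕ B ⊖ C)) (d₃ A B C) (minus {A ⊕ B ⊕ C} {A ⊕ B ⊖ C} p s))))

-- A common factor 3 is divided out, the smaller number is treated recursively, and `rotate-3`
-- restores the factor 9 without bringing the common divisor back.
prim-3 : ∀ N a b c → N ≡ sum3 a b c → 1 ≤ N → Prim3 N
prim-3 = <-rec _ step
  where
  step : ∀ N → (∀ {M} → M < N → ∀ a b c → M ≡ sum3 a b c → 1 ≤ M → Prim3 M) → ∀ a b c → N ≡ sum3 a b c → 1 ≤ N → Prim3 N
  step N rec a b c e 1≤N with (a % 3 ≟ 0) ×-dec ((b % 3 ≟ 0) ×-dec (c % 3 ≟ 0))
  ... | no n = a , b , c , e , n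
  ... | yes (az , bz , cz) = expand (rec M<N (a / 3) (b / 3) (c / 3) refl 1≤M)
    where
    M = sum3 (a / 3) (b / 3) (c / 3)
    N≡ : N ≡ 9 * M
    N≡ = trans e (trans (cong₂ _+_ (cong₂ (λ x y → 1 * (x * x) + 1 * (y * y)) (times-of 3 a az) (times-of 3 b bz))
        (cong (λ x → 1 * (x * x)) (times-of 3 c cz))) (l (a / 3) (b / 3) (c / 3)))
      where l : ∀ a b c → 1 * (3 * a * (3 * a)) + 1 * (3 * b * (3 * b)) + 1 * (3 * c * (3 * c)) ≡ 9 *
                (1 * (a * a) + 1 * (b * b) + 1 * (c * c))
            l = ring-ℕ
    1≤M : 1 ≤ M
    1≤M = n≢0⇒n>0 λ z → <⇒≢ 1≤N (sym (trans N≡ (cong (9 *_) z)))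
    M<N : M < N
    M<N = subst (M <_) (trans (*-comm M 9) (sym N≡)) (m<m*n M 9 {{>-nonZero 1≤M}} (s≤s (s≤s z≤n)))
    expand : Prim3 M → Prim3 N
    expand (s , t , u , e′ , n) = subst Prim3 (trans (cong (9 *_) (sym e′)) (sym N≡)) (rotate-3 s t u n)

-- Because 24n + 18 is a multiple of 3, its three roots are all divisible by 3 or all prime to 3,
-- and `prim-3` excludes the former. Modulo 8 exactly one root is a multiple of 4 and the other two
-- are odd.
tuple-3 : Universal (+ 12) (+ 8) (+ 3) (+ 1) (+ 3) (+ 1)
tuple-3 = universal 12 18 16 1 1 3 1 6 1 6 1 (+ 12) (+ 8) (+ 3) (+ 1) (+ 3) (+ 1)
    (λ n → start n (sum-rep {1} (three-squares (6 * n + 4)))) lem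
  where
  S3 : ℕ → Set
  S3 = Source 12 18 16 1 1 3 1 6 1 6 1
  table₃ : Table 3 1 1 1 0 λ i j k → (i ≡ 0 × j ≡ 0 × k ≡ 0) ⊎ (i ≢ 0 × j ≢ 0 × k ≢ 0)
  table₃ = from-yes (table? 3 1 1 1 0 λ i j k → ((i ≟ 0) ×-dec ((j ≟ 0) ×-dec (k ≟ 0))) ⊎-dec
      (¬? (i ≟ 0) ×-dec (¬? (j ≟ 0) ×-dec ¬? (k ≟ 0))))
  Shape : ℕ → ℕ → ℕ → Set
  Shape i j k = i % 4 ≡ 0 × j % 2 ≡ 1 × k % 2 ≡ 1
  shape? : ∀ i j k → Dec (Shape i j k)
  shape? i j k = (i % 4 ≟ 0) ×-dec ((j % 2 ≟ 1) ×-dec (k % 2 ≟ 1))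
  table₈ : Table 8 1 1 1 2 λ i j k → Shape i j k ⊎ Shape j i k ⊎ Shape k i j
  table₈ = from-yes (table? 8 1 1 1 2 λ i j k → shape? i j k ⊎-dec (shape? j i k ⊎-dec shape? k i j))
  l₁ : ∀ n → 4 * (6 * n + 4) + 2 ≡ 24 * n + 18
  l₁ = ring-ℕ
  l₂ : ∀ n → 24 * n + 18 ≡ 0 + (8 * n + 6) * 3
  l₂ = ring-ℕ
  l₃ : ∀ n → 24 * n + 18 ≡ 2 + (3 * n + 2) * 8
  l₃ = ring-ℕ
  l₄ : ∀ a → 1 * (4 * a * (4 * a)) ≡ 16 * (a * a)
  l₄ = ring-ℕ
  l₅ : ∀ a b c → 1 * a + 1 * b + 1 * c ≡ 1 * b + 1 * a + 1 * c
  l₅ = ring-ℕ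
  l₆ : ∀ a b c → 1 * a + 1 * b + 1 * c ≡ 1 * c + 1 * a + 1 * b
  l₆ = ring-ℕ
  finish : ∀ n a b c → 24 * n + 18 ≡ sum3 a b c → Shape (a % 8) (b % 8) (c % 8) → Three∤ a → Three∤ b → Three∤ c → S3 n
  finish n a b c e (az , bo , co) a3 b3 c3 = a / 4 , b , c , trans e
      (cong (λ t → t + 1 * (b * b) + 1 * (c * c)) (trans (cong (λ t → 1 * (t * t)) a≡) (l₄ (a / 4)))) ,
      unit-3 (a / 4) (three∤-* 4 a (a / 4) a≡ a3) , unit-6 b (%-via 4 2 b bo) b3 , unit-6 c (%-via 4 2 c co) c3
    where
    a≡ : a ≡ 4 * (a / 4)
    a≡ = times-of 4 a (%-via 2 4 a az)
  sort : ∀ n → Prim3 (24 * n + 18) → S3 n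
  sort n (a , b , c , e , np) = cases (table-lookup 3 1 1 1 0 a b c table₃ e 0 (8 * n + 6) (l₂ n) refl)
    where
    cases : (a % 3 ≡ 0 × b % 3 ≡ 0 × c % 3 ≡ 0) ⊎ (Three∤ a × Three∤ b × Three∤ c) → S3 n
    cases (inj₁ z) = ⊥-elim (np z)
    cases (inj₂ (a3 , b3 , c3)) = choose (table-lookup 8 1 1 1 2 a b c table₈ e 2 (3 * n + 2) (l₃ n) refl)
      where
      choose : Shape (a % 8) (b % 8) (c % 8) ⊎ Shape (b % 8) (a % 8) (c % 8) ⊎ Shape (c % 8) (a % 8) (b % 8) → S3 n
      choose (inj₁ s) = finish n a b c e s a3 b3 c3
      choose (inj₂ (inj₁ s)) = finish n b a c (trans e (l₅ (a * a) (b * b) (c * c))) s b3 a3 c3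
      choose (inj₂ (inj₂ s)) = finish n c a b (trans e (l₆ (a * a) (b * b) (c * c))) s c3 a3 b3
  start : ∀ n → Rep 1 1 1 (4 * (6 * n + 4) + 2) → S3 n
  start n (a , b , c , e) = sort n (prim-3 (24 * n + 18) a b c (trans (sym (l₁ n)) e)
      (≤-trans (s≤s z≤n) (m≤n+m 18 (24 * n))))
  lem : ∀ x y z → + 12 ⊗ (x ⊗ (+ 12 ⊗ x ⊕ + 8) ⊕ y ⊗ (+ 3 ⊗ y ⊕ + 1) ⊕ z ⊗ (+ 3 ⊗ z ⊕ + 1)) ⊕ + 18
    ≡ + 16 ⊗ ((+ 3 ⊗ x ⊕ + 1) ⊗ (+ 3 ⊗ x ⊕ + 1)) ⊕ + 1 ⊗ ((+ 6 ⊗ y ⊕ + 1) ⊗ (+ 6 ⊗ y ⊕ + 1)) ⊕ + 1 ⊗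
        ((+ 6 ⊗ z ⊕ + 1) ⊗ (+ 6 ⊗ z ⊕ + 1))
  lem = ring-ℤ

-- The vanishing third term gives x² + 2y² the shape expected by `rep-abs` and `nat-squares`.
sum2 : ℕ → ℕ → ℕ
sum2 x y = 1 * (x * x) + 2 * (y * y) + 0 * (0 * 0)

Units3 : ℕ → Set
Units3 N = ∃ λ u → ∃ λ v → N ≡ sum2 u v × Three∤ u × Three∤ v

-- Multiplication by (1 ± √-2)².
rotate-√-2 : ∀ a b → ¬ (a % 3 ≡ 0 × b % 3 ≡ 0) → Units3 (9 * sum2 a b)
rotate-√-2 a b n = choose (multiple3? (A ⊕ B)) (multiple3? (A ⊖ B))
  where
  A = + a
  B = + b
  Goal = Units3 (9 * sum2 a b)
  l₀ : ∀ s t → + 9 ⊗ (+ 1 ⊗ (s ⊗ s) ⊕ + 2 ⊗ (t ⊗ t) ⊕ + 0 ⊗ (+ 0 ⊗ + 0)) ≡ + 1 ⊗ ((s ⊕ + 4 ⊗ t) ⊗ (s ⊕ + 4 ⊗ t)) ⊕ + 2 ⊗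
      ((+ 2 ⊗ s ⊖ t) ⊗ (+ 2 ⊗ s ⊖ t)) ⊕ + 0 ⊗ (+ 0 ⊗ + 0)
  l₀ = ring-ℤ
  l₁ : ∀ s t k → s ⊕ + 4 ⊗ t ≡ + 3 ⊗ k → s ⊕ t ≡ + 3 ⊗ (k ⊖ t)
  l₁ s t k e = trans (a′ s t) (trans (cong (_⊖ + 3 ⊗ t) e) (b′ k t))
    where a′ : ∀ s t → s ⊕ t ≡ s ⊕ + 4 ⊗ t ⊖ + 3 ⊗ t
          a′ = ring-ℤ
          b′ : ∀ k t → + 3 ⊗ k ⊖ + 3 ⊗ t ≡ + 3 ⊗ (k ⊖ t)
          b′ = ring-ℤ
  l₂ : ∀ s t k → + 2 ⊗ s ⊖ t ≡ + 3 ⊗ k → s ⊕ t ≡ + 3 ⊗ (s ⊖ k)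
  l₂ s t k e = trans (a′ s t) (trans (cong (_⊖_ (+ 3 ⊗ s)) e) (b′ s k))
    where a′ : ∀ s t → s ⊕ t ≡ + 3 ⊗ s ⊖ (+ 2 ⊗ s ⊖ t)
          a′ = ring-ℤ
          b′ : ∀ s k → + 3 ⊗ s ⊖ + 3 ⊗ k ≡ + 3 ⊗ (s ⊖ k)
          b′ = ring-ℤ
  go : ∀ T → T ⊗ T ≡ B ⊗ B → ¬ Multiple3 (A ⊕ T) → Goal
  go T et h = ℤ.∣ A ⊕ + 4 ⊗ T ∣ , ℤ.∣ + 2 ⊗ A ⊖ T ∣ ,
      rep-abs {1} {2} {0} (A ⊕ + 4 ⊗ T) (+ 2 ⊗ A ⊖ T) (+ 0) (trans (ℤ.pos-* 9 (sum2 a b))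
          (trans (cong (_⊗_ (+ 9)) (trans (nat-squares a b 0 1 2 0)
          (cong (λ y → + 1 ⊗ (A ⊗ A) ⊕ + 2 ⊗ y ⊕ + 0 ⊗ (+ 0 ⊗ + 0)) (sym et)))) (l₀ A T))) ,
      multiple3-abs (A ⊕ + 4 ⊗ T) (λ (k , e) → h (k ⊖ T , l₁ A T k e)) , multiple3-abs (+ 2 ⊗ A ⊖ T)
          (λ (k , e) → h (A ⊖ k , l₂ A T k e))
  neg : ∀ x → (⊝ x) ⊗ (⊝ x) ≡ x ⊗ x
  neg = ring-ℤ
  d₁ : ∀ s t k j → s ⊕ t ≡ + 3 ⊗ k → s ⊖ t ≡ + 3 ⊗ j → + 2 ⊗ s ≡ + 3 ⊗ (k ⊕ j) ⊕ + 3 ⊗ + 0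
  d₁ s t k j e f = trans (a′ s t) (trans (cong₂ _⊕_ e f) (b′ k j))
    where a′ : ∀ s t → + 2 ⊗ s ≡ (s ⊕ t) ⊕ (s ⊖ t)
          a′ = ring-ℤ
          b′ : ∀ k j → + 3 ⊗ k ⊕ + 3 ⊗ j ≡ + 3 ⊗ (k ⊕ j) ⊕ + 3 ⊗ + 0
          b′ = ring-ℤ
  d₂ : ∀ s t k j → s ⊕ t ≡ + 3 ⊗ k → s ⊖ t ≡ + 3 ⊗ j → + 2 ⊗ t ≡ + 3 ⊗ (k ⊖ j) ⊕ + 3 ⊗ + 0
  d₂ s t k j e f = trans (a′ s t) (trans (cong₂ _⊖_ e f) (b′ k j))
    where a′ : ∀ s t → + 2 ⊗ t ≡ (s ⊕ t) ⊖ (s ⊖ t)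
          a′ = ring-ℤ
          b′ : ∀ k j → + 3 ⊗ k ⊖ + 3 ⊗ j ≡ + 3 ⊗ (k ⊖ j) ⊕ + 3 ⊗ + 0
          b′ = ring-ℤ
  choose : Multiple3 (A ⊕ B) ⊎ ¬ Multiple3 (A ⊕ B) → Multiple3 (A ⊖ B) ⊎ ¬ Multiple3 (A ⊖ B) → Goal
  choose (inj₂ h) _ = go B refl h
  choose (inj₁ _) (inj₂ h) = go (⊝ B) (neg B) h
  choose (inj₁ (k , e)) (inj₁ (j , f)) = ⊥-elim (n
    ( abs-multiple3 a (via-double A (+ 0) (+ 3 ⊗ (k ⊕ j)) (d₁ A B k j e f) (k ⊕ j , refl))
    , abs-multiple3 b (via-double B (+ 0) (+ 3 ⊗ (k ⊖ j)) (d₂ A B k j e f) (k ⊖ j , refl))))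

-- The factor 9 pays for a rotation that leaves both coordinates prime to 3. If 3 divides a and b,
-- the recursive call already represents N itself by such coordinates, and one more rotation passes
-- to 9N.
units-3 : ∀ N a b → N ≡ sum2 a b → 1 ≤ N → Units3 (9 * N)
units-3 = <-rec _ step
  where
  step : ∀ N → (∀ {M} → M < N → ∀ a b → M ≡ sum2 a b → 1 ≤ M → Units3 (9 * M)) → ∀ a b → N ≡ sum2 a b → 1 ≤ N → Units3
      (9 * N)
  step N rec a b e 1≤N with (a % 3 ≟ 0) ×-dec (b % 3 ≟ 0)
  ... | no n = subst (λ x → Units3 (9 * x)) (sym e) (rotate-√-2 a b n)
  ... | yes (az , bz) = expand (rec M<N (a / 3) (b / 3) refl 1≤M)
    where
    M = sum2 (a / 3) (b / 3)
    N≡ : N ≡ 9 * M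
    N≡ = trans e (trans (cong₂ (λ x y → 1 * (x * x) + 2 * (y * y) + 0) (times-of 3 a az) (times-of 3 b bz))
        (l (a / 3) (b / 3)))
      where l : ∀ a b → 1 * (3 * a * (3 * a)) + 2 * (3 * b * (3 * b)) + 0 ≡ 9 * (1 * (a * a) + 2 * (b * b) + 0)
            l = ring-ℕ
    1≤M : 1 ≤ M
    1≤M = n≢0⇒n>0 λ z → <⇒≢ 1≤N (sym (trans N≡ (cong (9 *_) z)))
    M<N : M < N
    M<N = subst (M <_) (trans (*-comm M 9) (sym N≡)) (m<m*n M 9 {{>-nonZero 1≤M}} (s≤s (s≤s z≤n)))
    expand : Units3 (9 * M) → Units3 (9 * N)
    expand (s , t , e′ , s3 , t3) = subst (λ x → Units3 (9 * x)) (sym (trans N≡ e′)) (rotate-√-2 s t (λ (z , _) → s3 z))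

-- Halving 24n + 14 = a² + b² + c² with a even gives 12n + 7 = 2A² + 4B² + C². Modulo 3, either all
-- of A, B, C are prime to 3, or A and one other are both divisible by 3. In the latter case that
-- pair contributes 2(A² + 2B²) or C² + 2A², and `units-3` replaces it.
tuple-2 : Universal (+ 12) (+ 4) (+ 6) (+ 4) (+ 6) (+ 2)
tuple-2 = universal 6 7 2 4 1 6 1 3 1 6 1 (+ 12) (+ 4) (+ 6) (+ 4) (+ 6) (+ 2)
    (λ n → start n (sum-rep {1} (three-squares (6 * n + 3)))) lem
  where
  S2 : ℕ → Set
  S2 = Source 6 7 2 4 1 6 1 3 1 6 1
  Shape : ℕ → ℕ → ℕ → Set
  Shape i j k = i % 2 ≡ 0 × j % 2 ≡ 1 × k % 2 ≡ 1
  shape? : ∀ i j k → Dec (Shape i j k)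
  shape? i j k = (i % 2 ≟ 0) ×-dec ((j % 2 ≟ 1) ×-dec (k % 2 ≟ 1))
  table₄ : Table 4 1 1 1 2 λ i j k → Shape i j k ⊎ Shape j i k ⊎ Shape k i j
  table₄ = from-yes (table? 4 1 1 1 2 λ i j k → shape? i j k ⊎-dec (shape? j i k ⊎-dec shape? k i j))
  table₂ : Table 2 2 1 1 1 λ i j k → (j ≡ 0) ⊎ (k ≡ 0)
  table₂ = from-yes (table? 2 2 1 1 1 λ i j k → (j ≟ 0) ⊎-dec (k ≟ 0))
  table₃ : Table 3 2 4 1 1 λ i j k → (i ≢ 0 × j ≢ 0 × k ≢ 0) ⊎ (i ≡ 0 × j ≡ 0 × k ≢ 0) ⊎ (i ≡ 0 × k ≡ 0 × j ≢ 0)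
  table₃ = from-yes (table? 3 2 4 1 1 λ i j k → (¬? (i ≟ 0) ×-dec (¬? (j ≟ 0) ×-dec ¬? (k ≟ 0))) ⊎-dec
      (((i ≟ 0) ×-dec ((j ≟ 0) ×-dec ¬? (k ≟ 0))) ⊎-dec ((i ≟ 0) ×-dec ((k ≟ 0) ×-dec ¬? (j ≟ 0)))))
  table₄′ : Table 4 2 4 1 3 λ i j k → i % 2 ≡ 1 × k % 2 ≡ 1
  table₄′ = from-yes (table? 4 2 4 1 3 λ i j k → (i % 2 ≟ 1) ×-dec (k % 2 ≟ 1))
  l₀ : ∀ n → 4 * (6 * n + 3) + 2 ≡ 2 + (6 * n + 3) * 4
  l₀ = ring-ℕ
  l₁ : ∀ n → 2 * (12 * n + 7) ≡ 4 * (6 * n + 3) + 2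
  l₁ = ring-ℕ
  l₂ : ∀ a b c → 1 * (2 * a * (2 * a)) + 1 * b + 1 * c ≡ 2 * (2 * (a * a)) + (b + c)
  l₂ = ring-ℕ
  l₃ : ∀ a x y → 2 * (2 * a) + 2 * (x + y) ≡ 2 * (2 * a + 1 * x + 1 * y)
  l₃ = ring-ℕ
  l₄ : ∀ a x c → 2 * a + 1 * (2 * x * (2 * x)) + 1 * c ≡ 2 * a + 4 * (x * x) + 1 * c
  l₄ = ring-ℕ
  l₅ : ∀ a b c → 1 * a + 1 * b + 1 * c ≡ 1 * b + 1 * a + 1 * c
  l₅ = ring-ℕ
  l₆ : ∀ a b c → 1 * a + 1 * b + 1 * c ≡ 1 * c + 1 * a + 1 * b
  l₆ = ring-ℕ
  l₇ : ∀ n → 12 * n + 7 ≡ 3 + (3 * n + 1) * 4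
  l₇ = ring-ℕ
  l₈ : ∀ n → 12 * n + 7 ≡ 1 + (4 * n + 2) * 3
  l₈ = ring-ℕ
  l₉ : ∀ n → 12 * n + 7 ≡ 1 + (6 * n + 3) * 2
  l₉ = ring-ℕ
  l₁₀ : ∀ a b c → 2 * a + 1 * b + 1 * c ≡ 2 * a + 1 * c + 1 * b
  l₁₀ = ring-ℕ
  m₁ : ∀ a b c → 2 * (3 * a * (3 * a)) + 4 * (3 * b * (3 * b)) + c ≡ 2 * (9 * (1 * (a * a) + 2 * (b * b) + 0)) + c
  m₁ = ring-ℕ
  m₂ : ∀ u v c → 2 * (1 * u + 2 * v + 0) + c ≡ 2 * u + 4 * v + c
  m₂ = ring-ℕ
  m₃ : ∀ a b c → 2 * (3 * a * (3 * a)) + 4 * b + 1 * (3 * c * (3 * c)) ≡ 9 * (1 * (c * c) + 2 * (a * a) + 0) + 4 * b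
  m₃ = ring-ℕ
  m₄ : ∀ u v b → 1 * u + 2 * v + 0 + 4 * b ≡ 2 * v + 4 * b + 1 * u
  m₄ = ring-ℕ
  parities : ∀ n A B C → 12 * n + 7 ≡ 2 * (A * A) + 4 * (B * B) + 1 * (C * C) → Odd A × Odd C
  parities n A B C e = convert (table-lookup 4 2 4 1 3 A B C table₄′ e 3 (3 * n + 1) (l₇ n) refl)
    where
    convert : A % 4 % 2 ≡ 1 × C % 4 % 2 ≡ 1 → Odd A × Odd C
    convert (a , c) = %-via 2 2 A a , %-via 2 2 C c
  finish : ∀ n A B C → 12 * n + 7 ≡ 2 * (A * A) + 4 * (B * B) + 1 * (C * C) → Three∤ A → Three∤ B → Three∤ C → S2 n
  finish n A B C e a3 b3 c3 = A , B , C , e , unit-6 A (proj₁ (parities n A B C e)) a3 , unit-3 B b3 , unit-6 C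
      (proj₂ (parities n A B C e)) c3
  third-positive : ∀ x → x % 3 ≡ 0 → Odd x → 1 ≤ x / 3
  third-positive x z o = n≢0⇒n>0 λ x/3≡0 → 0≢1+n (trans (cong (_% 2) (sym (trans (times-of 3 x z) (cong (3 *_) x/3≡0))))
      o)
  adjust : ∀ n A B C → 12 * n + 7 ≡ 2 * (A * A) + 4 * (B * B) + 1 * (C * C) → S2 n
  adjust n A B C e = cases′ (table-lookup 3 2 4 1 1 A B C table₃ e 1 (4 * n + 2) (l₈ n) refl)
    where
    positive-sum : ∀ x y → 1 ≤ x ⊎ 1 ≤ y → 1 ≤ sum2 x y
    positive-sum x y (inj₁ p) = ≤-trans (*-mono-≤ p p) (≤-trans
        (≤-trans (m≤m+n (x * x) 0) (m≤m+n (1 * (x * x)) (2 * (y * y)))) (m≤m+n _ 0))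
    positive-sum x y (inj₂ p) = ≤-trans (*-mono-≤ p p) (≤-trans
        (≤-trans (m≤m+n (y * y) (y * y + 0)) (m≤n+m (2 * (y * y)) (1 * (x * x)))) (m≤m+n _ 0))
    cases′ : (Three∤ A × Three∤ B × Three∤ C) ⊎ (A % 3 ≡ 0 × B % 3 ≡ 0 × Three∤ C) ⊎ (A % 3 ≡ 0 × C % 3 ≡ 0 × Three∤ B)
        → S2 n
    cases′ (inj₁ (a3 , b3 , c3)) = finish n A B C e a3 b3 c3
    -- A is odd, hence not 0, which supplies the positivity required by `units-3`.
    cases′ (inj₂ (inj₁ (az , bz , c3))) = replace (units-3 (sum2 (A / 3) (B / 3)) (A / 3) (B / 3) refl
        (positive-sum (A / 3) (B / 3) (inj₁ (third-positive A az (proj₁ (parities n A B C e))))))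
      where
      replace : Units3 (9 * sum2 (A / 3) (B / 3)) → S2 n
      replace (u , v , e′ , u3 , v3) = finish n u v C (trans e (trans
          (cong₂ (λ x y → 2 * (x * x) + 4 * (y * y) + 1 * (C * C)) (times-of 3 A az) (times-of 3 B bz))
        (trans (m₁ (A / 3) (B / 3) (1 * (C * C))) (trans (cong (λ x → 2 * x + 1 * (C * C)) e′)
            (m₂ (u * u) (v * v) (1 * (C * C))))))) u3 v3 c3
    cases′ (inj₂ (inj₂ (az , cz , b3))) = replace (units-3 (sum2 (C / 3) (A / 3)) (C / 3) (A / 3) refl
        (positive-sum (C / 3) (A / 3) (inj₂ (third-positive A az (proj₁ (parities n A B C e))))))
      where
      replace : Units3 (9 * sum2 (C / 3) (A / 3)) → S2 n
      replace (u , v , e′ , u3 , v3) = finish n v B u (trans e (trans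
          (cong₂ (λ x y → 2 * (x * x) + 4 * (B * B) + 1 * (y * y)) (times-of 3 A az) (times-of 3 C cz))
        (trans (m₃ (A / 3) (B * B) (C / 3)) (trans (cong (λ x → x + 4 * (B * B)) e′) (m₄ (u * u) (v * v) (B * B)))))) v3
            b3 u3
  halve : ∀ n a b c → 4 * (6 * n + 3) + 2 ≡ sum3 a b c → Shape (a % 4) (b % 4) (c % 4) → S2 n
  halve n a b c e (az , bo , co) = join (half-sum b c (%-via 2 2 b
      (trans (trans bo (sym co)) (m∣n⇒o%n%m≡o%m 2 4 c (divides 2 refl)))))
    where
    join : (∃ λ x → ∃ λ y → b * b + c * c ≡ 2 * (x * x + y * y)) → S2 n
    join (x , y , hs) = choose (table-lookup 2 2 1 1 1 (a / 2) x y table₂ e′ 1 (6 * n + 3) (l₉ n) refl)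
      where
      e′ : 12 * n + 7 ≡ 2 * (a / 2 * (a / 2)) + 1 * (x * x) + 1 * (y * y)
      e′ = *-cancelˡ-≡ _ _ 2 (trans (l₁ n) (trans e (trans (cong (λ t → 1 * (t * t) + 1 * (b * b) + 1 * (c * c))
          (half-of a (%-via 2 2 a az)))
        (trans (l₂ (a / 2) (b * b) (c * c)) (trans (cong (λ t → 2 * (2 * (a / 2 * (a / 2))) + t) hs)
            (l₃ (a / 2 * (a / 2)) (x * x) (y * y)))))))
      choose : x % 2 ≡ 0 ⊎ y % 2 ≡ 0 → S2 n
      choose (inj₁ xz) = adjust n (a / 2) (x / 2) y (trans e′ (trans
          (cong (λ t → 2 * (a / 2 * (a / 2)) + 1 * (t * t) + 1 * (y * y)) (half-of x xz))
          (l₄ (a / 2 * (a / 2)) (x / 2) (y * y))))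
      choose (inj₂ yz) = adjust n (a / 2) (y / 2) x (trans e′ (trans (l₁₀ (a / 2 * (a / 2)) (x * x) (y * y))
          (trans (cong (λ t → 2 * (a / 2 * (a / 2)) + 1 * (t * t) + 1 * (x * x)) (half-of y yz))
          (l₄ (a / 2 * (a / 2)) (y / 2) (x * x)))))
  start : ∀ n → Rep 1 1 1 (4 * (6 * n + 3) + 2) → S2 n
  start n (a , b , c , e) = choose (table-lookup 4 1 1 1 2 a b c table₄ e 2 (6 * n + 3) (l₀ n) refl)
    where
    choose : Shape (a % 4) (b % 4) (c % 4) ⊎ Shape (b % 4) (a % 4) (c % 4) ⊎ Shape (c % 4) (a % 4) (b % 4) → S2 n
    choose (inj₁ s) = halve n a b c e s
    choose (inj₂ (inj₁ s)) = halve n b a c (trans e (l₅ (a * a) (b * b) (c * c))) s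
    choose (inj₂ (inj₂ s)) = halve n c a b (trans e (l₆ (a * a) (b * b) (c * c))) s
  lem : ∀ x y z → + 6 ⊗ (x ⊗ (+ 12 ⊗ x ⊕ + 4) ⊕ y ⊗ (+ 6 ⊗ y ⊕ + 4) ⊕ z ⊗ (+ 6 ⊗ z ⊕ + 2)) ⊕ + 7
    ≡ + 2 ⊗ ((+ 6 ⊗ x ⊕ + 1) ⊗ (+ 6 ⊗ x ⊕ + 1)) ⊕ + 4 ⊗ ((+ 3 ⊗ y ⊕ + 1) ⊗ (+ 3 ⊗ y ⊕ + 1)) ⊕ + 1 ⊗
        ((+ 6 ⊗ z ⊕ + 1) ⊗ (+ 6 ⊗ z ⊕ + 1))
  lem = ring-ℤ

theorem2p3 : Universal (+ 12) (+ 4) (+ 3) (+ 1) (+ 2) (+ 0)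
    × Universal (+ 12) (+ 4) (+ 6) (+ 4) (+ 6) (+ 2)
    × Universal (+ 12) (+ 8) (+ 3) (+ 1) (+ 3) (+ 1)
    × Universal (+ 12) (+ 6) (+ 8) (+ 2) (+ 3) (+ 1)
    × Universal (+ 12) (+ 6) (+ 8) (+ 6) (+ 3) (+ 1)
    × Universal (+ 12) (+ 8) (+ 3) (+ 1) (+ 2) (+ 0)
    × Universal (+ 12) (+ 8) (+ 5) (+ 3) (+ 5) (+ 1)
    × Universal (+ 12) (+ 8) (+ 4) (+ 2) (+ 4) (+ 2)
    × Universal (+ 12) (+ 8) (+ 8) (+ 4) (+ 2) (+ 0)
    × Universal (+ 12) (+ 8) (+ 8) (+ 4) (+ 3) (+ 1)
    × Universal (+ 12) (+ 8) (+ 12) (+ 4) (+ 2) (+ 0)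
theorem2p3 = tuple-1 , tuple-2 , tuple-3 , tuple-4 , tuple-5 , tuple-6 , tuple-7 , tuple-8 , tuple-9 , tuple-10 ,
    tuple-11
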